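{- Let $m\ge1$ and let $G_1,\dots,G_m$ be graphs each of which is either a clique $K_n$ (for some $n\ge1$) or a cycle $C_a$ (for some $a\ge2$). Then the adjacent cycle+clique chain $G_1+G_2+\cdots+G_m$ is $e$-positive.
   Context: $K_n$ is the graph on $\{1,\dots,n\}$ with an edge between every pair of distinct vertices. $C_a$ is the cycle graph on $\{1,\dots,a\}$ with edges $(1,2),(2,3),\dots,(a-1,a),(a,1)$ (for $a=2$ this is a single edge). If $G_1,G_2$ are graphs with vertices labeled $1,\dots,k_1$ and $1,\dots,k_2$, then $G_1+G_2$ is the graph on $\{1,\dots,k_1+k_2-1\}$ with edge set $E(G_1)\cup\{(i+k_1-1,j+k_1-1):(i,j)\in E(G_2)\}$, i.e. the last vertex of $G_1$ is identified with the first vertex of $G_2$; this operation is associative. The chromatic symmetric function of a graph $G$ with $n$ vertices is $X_G(\boldsymbol{x})=\sum_\kappa\prod_{v\in V(G)}x_{\kappa(v)}$, summed over proper colorings $\kappa:V(G)\to\mathbb{N}$, in infinitely many variables $\boldsymbol{x}=(x_i)_{i\in\mathbb{N}}$. $e_k=\sum_{i_1<\cdots<i_k}x_{i_1}\cdots x_{i_k}$ and $e_\lambda=\prod_i e_{\lambda_i}$ for a partition $\lambda$. $X_G$ is uniquely a linear combination $\sum_\lambda c_\lambda e_\lambda$ over partitions $\lambda$ of $n$, and $G$ is $e$-positive if all $c_\lambda\ge0$. -}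

module Defs where

open import Data.Bool using (if_then_else_)
open import Data.Fin using (Fin; toℕ)
import Data.Fin.Properties as Fin
open import Data.Integer as ℤ using (ℤ; +_; 0ℤ; 1ℤ)
open import Data.List as List using (List; []; _∷_; foldr; upTo; filter; length; cartesianProductWith; concatMap)
open import Data.List.NonEmpty as List⁺ using (List⁺)
open import Data.List.Relation.Unary.All as All using (All)
open import Data.List.Relation.Unary.Linked as Linked using (Linked)
open import Data.Nat using (ℕ; zero; suc; _+_; _∸_; _≤_; _<_; _≥_; s≤s; _≟_; _≤?_; _<?_; _≥?_)
open import Data.Nat.ListAction using (sum)
open import Data.Nat.Properties using (+-cancelʳ-≡; suc-injective; 1+n≢n)
open import Data.Product using (∃; ∃₂; _×_; _,_)
open import Data.Sum as Sum using (_⊎_; inj₁; inj₂; [_,_]′)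
open import Data.Vec using (Vec; []; _∷_; tabulate; lookup; count; replicate; zipWith; toList)
open import Data.Vec.Properties using (≡-dec)
import Data.Vec.Relation.Unary.Linked as VecLinked
open import Relation.Binary.Definitions using (Decidable; Symmetric; Irreflexive)
open import Relation.Binary.PropositionalEquality using (_≡_; _≢_; refl; sym; trans)
import Relation.Unary as Unary
open import Relation.Nullary using (¬_; does; ¬?)
open import Relation.Nullary.Decidable using (_×-dec_; _⊎-dec_; _→-dec_)

-- The vertices 1, …, n are the elements of Fin n, so all labels are
-- shifted down by one.
record Graph : Set₁ where
  field
    order  : ℕ
    Adj    : Fin order → Fin order → Set
    adj?   : Decidable Adj
    symm   : Symmetric Adj
    irrefl : Irreflexive _≡_ Adj

open Graph public using (order)

K : ℕ → Graph
K n = record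
  { order  = n
  ; Adj    = _≢_
  ; adj?   = λ i j → ¬? (i Fin.≟ j)
  ; symm   = λ i≢j j≡i → i≢j (sym j≡i)
  ; irrefl = λ i≡j i≢j → i≢j i≡j
  }

Next : (a : ℕ) → Fin a → Fin a → Set
Next a i j = toℕ j ≡ suc (toℕ i) ⊎ (suc (toℕ i) ≡ a × toℕ j ≡ 0)

next? : ∀ a → Decidable (Next a)
next? a i j = (toℕ j ≟ suc (toℕ i)) ⊎-dec ((suc (toℕ i) ≟ a) ×-dec (toℕ j ≟ 0))

next-irrefl : ∀ {a} → 2 ≤ a → (i : Fin a) → ¬ Next a i i
next-irrefl _ i (inj₁ i≡1+i) = 1+n≢n (sym i≡1+i)
next-irrefl (s≤s (s≤s _)) i (inj₂ (1+i≡a , i≡0))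
  with () ← trans (sym i≡0) (suc-injective 1+i≡a)

C : (a : ℕ) → 2 ≤ a → Graph
C a 2≤a = record
  { order  = a
  ; Adj    = λ i j → Next a i j ⊎ Next a j i
  ; adj?   = λ i j → next? a i j ⊎-dec next? a j i
  ; symm   = Sum.swap
  ; irrefl = λ { {i} refl → [ next-irrefl 2≤a i , next-irrefl 2≤a i ]′ }
  }

-- The image of the edge set of H under the shift i ↦ i + s, inside a
-- graph on n vertices.
ShiftedAdj : (H : Graph) (s n : ℕ) → Fin n → Fin n → Set
ShiftedAdj H s n u v =
  ∃₂ λ i j → Graph.Adj H i j × toℕ u ≡ toℕ i + s × toℕ v ≡ toℕ j + s

shiftedAdj? : ∀ H s n → Decidable (ShiftedAdj H s n)
shiftedAdj? H s n u v = Fin.any? λ i → Fin.any? λ j →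
  Graph.adj? H i j ×-dec (toℕ u ≟ toℕ i + s) ×-dec (toℕ v ≟ toℕ j + s)

shiftedAdj-sym : ∀ H s n → Symmetric (ShiftedAdj H s n)
shiftedAdj-sym H s n (i , j , ij , p , q) = j , i , Graph.symm H ij , q , p

shiftedAdj-irrefl : ∀ H s n → Irreflexive _≡_ (ShiftedAdj H s n)
shiftedAdj-irrefl H s n refl (i , j , ij , p , q) =
  Graph.irrefl H (Fin.toℕ-injective (+-cancelʳ-≡ s (toℕ i) (toℕ j) (trans (sym p) q))) ij

-- Identifies the last vertex of G with the first vertex of H.
infixr 6 _⊕_
_⊕_ : Graph → Graph → Graph
G ⊕ H = record
  { order  = n
  ; Adj    = λ u v → ShiftedAdj G 0 n u v ⊎ ShiftedAdj H s n u v
  ; adj?   = λ u v → shiftedAdj? G 0 n u v ⊎-dec shiftedAdj? H s n u v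
  ; symm   = Sum.map (shiftedAdj-sym G 0 n) (shiftedAdj-sym H s n)
  ; irrefl = λ u≡v → [ shiftedAdj-irrefl G 0 n u≡v , shiftedAdj-irrefl H s n u≡v ]′
  }
  where
  n s : ℕ
  n = order G + order H ∸ 1
  s = order G ∸ 1

chain : List⁺ Graph → Graph
chain = List⁺.foldr₁ _⊕_

data CliqueOrCycle : Graph → Set₁ where
  clique : ∀ n → 1 ≤ n → CliqueOrCycle (K n)
  cycle  : ∀ a (2≤a : 2 ≤ a) → CliqueOrCycle (C a 2≤a)

-- Formal power series over ℤ in the variables x₀, x₁, x₂, …
-- f N α is the coefficient in f of x₀^α₀ ⋯ x_{N-1}^α_{N-1}.  Every
-- monomial in the xᵢ has this form for some N.  (It does so for several
-- N, because trailing zero exponents may be appended; the series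
-- constructed below do not depend on this choice.)
PowerSeries : Set
PowerSeries = (N : ℕ) → Vec ℕ N → ℤ

infix 4 _≈_
_≈_ : PowerSeries → PowerSeries → Set
f ≈ g = ∀ N α → f N α ≡ g N α

sumOver : {A : Set} → List A → (A → ℤ) → ℤ
sumOver xs f = foldr (λ x s → f x ℤ.+ s) 0ℤ xs

𝟙 : PowerSeries
𝟙 N α = if does (≡-dec _≟_ α (replicate N 0)) then 1ℤ else 0ℤ

divisors : ∀ {N} → Vec ℕ N → List (Vec ℕ N)
divisors []      = [] ∷ []
divisors (a ∷ α) = cartesianProductWith _∷_ (upTo (suc a)) (divisors α)

infixl 7 _·_
_·_ : PowerSeries → PowerSeries → PowerSeries
(f · g) N α = sumOver (divisors α) λ β → f N β ℤ.* g N (zipWith _∸_ α β)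

words : {A : Set} → List A → (k : ℕ) → List (Vec A k)
words xs zero    = [] ∷ []
words xs (suc k) = cartesianProductWith _∷_ xs (words xs k)

exponents : ∀ {k} N → Vec ℕ k → Vec ℕ N
exponents N w = tabulate λ i → count (toℕ i ≟_) w

-- The series Σ_w x_{w₁} ⋯ x_{w_k}, summed over all w ∈ ℕᵏ satisfying P.
-- The words contributing to the coefficient of a monomial in
-- x₀, …, x_{N-1} have all their letters below N, so only these are
-- counted.
sumOfMonomials : ∀ {k} {P : Vec ℕ k → Set} → Unary.Decidable P → PowerSeries
sumOfMonomials {k} P? N α =
  + length (filter (λ w → P? w ×-dec ≡-dec _≟_ (exponents N w) α) (words (upTo N) k))

e : ℕ → PowerSeries
e k = sumOfMonomials {k} (VecLinked.linked? _<?_)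

e[_] : List ℕ → PowerSeries
e[ μ ] = foldr (λ k f → e k · f) 𝟙 μ

-- A colouring κ : V(G) → ℕ is given as the vector of its values.
Proper : (G : Graph) → Vec ℕ (order G) → Set
Proper G κ = ∀ u v → Graph.Adj G u v → lookup κ u ≢ lookup κ v

proper? : ∀ G → Unary.Decidable (Proper G)
proper? G κ = Fin.all? λ u → Fin.all? λ v →
  Graph.adj? G u v →-dec ¬? (lookup κ u ≟ lookup κ v)

X : Graph → PowerSeries
X G = sumOfMonomials (proper? G)

IsPartition : ℕ → List ℕ → Set
IsPartition n μ = All (1 ≤_) μ × Linked _≥_ μ × sum μ ≡ n

isPartition? : ∀ n → Unary.Decidable (IsPartition n)
isPartition? n μ = All.all? (1 ≤?_) μ ×-dec Linked.linked? _≥?_ μ ×-dec (sum μ ≟ n)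

-- Each partition of n occurs exactly once: it has at most n parts, each
-- of them at most n.
partitions : ℕ → List (List ℕ)
partitions n =
  filter (isPartition? n)
    (concatMap (λ k → List.map toList (words (upTo (suc n)) k)) (upTo (suc n)))

-- Only the values of c at the partitions of n matter.
eCombination : (n : ℕ) → (List ℕ → ℤ) → PowerSeries
eCombination n c N α = sumOver (partitions n) λ μ → c μ ℤ.* e[ μ ] N α

-- Since the e-expansion of X G is unique, G is e-positive precisely when
-- some expansion has nonnegative coefficients.  The eμ form a ℤ-basis of
-- the symmetric functions with integer coefficients, so integer
-- coefficients suffice.
EPositive : Graph → Set
EPositive G = ∃ λ (c : List ℕ → ℤ) →
  X G ≈ eCombination (order G) c ×
  (∀ μ → IsPartition (order G) μ → 0ℤ ℤ.≤ c μ)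

{-# OPTIONS --safe #-}
module Submission where

-- Give every graph of the chain its first vertex as root, and let its
-- rooted series at d be the part of the chromatic symmetric function due
-- to the colourings in which the root has colour d.  Let u k d be the sum
-- of the terms of e k which contain the variable x d, so that the sum of
-- u k d over all d is k e k.  It is enough to show that the rooted series
-- of a chain is a combination of the u k d whose coefficients are
-- e-positive and do not depend on d.  Gluing a clique or a cycle to the
-- root acts linearly on rooted series, so one only has to see what it does
-- to u k.  For an edge, u (k + 1) becomes u (k + 2) + k e (k + 1) u 1, and
-- iterating this gives paths.  A cycle is a path with the walks returning
-- to d removed; the negative terms that arise this way contain products
-- u k u j, which for k ≤ j are rewritten by
--   u k u j = Σ_{1≤i≤k} u i e (k+j-i) - Σ_{i<k} u (k+j-i) e i
-- and then cancel.  Cliques use the same identity.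

open import Defs hiding (_≈_; e)
open import Algebra.Bundles using (CommutativeRing; RawRing)
import Algebra.Construct.Pointwise as Pointwise
import Algebra.Properties.AbelianGroup as AbelianGroupProperties
import Algebra.Properties.CommutativeSemigroup as CommutativeSemigroupProperties
import Algebra.Properties.Ring as RingProperties
import Algebra.Solver.Ring as RingSolver
open import Algebra.Solver.Ring.AlmostCommutativeRing
  using (AlmostCommutativeRing; fromCommutativeRing; _-Raw-AlmostCommutative⟶_)
open import Data.Bool using (if_then_else_)
open import Data.Fin as Fin using (Fin; toℕ; fromℕ<)
import Data.Fin.Properties as Fin
open import Data.Integer as ℤ using (ℤ; +_; -[1+_]; 0ℤ; 1ℤ)
import Data.Integer.Properties as ℤ
open import Data.List as List
  using (List; []; _∷_; _++_; foldr; upTo; applyUpTo; filter; length; cartesianProductWith; concatMap)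
open import Data.List.NonEmpty using (List⁺; _∷_)
open import Data.List.NonEmpty.Relation.Unary.All using (All; _∷_)
import Data.List.Properties as List
open import Data.List.Relation.Binary.Permutation.Propositional using (_↭_; ↭-sym)
  renaming (refl to ↭-refl; prep to ↭-prep; swap to ↭-swap; trans to ↭-trans)
open import Data.List.Relation.Binary.Permutation.Propositional.Properties using (All-resp-↭)
open import Data.List.Relation.Unary.All as ListAll using ([]; _∷_) renaming (All to ListAll)
import Data.List.Relation.Unary.All.Properties as ListAll
open import Data.List.Relation.Unary.AllPairs using (AllPairs; []; _∷_; allPairs?)
open import Data.List.Relation.Unary.Linked using (Linked; []; [-]; _∷_; linked?)
open import Data.Maybe using (Maybe; just; nothing)
open import Data.Nat as ℕ using (ℕ; zero; suc; z≤n; s≤s; _<_; _≤_; _∸_; _!)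
open import Data.Nat.ListAction using (sum)
import Data.Nat.ListAction.Properties as ℕ
import Data.Nat.Properties as ℕ
open import Data.Nat.Solver using (module +-*-Solver)
open import Data.Product using (_×_; _,_; proj₁; proj₂; ∃)
open import Data.Sum using (_⊎_; inj₁; inj₂)
open import Data.Unit using (⊤; tt)
open import Data.Vec as Vec using (Vec; []; _∷_; tabulate; count; replicate; zipWith; toList; lookup)
import Data.Vec.Properties as Vec
import Data.Vec.Relation.Unary.Linked as VecLinked
open import Function using (_∘_; id)
open import Level using (0ℓ)
import Relation.Binary.Construct.Flip.EqAndOrd as Flip
open import Data.List.Sort (Flip.decTotalOrder ℕ.≤-decTotalOrder) using (sort; sort-↭; sort-↗)
open import Relation.Binary.PropositionalEquality as ≡ using (_≡_; _≢_; cong; cong₂)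
import Relation.Binary.Reasoning.Setoid as SetoidReasoning
open import Relation.Nullary using (Dec; yes; no; ¬_; does; ¬?)
open import Relation.Nullary.Decidable using (_×-dec_; _→-dec_; dec-true; dec-false)
open import Relation.Nullary.Negation using (contradiction)
import Relation.Unary as Unary

-- The expansion must have the same coefficients for every number N of colours, while each identity
-- is proved in a ring with N fixed. Positivity is therefore carried by derivations about families
-- indexed by N (`EPos`, `RootPos`). One list of monomials, common to all N, is read off such a
-- derivation, and the coefficients are multiplicities in that list, hence nonnegative. The obstacle
-- is that both gluings require the two ends to have different colours, and so subtract something.
-- For a cycle, the closed walks contribute j u (k+1) u (j+1), to be set against path terms in which
-- u (i+1) e (k+j+1-i) has coefficient k+j-i. Expanding the product takes j off these coefficients
-- and leaves k-i, which is nonnegative for i ≤ k; so the expansion of the product must stop at the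
-- smaller of its two indices. For a clique, the sum `S` k a obeys a recursion that raises k and
-- lowers a. It can be run forwards to a = 0 or backwards to k = 0, and the shorter run yields
-- nonnegative coefficients.

-- Integer multiples and polynomial identities in a commutative ring

module Scalars (R : CommutativeRing 0ℓ 0ℓ) where
  open CommutativeRing R
  open RingProperties ring using (-‿distribˡ-*; -‿distribʳ-*; -‿involutive; -0#≈0#)
  open AbelianGroupProperties +-abelianGroup using (⁻¹-∙-comm)
  open SetoidReasoning setoid

  nat : ℕ → Carrier
  nat zero    = 0#
  nat (suc n) = 1# + nat n

  nat-+ : ∀ m n → nat (m ℕ.+ n) ≈ nat m + nat n
  nat-+ zero    n = sym (+-identityˡ _)
  nat-+ (suc m) n = trans (+-congˡ (nat-+ m n)) (sym (+-assoc _ _ _))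

  nat-* : ∀ m n → nat (m ℕ.* n) ≈ nat m * nat n
  nat-* zero    n = sym (zeroˡ _)
  nat-* (suc m) n = begin
    nat (n ℕ.+ m ℕ.* n)          ≈⟨ nat-+ n (m ℕ.* n) ⟩
    nat n + nat (m ℕ.* n)        ≈⟨ +-cong (sym (*-identityˡ _)) (nat-* m n) ⟩
    1# * nat n + nat m * nat n   ≈⟨ distribʳ _ _ _ ⟨
    (1# + nat m) * nat n         ∎

  int : ℤ → Carrier
  int (+ n)    = nat n
  int -[1+ n ] = - nat (suc n)

  private
    cancel-1 : ∀ a b → (1# + a) - (1# + b) ≈ a - b
    cancel-1 a b = begin
      (1# + a) - (1# + b)       ≈⟨ +-cong (+-comm _ _) (sym (⁻¹-∙-comm _ _)) ⟩
      (a + 1#) + (- 1# + - b)   ≈⟨ +-assoc _ _ _ ⟩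
      a + (1# + (- 1# + - b))   ≈⟨ +-congˡ (+-assoc _ _ _) ⟨
      a + ((1# + - 1#) + - b)   ≈⟨ +-congˡ (+-congʳ (-‿inverseʳ _)) ⟩
      a + (0# + - b)            ≈⟨ +-congˡ (+-identityˡ _) ⟩
      a - b                     ∎

    int-⊖ : ∀ m n → int (m ℤ.⊖ n) ≈ nat m - nat n
    int-⊖ zero    zero    = sym (-‿inverseʳ _)
    int-⊖ zero    (suc n) = sym (+-identityˡ _)
    int-⊖ (suc m) zero    = sym (trans (+-congˡ -0#≈0#) (+-identityʳ _))
    int-⊖ (suc m) (suc n) = begin
      int (suc m ℤ.⊖ suc n)  ≡⟨ ≡.cong int (ℤ.[1+m]⊖[1+n]≡m⊖n m n) ⟩
      int (m ℤ.⊖ n)          ≈⟨ int-⊖ m n ⟩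
      nat m - nat n          ≈⟨ cancel-1 _ _ ⟨
      nat (suc m) - nat (suc n) ∎

    int-+ : ∀ i j → int (i ℤ.+ j) ≈ int i + int j
    int-+ (+ m)    (+ n)    = nat-+ m n
    int-+ (+ m)    -[1+ n ] = int-⊖ m (suc n)
    int-+ -[1+ m ] (+ n)    = trans (int-⊖ n (suc m)) (+-comm _ _)
    int-+ -[1+ m ] -[1+ n ] = begin
      - nat (suc (suc (m ℕ.+ n)))      ≡⟨ ≡.cong (λ k → - nat (suc k)) (ℕ.+-suc m n) ⟨
      - nat (suc m ℕ.+ suc n)          ≈⟨ -‿cong (nat-+ (suc m) (suc n)) ⟩
      - (nat (suc m) + nat (suc n))    ≈⟨ ⁻¹-∙-comm _ _ ⟨
      - nat (suc m) + - nat (suc n)    ∎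

    int-neg : ∀ i → int (ℤ.- i) ≈ - int i
    int-neg (+ zero)  = sym -0#≈0#
    int-neg (+ suc n) = refl
    int-neg -[1+ n ]  = sym (-‿involutive _)

    int-+* : ∀ m j → int (+ m ℤ.* j) ≈ nat m * int j
    int-+* m (+ n) = trans (reflexive (≡.cong int (≡.sym (ℤ.pos-* m n)))) (nat-* m n)
    int-+* m -[1+ n ] = begin
      int (+ m ℤ.* -[1+ n ])          ≡⟨ ≡.cong int (ℤ.neg-distribʳ-* (+ m) (+ suc n)) ⟨
      int (ℤ.- (+ m ℤ.* + suc n))     ≈⟨ int-neg (+ m ℤ.* + suc n) ⟩
      - int (+ m ℤ.* + suc n)         ≈⟨ -‿cong (int-+* m (+ suc n)) ⟩
      - (nat m * nat (suc n))         ≈⟨ -‿distribʳ-* _ _ ⟩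
      nat m * - nat (suc n)           ∎

    int-* : ∀ i j → int (i ℤ.* j) ≈ int i * int j
    int-* (+ m)    j = int-+* m j
    int-* -[1+ m ] j = begin
      int (-[1+ m ] ℤ.* j)            ≡⟨ ≡.cong int (ℤ.neg-distribˡ-* (+ suc m) j) ⟨
      int (ℤ.- (+ suc m ℤ.* j))       ≈⟨ int-neg (+ suc m ℤ.* j) ⟩
      - int (+ suc m ℤ.* j)           ≈⟨ -‿cong (int-+* (suc m) j) ⟩
      - (nat (suc m) * int j)         ≈⟨ -‿distribˡ-* _ _ ⟩
      - nat (suc m) * int j           ∎

    ℤ-rawRing : RawRing 0ℓ 0ℓ
    ℤ-rawRing = CommutativeRing.rawRing ℤ.+-*-commutativeRing

    almostRing : AlmostCommutativeRing 0ℓ 0ℓ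
    almostRing = fromCommutativeRing R

    morphism : ℤ-rawRing -Raw-AlmostCommutative⟶ almostRing
    morphism = record
      { ⟦_⟧    = int
      ; +-homo = int-+
      ; *-homo = int-*
      ; -‿homo = int-neg
      ; 0-homo = refl
      -- The integer 1 is interpreted as 1# + 0#, which is not literally 1#; this is why later
      -- identities feed 1# to the solver as a variable `o`.
      ; 1-homo = +-identityʳ 1#
      }

    int≟ : ∀ i j → Maybe (int i ≈ int j)
    int≟ i j with i ℤ.≟ j
    ... | yes i≡j = just (reflexive (≡.cong int i≡j))
    ... | no  _   = nothing

  open RingSolver ℤ-rawRing almostRing morphism int≟ public
    using (solve; _:=_; _:+_; _:*_; _:-_; :-_; con)

-- Finite sums and indicator functions

module Sums (R : CommutativeRing 0ℓ 0ℓ) where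
  open CommutativeRing R
  open Scalars R public
  open SetoidReasoning setoid

  ∑ : ℕ → (ℕ → Carrier) → Carrier
  ∑ zero    f = 0#
  ∑ (suc n) f = f 0 + ∑ n (λ i → f (suc i))

  ∑-cong< : ∀ n {f g} → (∀ i → i < n → f i ≈ g i) → ∑ n f ≈ ∑ n g
  ∑-cong< zero    eq = refl
  ∑-cong< (suc n) eq =
    +-cong (eq 0 (s≤s z≤n)) (∑-cong< n (λ i i<n → eq (suc i) (s≤s i<n)))

  ∑-cong : ∀ n {f g} → (∀ i → f i ≈ g i) → ∑ n f ≈ ∑ n g
  ∑-cong n eq = ∑-cong< n (λ i _ → eq i)

  ∑-0 : ∀ n → ∑ n (λ _ → 0#) ≈ 0#
  ∑-0 zero    = refl
  ∑-0 (suc n) = trans (+-identityˡ _) (∑-0 n)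

  ∑-+ : ∀ n f g → ∑ n (λ i → f i + g i) ≈ ∑ n f + ∑ n g
  ∑-+ zero    f g = sym (+-identityˡ _)
  ∑-+ (suc n) f g = trans (+-congˡ (∑-+ n _ _))
    (solve 4 (λ a b c d → (a :+ b) :+ (c :+ d) := (a :+ c) :+ (b :+ d)) refl _ _ _ _)

  ∑-*ˡ : ∀ n a f → ∑ n (λ i → a * f i) ≈ a * ∑ n f
  ∑-*ˡ zero    a f = sym (zeroʳ _)
  ∑-*ˡ (suc n) a f = trans (+-congˡ (∑-*ˡ n a _)) (sym (distribˡ _ _ _))

  ∑-*ʳ : ∀ n a f → ∑ n (λ i → f i * a) ≈ ∑ n f * a
  ∑-*ʳ n a f = trans (∑-cong n (λ _ → *-comm _ _)) (trans (∑-*ˡ n a f) (*-comm _ _))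

  ∑-neg : ∀ n f → ∑ n (λ i → - f i) ≈ - ∑ n f
  ∑-neg zero    f = solve 0 (con 0ℤ := :- con 0ℤ) refl
  ∑-neg (suc n) f = trans (+-congˡ (∑-neg n _))
    (solve 2 (λ a b → :- a :+ :- b := :- (a :+ b)) refl _ _)

  ∑-minus : ∀ n f g → ∑ n (λ i → f i - g i) ≈ ∑ n f - ∑ n g
  ∑-minus n f g = trans (∑-+ n f (λ i → - g i)) (+-congˡ (∑-neg n g))

  ∑-swap : ∀ m n (f : ℕ → ℕ → Carrier) → ∑ m (λ i → ∑ n (λ j → f i j)) ≈ ∑ n (λ j → ∑ m (λ i → f i j))
  ∑-swap zero    n f = sym (∑-0 n)
  ∑-swap (suc m) n f = trans (+-congˡ (∑-swap m n _)) (sym (∑-+ n _ _))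

  ∑-last : ∀ n f → ∑ (suc n) f ≈ ∑ n f + f n
  ∑-last zero    f = +-comm _ _
  ∑-last (suc n) f = trans (+-congˡ (∑-last n _)) (sym (+-assoc _ _ _))

  ∑-split : ∀ m n f → ∑ (m ℕ.+ n) f ≈ ∑ m f + ∑ n (λ i → f (m ℕ.+ i))
  ∑-split zero    n f = sym (+-identityˡ _)
  ∑-split (suc m) n f = trans (+-congˡ (∑-split m n _)) (sym (+-assoc _ _ _))

  ind : ∀ {P : Set} → Dec P → Carrier
  ind (yes _) = 1#
  ind (no _)  = 0#

  ind-yes : ∀ {P : Set} (d : Dec P) → P → ind d ≈ 1#
  ind-yes (yes _) p = refl
  ind-yes (no ¬p) p = contradiction p ¬p

  ind-no : ∀ {P : Set} (d : Dec P) → ¬ P → ind d ≈ 0#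
  ind-no (yes p) ¬p = contradiction p ¬p
  ind-no (no _)  ¬p = refl

  ind-⇔ : ∀ {P Q : Set} (d : Dec P) (d′ : Dec Q) → (P → Q) → (Q → P) → ind d ≈ ind d′
  ind-⇔ (yes p) d′ f g = sym (ind-yes d′ (f p))
  ind-⇔ (no ¬p) d′ f g = sym (ind-no d′ (λ q → ¬p (g q)))

  ind-× : ∀ {P Q S : Set} (d : Dec S) (p : Dec P) (q : Dec Q) →
          (S → P × Q) → (P → Q → S) → ind d ≈ ind p * ind q
  ind-× d (yes p) (yes q) f g = trans (ind-yes d (g p q)) (sym (*-identityˡ _))
  ind-× d (yes p) (no ¬q) f g = trans (ind-no d (λ s → ¬q (proj₂ (f s)))) (sym (zeroʳ _))
  ind-× d (no ¬p) q       f g = trans (ind-no d (λ s → ¬p (proj₁ (f s)))) (sym (zeroˡ _))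

  δ : ℕ → ℕ → Carrier
  δ c d = ind (c ℕ.≟ d)

  δ-suc : ∀ c d → δ (suc c) (suc d) ≈ δ c d
  δ-suc c d = ind-⇔ (suc c ℕ.≟ suc d) (c ℕ.≟ d) ℕ.suc-injective (≡.cong suc)

  δ-sym : ∀ c d → δ c d ≈ δ d c
  δ-sym c d = ind-⇔ (c ℕ.≟ d) (d ℕ.≟ c) ≡.sym ≡.sym

  δ-refl : ∀ c → δ c c ≈ 1#
  δ-refl c = ind-yes (c ℕ.≟ c) ≡.refl

  ∑-δ : ∀ n {d} (f : ℕ → Carrier) → d < n → ∑ n (λ c → δ d c * f c) ≈ f d
  ∑-δ (suc n) {zero} f _ = begin
    δ 0 0 * f 0 + ∑ n (λ c → δ 0 (suc c) * f (suc c))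
      ≈⟨ +-cong (*-identityˡ _) (∑-cong n (λ _ → zeroˡ _)) ⟩
    f 0 + ∑ n (λ _ → 0#)   ≈⟨ +-congˡ (∑-0 n) ⟩
    f 0 + 0#               ≈⟨ +-identityʳ _ ⟩
    f 0                    ∎
  ∑-δ (suc n) {suc d} f (s≤s d<n) = begin
    0# * f 0 + ∑ n (λ c → δ (suc d) (suc c) * f (suc c))
      ≈⟨ +-cong (zeroˡ _) (∑-cong n (λ c → *-congʳ (δ-suc d c))) ⟩
    0# + ∑ n (λ c → δ d c * f (suc c))   ≈⟨ +-identityˡ _ ⟩
    ∑ n (λ c → δ d c * f (suc c))        ≈⟨ ∑-δ n (λ c → f (suc c)) d<n ⟩
    f (suc d)              ∎

  -- The adjacency matrix of the complete graph on the colours. Written as a difference, it turns a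
  -- sum over the other colours into the full sum minus one term (`∑-A`).
  A : ℕ → ℕ → Carrier
  A c d = 1# - δ c d

  A-sym : ∀ c d → A c d ≈ A d c
  A-sym c d = +-congˡ (-‿cong (δ-sym c d))

  ind-≢ : ∀ {P : Set} (p : Dec P) c d → (P → c ≢ d) → (c ≢ d → P) → ind p ≈ A c d
  ind-≢ p c d f g with c ℕ.≟ d
  ... | yes c≡d = trans (ind-no p (λ q → f q c≡d)) (sym (-‿inverseʳ _))
  ... | no  c≢d = trans (ind-yes p (g c≢d)) (solve 1 (λ a → a := a :- con 0ℤ) refl _)

  ∑-A : ∀ n {d} (f : ℕ → Carrier) → d < n → ∑ n (λ c → A d c * f c) ≈ ∑ n f - f d
  ∑-A n {d} f d<n = begin
    ∑ n (λ c → (1# - δ d c) * f c)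
      ≈⟨ ∑-cong n (λ c → trans
           (solve 3 (λ o a b → (o :- a) :* b := o :* b :- a :* b) refl _ _ _)
           (+-congʳ (*-identityˡ _))) ⟩
    ∑ n (λ c → f c - δ d c * f c)          ≈⟨ ∑-minus n _ _ ⟩
    ∑ n f - ∑ n (λ c → δ d c * f c)        ≈⟨ +-congˡ (-‿cong (∑-δ n f d<n)) ⟩
    ∑ n f - f d                            ∎

-- Elementary symmetric polynomials split at one variable

module Pointed (R : CommutativeRing 0ℓ 0ℓ) where
  open CommutativeRing R
  open Sums R public
  open SetoidReasoning setoid

  -- If E k is the k-th elementary symmetric polynomial in some variables
  -- among which y occurs, then pt E y k is the sum of those of its terms
  -- which contain y, and del E y k the sum of the others.
  pt : (ℕ → Carrier) → Carrier → ℕ → Carrier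
  pt E y zero    = 0#
  pt E y (suc k) = y * (E k - pt E y k)

  del : (ℕ → Carrier) → Carrier → ℕ → Carrier
  del E y k = E k - pt E y k

  pt-1 : ∀ {E} y → E 0 ≈ 1# → pt E y 1 ≈ y
  pt-1 {E} y E0 = begin
    y * (E 0 - 0#)  ≈⟨ *-congˡ (+-congʳ E0) ⟩
    y * (1# - 0#)   ≈⟨ solve 2 (λ o y → y :* (o :- con 0ℤ) := o :* y) refl _ _ ⟩
    1# * y          ≈⟨ *-identityˡ _ ⟩
    y               ∎

  del-0 : ∀ {E} y → E 0 ≈ 1# → del E y 0 ≈ 1#
  del-0 y E0 = trans (+-congʳ E0) (solve 1 (λ o → o :- con 0ℤ := o) refl _)

  -- E′ has the one variable y more than E.
  Extends : (E′ E : ℕ → Carrier) → Carrier → Set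
  Extends E′ E y = (E′ 0 ≈ E 0) × (∀ k → E′ (suc k) ≈ E (suc k) + y * E k)

  del-extends : ∀ E y → Extends E (del E y) y
  del-extends E y =
    solve 1 (λ a → a := a :- con 0ℤ) refl _ ,
    λ k → solve 3 (λ a b y → a := (a :- y :* b) :+ y :* b) refl _ _ _

  -- `pt` is linear in E, so the recursion that adds y passes from E to `pt`; at the bottom the
  -- missing predecessor is replaced by `pt` E z 0 = 0.
  pt-extends : ∀ {E′ E y} → Extends E′ E y → ∀ z k →
               pt E′ z (suc k) ≈ pt E z (suc k) + y * pt E z k
  pt-extends {y = y} (base , step) z zero = trans
    (*-congˡ (+-congʳ base))
    (solve 2 (λ a y → a := a :+ y :* con 0ℤ) refl _ y)
  pt-extends {E′} {E} {y} (base , step) z (suc k) = begin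
    z * (E′ (suc k) - pt E′ z (suc k))
      ≈⟨ *-congˡ (+-cong (step k) (-‿cong (pt-extends (base , step) z k))) ⟩
    z * ((E (suc k) + y * E k) - (pt E z (suc k) + y * pt E z k))
      ≈⟨ solve 6 (λ z y a b c d →
           z :* ((a :+ y :* b) :- (c :+ y :* d)) :=
           z :* (a :- c) :+ y :* (z :* (b :- d))) refl _ _ _ _ _ _ ⟩
    z * (E (suc k) - pt E z (suc k)) + y * (z * (E k - pt E z k))   ∎

  -- Deleting from E′ the variable just added gives E back.
  pt-new : ∀ {E′ E y} → Extends E′ E y → ∀ k → pt E′ y (suc k) ≈ y * E k
  pt-new {y = y} (base , step) zero = *-congˡ (trans (+-congʳ base)
    (solve 1 (λ a → a :- con 0ℤ := a) refl _))
  pt-new {E′} {E} {y} (base , step) (suc k) = begin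
    y * (E′ (suc k) - pt E′ y (suc k))
      ≈⟨ *-congˡ (+-cong (step k) (-‿cong (pt-new (base , step) k))) ⟩
    y * ((E (suc k) + y * E k) - y * E k)
      ≈⟨ solve 3 (λ y a b → y :* ((a :+ y :* b) :- y :* b) := y :* a) refl _ _ _ ⟩
    y * E (suc k)   ∎

  module _ (E : ℕ → Carrier) (y : Carrier) where
    private
      u : ℕ → Carrier
      u = pt E y

    -- Both sides equal y (E k E j - u k u j).
    pt-exchange : ∀ k j → u (suc k) * u j + E k * u (suc j) ≈ u k * u (suc j) + u (suc k) * E j
    pt-exchange k j = solve 5 (λ y a b c d →
      (y :* (a :- b)) :* d :+ a :* (y :* (c :- d)) :=
      b :* (y :* (c :- d)) :+ (y :* (a :- b)) :* c) refl _ _ _ _ _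

    -- `pt-exchange` telescopes along k + j = n down to u 0 = 0. The sum to be subtracted stands on
    -- the left, so that the induction involves no differences.
    pt-product : ∀ n k j → k ℕ.+ j ≡ n →
      u k * u j + ∑ k (λ i → E i * u (n ∸ i)) ≈ ∑ (suc k) (λ i → u i * E (n ∸ i))
    pt-product n zero j eq =
      solve 2 (λ a b → con 0ℤ :* a :+ con 0ℤ := con 0ℤ :* b :+ con 0ℤ) refl _ _
    pt-product n (suc k) j eq = begin
      u (suc k) * u j + ∑ (suc k) (λ i → E i * u (n ∸ i))
        ≈⟨ +-congˡ (∑-last k _) ⟩
      u (suc k) * u j + (∑ k (λ i → E i * u (n ∸ i)) + E k * u (n ∸ k))
        ≡⟨ ≡.cong (λ l → u (suc k) * u j + (∑ k (λ i → E i * u (n ∸ i)) + E k * u l)) n∸k ⟩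
      u (suc k) * u j + (∑ k (λ i → E i * u (n ∸ i)) + E k * u (suc j))
        ≈⟨ solve 3 (λ a b c → a :+ (b :+ c) := (a :+ c) :+ b) refl _ _ _ ⟩
      (u (suc k) * u j + E k * u (suc j)) + ∑ k (λ i → E i * u (n ∸ i))
        ≈⟨ +-congʳ (pt-exchange k j) ⟩
      (u k * u (suc j) + u (suc k) * E j) + ∑ k (λ i → E i * u (n ∸ i))
        ≈⟨ solve 3 (λ a b c → (a :+ b) :+ c := (a :+ c) :+ b) refl _ _ _ ⟩
      (u k * u (suc j) + ∑ k (λ i → E i * u (n ∸ i))) + u (suc k) * E j
        ≈⟨ +-congʳ (pt-product n k (suc j) eq′) ⟩
      ∑ (suc k) (λ i → u i * E (n ∸ i)) + u (suc k) * E j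
        ≡⟨ ≡.cong (λ l → ∑ (suc k) (λ i → u i * E (n ∸ i)) + u (suc k) * E l) n∸1+k ⟨
      ∑ (suc k) (λ i → u i * E (n ∸ i)) + u (suc k) * E (n ∸ suc k)
        ≈⟨ ∑-last (suc k) (λ i → u i * E (n ∸ i)) ⟨
      ∑ (suc (suc k)) (λ i → u i * E (n ∸ i))   ∎
      where
      eq′ : k ℕ.+ suc j ≡ n
      eq′ = ≡.trans (ℕ.+-suc k j) eq
      n∸k : n ∸ k ≡ suc j
      n∸k = ≡.trans (≡.cong (_∸ k) (≡.sym eq′)) (ℕ.m+n∸m≡n k (suc j))
      n∸1+k : n ∸ suc k ≡ j
      n∸1+k = ≡.trans (≡.cong (_∸ suc k) (≡.sym eq)) (ℕ.m+n∸m≡n (suc k) j)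

-- Sets of letters and their elementary symmetric polynomials

module Letters (R : CommutativeRing 0ℓ 0ℓ) (N : ℕ) (x : ℕ → CommutativeRing.Carrier R) where
  open CommutativeRing R
  open Pointed R public
  open SetoidReasoning setoid

  -- a is the indicator function of a set of letters whose elementary
  -- symmetric polynomials are E.
  record Newton (a : ℕ → Carrier) (E : ℕ → Carrier) : Set where
    field
      E-0    : E 0 ≈ 1#
      a-01   : ∀ b → a b ≈ 0# ⊎ a b ≈ 1#
      newton : ∀ k → ∑ N (λ b → a b * pt E (x b) k) ≈ nat k * E k

  open Newton

  -- Writing D for `del` E (x c), the identity for E at k + 1 loses its summand at c, which is x c D
  -- k, and by `pt-extends` also x c times the identity for D at k, that is k x c D k. What remains
  -- is (k + 1)(E (k+1) - x c D k) = (k + 1) D (k+1).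
  Newton-del : ∀ {a E c} → Newton a E → c < N → a c ≈ 1# →
               Newton (λ b → A c b * a b) (del E (x c))
  Newton-del {a} {E} {c} nw c<N ac = record
    { E-0 = del-0 {E} (x c) (E-0 nw)
    ; a-01 = a′-01
    ; newton = nw′
    }
    where
    y : Carrier
    y = x c
    D : ℕ → Carrier
    D = del E y
    a′-01 : ∀ b → A c b * a b ≈ 0# ⊎ A c b * a b ≈ 1#
    a′-01 b with c ℕ.≟ b
    ... | yes _ = inj₁ (trans (*-congʳ (-‿inverseʳ _)) (zeroˡ _))
    ... | no  _ with a-01 nw b
    ...   | inj₁ p = inj₁ (trans (*-congˡ p) (zeroʳ _))
    ...   | inj₂ p = inj₂ (trans (*-congˡ p) (trans (*-identityʳ _)
                       (solve 1 (λ o → o :- con 0ℤ := o) refl _)))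
    nw′ : ∀ k → ∑ N (λ b → (A c b * a b) * pt D (x b) k) ≈ nat k * D k
    nw′ zero = trans (∑-cong N (λ _ → zeroʳ _)) (trans (∑-0 N) (sym (zeroˡ _)))
    nw′ (suc k) = begin
      ∑ N (λ b → (A c b * a b) * pt D (x b) (suc k))
        ≈⟨ ∑-cong N (λ b → trans
             (solve 5 (λ p q r s y → (p :* q) :* r :=
               p :* (q :* (r :+ y :* s)) :- y :* ((p :* q) :* s)) refl _ _ _ (pt D (x b) k) y)
             (+-congʳ (*-congˡ (*-congˡ (sym (pt-extends (del-extends E y) (x b) k)))))) ⟩
      ∑ N (λ b → A c b * (a b * pt E (x b) (suc k)) - y * ((A c b * a b) * pt D (x b) k))
        ≈⟨ trans (∑-minus N _ _) (+-congˡ (-‿cong (∑-*ˡ N y _))) ⟩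
      ∑ N (λ b → A c b * (a b * pt E (x b) (suc k))) -
        y * ∑ N (λ b → (A c b * a b) * pt D (x b) k)
        ≈⟨ +-cong (∑-A N _ c<N) (-‿cong (*-congˡ (nw′ k))) ⟩
      (∑ N (λ b → a b * pt E (x b) (suc k)) - a c * pt E y (suc k)) - y * (nat k * D k)
        ≈⟨ +-congʳ (+-cong (newton nw (suc k)) (-‿cong (trans (*-congʳ ac) (*-identityˡ _)))) ⟩
      (nat (suc k) * E (suc k) - y * D k) - y * (nat k * D k)
        ≈⟨ +-congʳ (+-congˡ (-‿cong (sym (*-identityˡ _)))) ⟩
      ((1# + nat k) * E (suc k) - 1# * (y * D k)) - y * (nat k * D k)
        ≈⟨ solve 5 (λ o k e y d → ((o :+ k) :* e :- o :* (y :* d)) :- y :* (k :* d) :=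
             (o :+ k) :* (e :- y :* d)) refl _ _ _ _ _ ⟩
      nat (suc k) * D (suc k)   ∎

  injections : ℕ → (ℕ → Carrier) → Carrier
  injections zero    a = 1#
  injections (suc m) a = ∑ N (λ b → a b * (x b * injections m (λ z → A b z * a z)))

  -- After the first letter b, the others come from the set without b. By induction they contribute
  -- m! times `del` E (x b) m, and summing over b with `newton` supplies the factor m + 1.
  injections≈ : ∀ m {a E} → Newton a E → injections m a ≈ nat (m !) * E m
  injections≈ zero nw = sym (trans (*-congˡ (E-0 nw)) (trans (*-identityʳ _) (+-identityʳ _)))
  injections≈ (suc m) {a} {E} nw = begin
    ∑ N (λ b → a b * (x b * injections m (λ z → A b z * a z)))
      ≈⟨ ∑-cong< N term ⟩
    ∑ N (λ b → nat (m !) * (a b * pt E (x b) (suc m)))   ≈⟨ ∑-*ˡ N _ _ ⟩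
    nat (m !) * ∑ N (λ b → a b * pt E (x b) (suc m))     ≈⟨ *-congˡ (newton nw (suc m)) ⟩
    nat (m !) * (nat (suc m) * E (suc m))
      ≈⟨ solve 3 (λ p q r → p :* (q :* r) := (q :* p) :* r) refl _ _ _ ⟩
    (nat (suc m) * nat (m !)) * E (suc m)                ≈⟨ *-congʳ (nat-* (suc m) (m !)) ⟨
    nat (suc m !) * E (suc m)                            ∎
    where
    term : ∀ b → b < N → a b * (x b * injections m (λ z → A b z * a z)) ≈
                         nat (m !) * (a b * pt E (x b) (suc m))
    -- `Newton-del` removes only a letter that belongs to the set; for any other b the factor a b
    -- makes both sides vanish.
    term b b<N with a-01 nw b
    ... | inj₁ ab = trans (trans (*-congʳ ab) (zeroˡ _))
                      (sym (trans (*-congˡ (trans (*-congʳ ab) (zeroˡ _))) (zeroʳ _)))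
    ... | inj₂ ab = trans (*-congˡ (*-congˡ (injections≈ m (Newton-del nw b<N ab))))
                      (solve 4 (λ a x n d → a :* (x :* (n :* d)) := n :* (a :* (x :* d)))
                        refl _ _ _ _)

  -- ε j k is the k-th elementary symmetric polynomial in the letters
  -- j, …, N - 1, according to the least letter of each term.
  ε : ℕ → ℕ → Carrier
  ε j zero    = 1#
  ε j (suc k) = ∑ N (λ b → ind (j ℕ.≤? b) * (x b * ε (suc b) k))

  private
    split-≤ : ∀ j b → ind (j ℕ.≤? b) ≈ δ j b + ind (suc j ℕ.≤? b)
    split-≤ j b with j ℕ.≟ b
    ... | yes ≡.refl = trans (ind-yes (j ℕ.≤? j) ℕ.≤-refl)
          (sym (trans (+-congˡ (ind-no (suc j ℕ.≤? j) (ℕ.<-irrefl ≡.refl))) (+-identityʳ _)))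
    ... | no j≢b = trans (ind-⇔ (j ℕ.≤? b) (suc j ℕ.≤? b) (λ j≤b → ℕ.≤∧≢⇒< j≤b j≢b) ℕ.<⇒≤)
                     (sym (+-identityˡ _))

    ∑-split-≤ : ∀ {j} (f : ℕ → Carrier) → j < N →
      ∑ N (λ b → ind (j ℕ.≤? b) * f b) ≈ f j + ∑ N (λ b → ind (suc j ℕ.≤? b) * f b)
    ∑-split-≤ {j} f j<N = begin
      ∑ N (λ b → ind (j ℕ.≤? b) * f b)
        ≈⟨ ∑-cong N (λ b → trans (*-congʳ (split-≤ j b)) (distribʳ _ _ _)) ⟩
      ∑ N (λ b → δ j b * f b + ind (suc j ℕ.≤? b) * f b)   ≈⟨ ∑-+ N _ _ ⟩
      ∑ N (λ b → δ j b * f b) + ∑ N (λ b → ind (suc j ℕ.≤? b) * f b)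
        ≈⟨ +-congʳ (∑-δ N f j<N) ⟩
      f j + ∑ N (λ b → ind (suc j ℕ.≤? b) * f b)   ∎

    ∑-beyond : ∀ (f : ℕ → Carrier) → ∑ N (λ b → ind (N ℕ.≤? b) * f b) ≈ 0#
    ∑-beyond f = trans
      (∑-cong< N (λ b b<N → trans (*-congʳ (ind-no (N ℕ.≤? b) (ℕ.<⇒≱ b<N))) (zeroˡ _)))
      (∑-0 N)

    ε-extends : ∀ {j} → j < N → Extends (ε j) (ε (suc j)) (x j)
    ε-extends {j} j<N = refl , λ k → trans (∑-split-≤ _ j<N) (+-comm _ _)

    -- Induction on the number r of letters from j on. The letter j itself contributes x j E k, and
    -- each later letter contributes its terms without x j and those with x j; the weights add up as
    -- 1 + k in both degrees.
    ε-newton : ∀ r j → j ℕ.+ r ≡ N → ∀ k →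
      ∑ N (λ b → ind (j ℕ.≤? b) * pt (ε j) (x b) k) ≈ nat k * ε j k
    ε-newton r j eq zero =
      trans (∑-cong N (λ _ → zeroʳ _)) (trans (∑-0 N) (sym (zeroˡ _)))
    ε-newton zero j eq (suc k) with ≡.trans (≡.sym (ℕ.+-identityʳ j)) eq
    ... | ≡.refl = trans (∑-beyond (λ b → pt (ε j) (x b) (suc k)))
      (sym (trans (*-congˡ (∑-beyond (λ b → x b * ε (suc b) k))) (zeroʳ _)))
    ε-newton (suc r) j eq (suc k) = begin
      ∑ N (λ b → ind (j ℕ.≤? b) * pt (ε j) (x b) (suc k))   ≈⟨ ∑-split-≤ _ j<N ⟩
      pt (ε j) y (suc k) + ∑ N (λ b → ind (suc j ℕ.≤? b) * pt (ε j) (x b) (suc k))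
        ≈⟨ +-cong (pt-new ext k) (∑-cong N (λ b → trans
             (*-congˡ (pt-extends ext (x b) k))
             (solve 4 (λ i a y b → i :* (a :+ y :* b) := i :* a :+ y :* (i :* b))
               refl _ _ _ _))) ⟩
      y * E k + ∑ N (λ b → ind (suc j ℕ.≤? b) * pt E (x b) (suc k) +
                           y * (ind (suc j ℕ.≤? b) * pt E (x b) k))
        ≈⟨ +-congˡ (trans (∑-+ N _ _) (+-congˡ (∑-*ˡ N y _))) ⟩
      y * E k + (∑ N (λ b → ind (suc j ℕ.≤? b) * pt E (x b) (suc k)) +
                 y * ∑ N (λ b → ind (suc j ℕ.≤? b) * pt E (x b) k))
        ≈⟨ +-cong (sym (*-identityˡ _)) (+-cong (ε-newton r (suc j) eq′ (suc k))
             (*-congˡ (ε-newton r (suc j) eq′ k))) ⟩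
      1# * (y * E k) + ((1# + nat k) * E (suc k) + y * (nat k * E k))
        ≈⟨ solve 5 (λ o k y a b → o :* (y :* a) :+ ((o :+ k) :* b :+ y :* (k :* a)) :=
             (o :+ k) :* (b :+ y :* a)) refl _ _ _ _ _ ⟩
      nat (suc k) * (E (suc k) + y * E k)   ≈⟨ *-congˡ (proj₂ ext k) ⟨
      nat (suc k) * ε j (suc k)             ∎
      where
      E : ℕ → Carrier
      E = ε (suc j)
      y : Carrier
      y = x j
      eq′ : suc j ℕ.+ r ≡ N
      eq′ = ≡.trans (≡.sym (ℕ.+-suc j r)) eq
      j<N : j < N
      j<N = ≡.subst (suc j ≤_) eq′ (ℕ.m≤m+n (suc j) r)
      ext : Extends (ε j) E y
      ext = ε-extends j<N

  e : ℕ → Carrier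
  e = ε 0

  e-Newton : Newton (λ _ → 1#) e
  e-Newton = record
    { E-0 = refl
    ; a-01 = λ _ → inj₂ refl
    ; newton = λ k → trans (∑-cong N (λ b → *-congʳ (sym (ind-yes (0 ℕ.≤? b) z≤n))))
                       (ε-newton N 0 ≡.refl k)
    }

  u : ℕ → ℕ → Carrier
  u k c = pt e (x c) k

  ∑-u : ∀ k → ∑ N (u k) ≈ nat k * e k
  ∑-u k = trans (∑-cong N (λ _ → sym (*-identityˡ _))) (newton e-Newton k)

-- What gluing a clique or a cycle does to `u`

module Transfer (R : CommutativeRing 0ℓ 0ℓ) (N : ℕ) (x : ℕ → CommutativeRing.Carrier R) where
  open CommutativeRing R
  open Letters R N x public
  open SetoidReasoning setoid

  private
    nat-suc-* : ∀ a k → (1# + nat k) * a ≈ a + nat k * a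
    nat-suc-* a k = trans (distribʳ _ _ _) (+-congʳ (*-identityˡ _))

    nat-minus : ∀ {m n} → n ≤ m → nat m - nat n ≈ nat (m ∸ n)
    nat-minus {m} {n} n≤m = begin
      nat m - nat n                 ≡⟨ ≡.cong (λ l → nat l - nat n) (ℕ.m∸n+n≡m n≤m) ⟨
      nat (m ∸ n ℕ.+ n) - nat n     ≈⟨ +-congʳ (nat-+ (m ∸ n) n) ⟩
      (nat (m ∸ n) + nat n) - nat n ≈⟨ solve 2 (λ a b → (a :+ b) :- b := a) refl _ _ ⟩
      nat (m ∸ n)                   ∎

  u-1 : ∀ c → u 1 c ≈ x c
  u-1 c = pt-1 {e} (x c) refl

  ∑-A-u : ∀ {d} k → d < N → ∑ N (λ c → A d c * u k c) ≈ nat k * e k - u k d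
  ∑-A-u k d<N = trans (∑-A N _ d<N) (+-congʳ (∑-u k))

  -- Cliques

  module Clique {d : ℕ} (d<N : d < N) where
    -- The terms of u a d which do not contain x c, if c ≢ d.
    v : ℕ → ℕ → Carrier
    v zero    c = 0#
    v (suc a) c = x d * del (del e (x d)) (x c) a

    S : ℕ → ℕ → Carrier
    S k a = ∑ N (λ c → A d c * (v a c * u k c))

    private
      v-suc : ∀ a c → v (suc a) c ≈ u (suc a) d - x c * v a c
      v-suc zero    c = solve 3 (λ y z b → y :* (b :- con 0ℤ) := y :* b :- z :* con 0ℤ)
                          refl _ (x c) _
      v-suc (suc a) c = solve 4 (λ y z b f → y :* (b :- z :* f) := y :* b :- z :* (y :* f))
                          refl _ _ _ _

      newton-d : Newton (λ c → A d c * 1#) (del e (x d))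
      newton-d = Newton-del e-Newton d<N refl

      -- Each term of `u` (a + 1) d has a letters other than d, and is met once for each of them.
      ∑-xv : ∀ a → ∑ N (λ c → A d c * (x c * v a c)) ≈ nat a * u (suc a) d
      ∑-xv zero = trans (∑-cong N (λ c → trans (*-congˡ (zeroʳ _)) (zeroʳ _)))
                    (trans (∑-0 N) (sym (zeroˡ _)))
      ∑-xv (suc a) = begin
        ∑ N (λ c → A d c * (x c * (x d * del (del e (x d)) (x c) a)))
          ≈⟨ ∑-cong N (λ c → trans (solve 4 (λ p y z f → p :* (y :* (z :* f)) := z :* (p :* (y :* f)))
               refl _ _ _ _) (*-congˡ (*-congʳ (sym (*-identityʳ _))))) ⟩
        ∑ N (λ c → x d * ((A d c * 1#) * pt (del e (x d)) (x c) (suc a)))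
          ≈⟨ ∑-*ˡ N _ _ ⟩
        x d * ∑ N (λ c → (A d c * 1#) * pt (del e (x d)) (x c) (suc a))
          ≈⟨ *-congˡ (Newton.newton newton-d (suc a)) ⟩
        x d * (nat (suc a) * del e (x d) (suc a))
          ≈⟨ solve 3 (λ y n f → y :* (n :* f) := n :* (y :* f)) refl _ _ _ ⟩
        nat (suc a) * u (suc (suc a)) d   ∎

    -- One letter c moves from the first factor to the second: `v` (a+1) c is u (a+1) d - x c `v` a
    -- c, and x c u k c is x c e k - u (k+1) c. The sums over c that are left are `∑-A-u` and
    -- `∑-xv`.
    S-suc : ∀ k a → S k (suc a) ≈
      ((nat k - nat a) * (u (suc a) d * e k) - u (suc a) d * u k d) + S (suc k) a
    S-suc k a = begin
      ∑ N (λ c → A d c * (v (suc a) c * u k c))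
        ≈⟨ ∑-cong N term ⟩
      ∑ N (λ c → (U * (A d c * u k c) - e k * (A d c * (x c * v a c))) +
                 A d c * (v a c * u (suc k) c))
        ≈⟨ trans (∑-+ N _ _) (+-congʳ (∑-minus N _ _)) ⟩
      (∑ N (λ c → U * (A d c * u k c)) - ∑ N (λ c → e k * (A d c * (x c * v a c)))) + S (suc k) a
        ≈⟨ +-congʳ (+-cong
             (trans (∑-*ˡ N _ _) (*-congˡ (∑-A-u k d<N)))
             (-‿cong (trans (∑-*ˡ N _ _) (*-congˡ (∑-xv a))))) ⟩
      (U * (nat k * e k - u k d) - e k * (nat a * U)) + S (suc k) a
        ≈⟨ +-congʳ (solve 5 (λ U k e u a → U :* (k :* e :- u) :- e :* (a :* U) :=
             (k :- a) :* (U :* e) :- U :* u) refl _ _ _ _ _) ⟩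
      ((nat k - nat a) * (U * e k) - U * u k d) + S (suc k) a   ∎
      where
      U : Carrier
      U = u (suc a) d
      term : ∀ c → A d c * (v (suc a) c * u k c) ≈
        (U * (A d c * u k c) - e k * (A d c * (x c * v a c))) + A d c * (v a c * u (suc k) c)
      term c = trans (*-congˡ (*-congʳ (v-suc a c)))
        (solve 6 (λ p U y v E w → p :* ((U :- y :* v) :* w) :=
          (U :* (p :* w) :- E :* (p :* (y :* v))) :+ p :* (v :* (y :* (E :- w))))
          refl _ _ _ _ _ _)

    private
      -- For α + β = n the terms at j and n - j cancel.  Hence S k a has one
      -- expansion with a terms and another one with k terms, and the shorter
      -- of the two has nonnegative coefficients.
      Q : ℕ → ℕ → Carrier → Carrier → Carrier
      Q n m α β = ∑ m (λ j → (α - nat j) * (u j d * e (n ∸ j)) + (β - nat j) * (u (n ∸ j) d * e j))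

      -- A unit moved from α to β exchanges one copy of each u j e (n-j) for one copy of each u
      -- (n-j) e j. These are the two sums that occur in `pt-product`.
      Q-shift : ∀ n m α β →
        Q n m (1# + α) β + ∑ m (λ j → e j * u (n ∸ j) d) ≈
        Q n m α (1# + β) + ∑ m (λ j → u j d * e (n ∸ j))
      Q-shift n m α β = trans (sym (∑-+ m _ _)) (trans (∑-cong m (λ j → trans
          (+-congˡ (sym (*-identityˡ _)))
          (trans (solve 8 (λ o α β j a b c d →
             (((o :+ α) :- j) :* (a :* b) :+ (β :- j) :* (c :* d)) :+ o :* (d :* c) :=
             ((α :- j) :* (a :* b) :+ ((o :+ β) :- j) :* (c :* d)) :+ o :* (a :* b))
             refl _ _ _ _ _ _ _ _)
            (+-congˡ (*-identityˡ _)))))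
        (∑-+ m _ _))

      cancel : ∀ {a b} c → a + c ≈ b + c → a ≈ b
      cancel {a} {b} c eq = begin
        a            ≈⟨ solve 2 (λ a c → a := (a :+ c) :- c) refl _ _ ⟩
        (a + c) - c  ≈⟨ +-congʳ eq ⟩
        (b + c) - c  ≈⟨ solve 2 (λ a c → (a :+ c) :- c := a) refl _ _ ⟩
        b            ∎

      -- `S-suc` run forwards, until a = 0, where `v` vanishes. The product u (a+1) u k that it
      -- leaves is expanded by `pt-product` and absorbed by `Q-shift`.
      S-expand₁ : ∀ n k a → k ℕ.+ a ≡ n →
        S k a ≈ Q n a (nat k) (nat a) + (nat k - nat a) * (u a d * e k)
      S-expand₁ n k zero eq = trans
        (trans (∑-cong N (λ c → trans (*-congˡ (zeroˡ _)) (zeroʳ _))) (∑-0 N))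
        (solve 2 (λ a b → con 0ℤ := con 0ℤ :+ a :* (con 0ℤ :* b)) refl (nat k - 0#) (e k))
      -- With T₂ added, `Q-shift` applies and produces T₁. Expanding the product then cancels T₁ and
      -- gives T₂ back, and the remaining terms are exactly the summand j = a of `Q` and the new
      -- correction term.
      S-expand₁ n k (suc a) eq = cancel T₂ (begin
        S k (suc a) + T₂
          ≈⟨ +-congʳ (S-suc k a) ⟩
        ((p * (U * e k) - U * u k d) + S (suc k) a) + T₂
          ≈⟨ +-congʳ (+-congˡ (S-expand₁ n (suc k) a eq′)) ⟩
        ((p * (U * e k) - U * u k d) +
          (Q n a (1# + nat k) (nat a) + ((1# + nat k) - nat a) * (u a d * e (suc k)))) + T₂
          ≈⟨ solve 5 (λ x y z w t → ((x :- y) :+ (z :+ w)) :+ t := (z :+ t) :+ ((x :+ w) :- y))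
               refl _ _ _ _ _ ⟩
        (Q n a (1# + nat k) (nat a) + T₂) +
          ((p * (U * e k) + ((1# + nat k) - nat a) * (u a d * e (suc k))) - U * u k d)
          ≈⟨ +-congʳ (Q-shift n a (nat k) (nat a)) ⟩
        (Q n a (nat k) (1# + nat a) + T₁) +
          ((p * (U * e k) + ((1# + nat k) - nat a) * (u a d * e (suc k))) - U * u k d)
          ≈⟨ +-congˡ (+-congˡ (-‿cong prod)) ⟩
        (Q n a (nat k) (1# + nat a) + T₁) +
          ((p * (U * e k) + ((1# + nat k) - nat a) * (u a d * e (suc k))) -
            (((T₁ + u a d * e (suc k)) + U * e k) - (T₂ + e a * u (suc k) d)))
          ≈⟨ solve 11 (λ o k a q t₁ U E w E′ t₂ z →
               (q :+ t₁) :+ (((k :- a) :* (U :* E) :+ ((o :+ k) :- a) :* (w :* E′)) :-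
                 (((t₁ :+ w :* E′) :+ U :* E) :- (t₂ :+ z))) :=
               ((q :+ (((k :- a) :* (w :* E′) :+ (o :* (w :* E′) :- w :* E′)) :+ z))
                 :+ ((k :- a) :* (U :* E) :- U :* E)) :+ t₂)
               refl _ _ _ _ _ _ _ _ _ _ _ ⟩
        ((Q n a (nat k) (1# + nat a) +
            (((nat k - nat a) * (u a d * e (suc k)) +
              (1# * (u a d * e (suc k)) - u a d * e (suc k))) + e a * u (suc k) d)) +
          ((nat k - nat a) * (U * e k) - U * e k)) + T₂
          ≈⟨ +-congʳ (+-cong (+-congˡ (+-cong
               (trans (+-congˡ (trans (+-congʳ (*-identityˡ _)) (-‿inverseʳ _))) (+-identityʳ _))
               (trans (*-comm _ _) (sym one*))))
               (trans (+-congˡ (-‿cong (sym (*-identityˡ _))))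
                 (solve 4 (λ o k a z → (k :- a) :* z :- o :* z := (k :- (o :+ a)) :* z)
                   refl _ _ _ _))) ⟩
        ((Q n a (nat k) (1# + nat a) +
            ((nat k - nat a) * (u a d * e (suc k)) +
              ((1# + nat a) - nat a) * (u (suc k) d * e a))) +
          (nat k - nat (suc a)) * (U * e k)) + T₂
          ≡⟨ ≡.cong₂ (λ i j → ((Q n a (nat k) (1# + nat a) +
               ((nat k - nat a) * (u a d * e i) + ((1# + nat a) - nat a) * (u j d * e a))) +
               (nat k - nat (suc a)) * (U * e k)) + T₂) n∸a n∸a ⟨
        ((Q n a (nat k) (1# + nat a) +
            ((nat k - nat a) * (u a d * e (n ∸ a)) +
              ((1# + nat a) - nat a) * (u (n ∸ a) d * e a))) +
          (nat k - nat (suc a)) * (U * e k)) + T₂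
          ≈⟨ +-congʳ (+-congʳ (∑-last a (λ j → (nat k - nat j) * (u j d * e (n ∸ j)) +
               ((1# + nat a) - nat j) * (u (n ∸ j) d * e j)))) ⟨
        (Q n (suc a) (nat k) (nat (suc a)) + (nat k - nat (suc a)) * (U * e k)) + T₂   ∎)
        where
        U T₁ T₂ p : Carrier
        U = u (suc a) d
        p = nat k - nat a
        T₁ = ∑ a (λ j → u j d * e (n ∸ j))
        T₂ = ∑ a (λ j → e j * u (n ∸ j) d)
        eq′ : suc k ℕ.+ a ≡ n
        eq′ = ≡.trans (≡.sym (ℕ.+-suc k a)) eq
        n∸a : n ∸ a ≡ suc k
        n∸a = ≡.trans (≡.cong (_∸ a) (≡.sym eq′)) (ℕ.m+n∸n≡m (suc k) a)
        n∸1+a : n ∸ suc a ≡ k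
        n∸1+a = ≡.trans (≡.cong (_∸ suc a) (≡.sym eq)) (ℕ.m+n∸n≡m k (suc a))
        one* : ∀ {z} → ((1# + nat a) - nat a) * z ≈ z
        one* = trans (*-congʳ (solve 2 (λ o a → (o :+ a) :- a := o) refl _ _)) (*-identityˡ _)
        prod : U * u k d ≈ ((T₁ + u a d * e (suc k)) + U * e k) - (T₂ + e a * u (suc k) d)
        prod = begin
          U * u k d
            ≈⟨ solve 2 (λ a b → a := (a :+ b) :- b) refl _ _ ⟩
          (U * u k d + ∑ (suc a) (λ j → e j * u (n ∸ j) d)) - ∑ (suc a) (λ j → e j * u (n ∸ j) d)
            ≈⟨ +-cong (pt-product e (x d) n (suc a) k (≡.trans (ℕ.+-comm (suc a) k) eq))
                 (-‿cong (∑-last a _)) ⟩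
          ∑ (suc (suc a)) (λ j → u j d * e (n ∸ j)) - (T₂ + e a * u (n ∸ a) d)
            ≈⟨ +-congʳ (trans (∑-last (suc a) (λ j → u j d * e (n ∸ j)))
                 (+-congʳ (∑-last a (λ j → u j d * e (n ∸ j))))) ⟩
          ((T₁ + u a d * e (n ∸ a)) + U * e (n ∸ suc a)) - (T₂ + e a * u (n ∸ a) d)
            ≡⟨ ≡.cong₂ (λ i j → ((T₁ + u a d * e i) + U * e j) - (T₂ + e a * u i d)) n∸a n∸1+a ⟩
          ((T₁ + u a d * e (suc k)) + U * e k) - (T₂ + e a * u (suc k) d)   ∎

      -- `S-suc` run backwards, until k = 0, where `u` vanishes; no correction term is left over.
      S-expand₂ : ∀ n k a → k ℕ.+ a ≡ n → S k a ≈ Q n k (nat k) (nat a)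
      S-expand₂ n zero a eq =
        trans (∑-cong N (λ c → trans (*-congˡ (zeroʳ _)) (zeroʳ _))) (∑-0 N)
      S-expand₂ n (suc k) a eq = begin
        S (suc k) a
          ≈⟨ solve 2 (λ w z → z := (w :+ z) :- w) refl (p * (U * e k) - U * u k d) _ ⟩
        ((p * (U * e k) - U * u k d) + S (suc k) a) - (p * (U * e k) - U * u k d)
          ≈⟨ +-cong (trans (sym (S-suc k a)) (S-expand₂ n k (suc a) eq′))
               (-‿cong (+-congˡ (-‿cong prod))) ⟩
        Q n k (nat k) (nat (suc a)) -
          (p * (U * e k) - ((T₁ + u k d * e (suc a)) - T₂))
          ≈⟨ solve 6 (λ q p z t₁ w t₂ →
               q :- (p :* z :- ((t₁ :+ w) :- t₂)) := ((q :+ t₁) :- t₂) :+ (w :- p :* z))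
               refl _ _ _ _ _ _ ⟩
        ((Q n k (nat k) (1# + nat a) + T₁) - T₂) + (u k d * e (suc a) - p * (U * e k))
          ≈⟨ +-cong (trans (+-congʳ (sym (Q-shift n k (nat k) (nat a))))
                       (solve 2 (λ a b → (a :+ b) :- b := a) refl _ _))
                    (trans (+-congʳ (sym one*))
                      (+-congˡ (solve 3 (λ k a z → :- ((k :- a) :* z) := (a :- k) :* z) refl _ _ _))) ⟩
        Q n k (1# + nat k) (nat a) +
          (((1# + nat k) - nat k) * (u k d * e (suc a)) + (nat a - nat k) * (U * e k))
          ≡⟨ ≡.cong₂ (λ i j → Q n k (1# + nat k) (nat a) +
               (((1# + nat k) - nat k) * (u k d * e i) + (nat a - nat k) * (u j d * e k)))
               n∸k n∸k ⟨
        Q n k (1# + nat k) (nat a) +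
          (((1# + nat k) - nat k) * (u k d * e (n ∸ k)) + (nat a - nat k) * (u (n ∸ k) d * e k))
          ≈⟨ ∑-last k (λ j → ((1# + nat k) - nat j) * (u j d * e (n ∸ j)) +
               (nat a - nat j) * (u (n ∸ j) d * e j)) ⟨
        Q n (suc k) (nat (suc k)) (nat a)   ∎
        where
        U T₁ T₂ p : Carrier
        U = u (suc a) d
        p = nat k - nat a
        T₁ = ∑ k (λ j → u j d * e (n ∸ j))
        T₂ = ∑ k (λ j → e j * u (n ∸ j) d)
        eq′ : k ℕ.+ suc a ≡ n
        eq′ = ≡.trans (ℕ.+-suc k a) eq
        n∸k : n ∸ k ≡ suc a
        n∸k = ≡.trans (≡.cong (_∸ k) (≡.sym eq′)) (ℕ.m+n∸m≡n k (suc a))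
        one* : ∀ {z} → ((1# + nat k) - nat k) * z ≈ z
        one* = trans (*-congʳ (solve 2 (λ o a → (o :+ a) :- a := o) refl _ _)) (*-identityˡ _)
        prod : U * u k d ≈ (T₁ + u k d * e (suc a)) - T₂
        prod = begin
          U * u k d
            ≈⟨ solve 3 (λ a b t → a :* b := (b :* a :+ t) :- t) refl _ _ T₂ ⟩
          (u k d * U + T₂) - T₂
            ≈⟨ +-congʳ (trans (pt-product e (x d) n k (suc a) eq′) (∑-last k _)) ⟩
          (T₁ + u k d * e (n ∸ k)) - T₂
            ≡⟨ ≡.cong (λ i → (T₁ + u k d * e i) - T₂) n∸k ⟩
          (T₁ + u k d * e (suc a)) - T₂   ∎

      Q-nat : ∀ n m k a → m ≤ suc k → m ≤ suc a → Q n m (nat k) (nat a) ≈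
        ∑ m (λ j → nat (k ∸ j) * (u j d * e (n ∸ j)) + nat (a ∸ j) * (u (n ∸ j) d * e j))
      Q-nat n m k a m≤k m≤a = ∑-cong< m (λ j j<m → +-cong
        (*-congʳ (nat-minus (ℕ.s≤s⁻¹ (ℕ.≤-trans j<m m≤k))))
        (*-congʳ (nat-minus (ℕ.s≤s⁻¹ (ℕ.≤-trans j<m m≤a)))))

    S-positive₁ : ∀ k a → a ≤ k → S k a ≈
      ∑ a (λ j → nat (k ∸ j) * (u j d * e (k ℕ.+ a ∸ j)) + nat (a ∸ j) * (u (k ℕ.+ a ∸ j) d * e j))
      + nat (k ∸ a) * (u a d * e k)
    S-positive₁ k a a≤k = trans (S-expand₁ _ k a ≡.refl)
      (+-cong (Q-nat _ a k a (ℕ.m≤n⇒m≤1+n a≤k) (ℕ.n≤1+n a)) (*-congʳ (nat-minus a≤k)))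

    S-positive₂ : ∀ k a → k ≤ a → S k a ≈
      ∑ k (λ j → nat (k ∸ j) * (u j d * e (k ℕ.+ a ∸ j)) + nat (a ∸ j) * (u (k ℕ.+ a ∸ j) d * e j))
    S-positive₂ k a k≤a = trans (S-expand₂ _ k a ≡.refl)
      (Q-nat _ k k a (ℕ.n≤1+n k) (ℕ.m≤n⇒m≤1+n k≤a))

  -- Walks and cycles

  -- The transfer operator: the action on rooted series of gluing an edge to the root, the new root
  -- being its free end.
  T : (ℕ → Carrier) → ℕ → Carrier
  T F d = x d * ∑ N (λ c → A d c * F c)

  T^ : ℕ → (ℕ → Carrier) → ℕ → Carrier
  T^ zero    F = F
  T^ (suc n) F = T^ n (T F)

  infix 4 _≋_
  _≋_ : (ℕ → Carrier) → (ℕ → Carrier) → Set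
  F ≋ G = ∀ {d} → d < N → F d ≈ G d

  T-cong : ∀ {F G} → F ≋ G → T F ≋ T G
  T-cong F≋G _ = *-congˡ (∑-cong< N (λ c c<N → *-congˡ (F≋G c<N)))

  T^-cong : ∀ n {F G} → F ≋ G → T^ n F ≋ T^ n G
  T^-cong zero    F≋G = F≋G
  T^-cong (suc n) F≋G = T^-cong n (T-cong F≋G)

  T^-T : ∀ n F → T^ (suc n) F ≡ T (T^ n F)
  T^-T zero    F = ≡.refl
  T^-T (suc n) F = T^-T n (T F)

  T-∑ : ∀ m (G : ℕ → ℕ → Carrier) (f : ℕ → Carrier) d →
        T (λ b → ∑ m (λ i → G i b * f i)) d ≈ ∑ m (λ i → T (G i) d * f i)
  T-∑ m G f d = begin
    x d * ∑ N (λ c → A d c * ∑ m (λ i → G i c * f i))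
      ≈⟨ *-congˡ (∑-cong N (λ c → sym (∑-*ˡ m _ _))) ⟩
    x d * ∑ N (λ c → ∑ m (λ i → A d c * (G i c * f i)))
      ≈⟨ *-congˡ (∑-swap N m _) ⟩
    x d * ∑ m (λ i → ∑ N (λ c → A d c * (G i c * f i)))
      ≈⟨ ∑-*ˡ m _ _ ⟨
    ∑ m (λ i → x d * ∑ N (λ c → A d c * (G i c * f i)))
      ≈⟨ ∑-cong m (λ i → trans
           (*-congˡ (trans (∑-cong N (λ c → sym (*-assoc _ _ _))) (∑-*ʳ N _ _)))
           (sym (*-assoc _ _ _))) ⟩
    ∑ m (λ i → T (G i) d * f i)   ∎

  T^-∑ : ∀ n m (G : ℕ → ℕ → Carrier) (f : ℕ → Carrier) →
         T^ n (λ b → ∑ m (λ i → G i b * f i)) ≋ (λ d → ∑ m (λ i → T^ n (G i) d * f i))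
  T^-∑ zero    m G f _   = refl
  T^-∑ (suc n) m G f d<N = trans (T^-cong n (λ {d} _ → T-∑ m G f d) d<N)
                             (T^-∑ n m (λ i → T (G i)) f d<N)

  T-+* : ∀ F G a d → T (λ b → F b + G b * a) d ≈ T F d + T G d * a
  T-+* F G a d = begin
    x d * ∑ N (λ c → A d c * (F c + G c * a))
      ≈⟨ *-congˡ (∑-cong N (λ c →
           solve 4 (λ p f g a → p :* (f :+ g :* a) := p :* f :+ (p :* g) :* a) refl _ _ _ _)) ⟩
    x d * ∑ N (λ c → A d c * F c + (A d c * G c) * a)
      ≈⟨ *-congˡ (trans (∑-+ N _ _) (+-congˡ (∑-*ʳ N _ _))) ⟩
    x d * (∑ N (λ c → A d c * F c) + ∑ N (λ c → A d c * G c) * a)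
      ≈⟨ solve 4 (λ p f g a → p :* (f :+ g :* a) := p :* f :+ (p :* g) :* a) refl _ _ _ _ ⟩
    T F d + T G d * a   ∎

  T^-+* : ∀ n F G a → T^ n (λ b → F b + G b * a) ≋ (λ d → T^ n F d + T^ n G d * a)
  T^-+* zero    F G a _   = refl
  T^-+* (suc n) F G a d<N = trans (T^-cong n (λ {d} _ → T-+* F G a d) d<N)
                              (T^-+* n (T F) (T G) a d<N)

  -- Of the k + 1 copies of e (k+1), one joins with -u (k+1) to give u (k+2) after multiplication by
  -- x d; the other k remain.
  T-u : ∀ k → T (u (suc k)) ≋ (λ d → u (suc (suc k)) d + u 1 d * (nat k * e (suc k)))
  T-u k {d} d<N = begin
    x d * ∑ N (λ c → A d c * u (suc k) c)
      ≈⟨ *-congˡ (∑-A-u (suc k) d<N) ⟩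
    x d * (nat (suc k) * e (suc k) - u (suc k) d)
      ≈⟨ *-congˡ (+-congʳ (nat-suc-* _ k)) ⟩
    x d * ((e (suc k) + nat k * e (suc k)) - u (suc k) d)
      ≈⟨ solve 4 (λ y e k u → y :* ((e :+ k :* e) :- u) := y :* (e :- u) :+ y :* (k :* e))
           refl _ _ _ _ ⟩
    u (suc (suc k)) d + x d * (nat k * e (suc k))
      ≈⟨ +-congˡ (*-congʳ (u-1 d)) ⟨
    u (suc (suc k)) d + u 1 d * (nat k * e (suc k))   ∎

  -- By T^-u₁, κ m j is the coefficient of u (suc j) in the series of the
  -- path on suc m vertices with its first vertex as root.
  κ : ℕ → ℕ → Carrier
  κ zero    zero    = 1#
  κ zero    (suc j) = 0#
  κ (suc m) zero    = ∑ (suc m) (λ j → (nat j * e (suc j)) * κ m j)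
  κ (suc m) (suc j) = κ m j

  T^-u₁ : ∀ m → T^ m (u 1) ≋ (λ d → ∑ (suc m) (λ j → u (suc j) d * κ m j))
  T^-u₁ zero _ = sym (trans (+-identityʳ _) (*-identityʳ _))
  T^-u₁ (suc m) {d} d<N = begin
    T^ (suc m) (u 1) d
      ≡⟨ ≡.cong (λ F → F d) (T^-T m (u 1)) ⟩
    T (T^ m (u 1)) d
      ≈⟨ T-cong (T^-u₁ m) d<N ⟩
    T (λ b → ∑ (suc m) (λ j → u (suc j) b * κ m j)) d
      ≈⟨ T-∑ (suc m) (λ j → u (suc j)) (κ m) d ⟩
    ∑ (suc m) (λ j → T (u (suc j)) d * κ m j)
      ≈⟨ ∑-cong (suc m) (λ j → trans (*-congʳ (T-u j d<N))
           (solve 4 (λ a b c k → (a :+ b :* c) :* k := b :* (c :* k) :+ a :* k)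
             refl _ _ _ (κ m j))) ⟩
    ∑ (suc m) (λ j → u 1 d * ((nat j * e (suc j)) * κ m j) + u (suc (suc j)) d * κ m j)
      ≈⟨ trans (∑-+ (suc m) (λ j → u 1 d * ((nat j * e (suc j)) * κ m j))
             (λ j → u (suc (suc j)) d * κ m j))
           (+-congʳ (∑-*ˡ (suc m) _ (λ j → (nat j * e (suc j)) * κ m j))) ⟩
    ∑ (suc (suc m)) (λ j → u (suc j) d * κ (suc m) j)   ∎

  -- The weight of the closed walks of length n through d.
  cyc : ℕ → ℕ → Carrier
  cyc n d = T^ n (λ b → δ b d) d

  -- The last vertex before the return to d may have any colour except d: all walks of n steps are
  -- counted, and those already at d are taken away.
  cyc-suc : ∀ n {d} → d < N → cyc (suc n) d ≈ T^ n (u 1) d - x d * cyc n d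
  cyc-suc n {d} d<N = begin
    T^ n (T (λ b → δ b d)) d
      ≈⟨ T^-cong n step d<N ⟩
    T^ n (λ b → u 1 b + δ b d * - x d) d
      ≈⟨ T^-+* n (u 1) (λ b → δ b d) (- x d) d<N ⟩
    T^ n (u 1) d + cyc n d * - x d
      ≈⟨ solve 3 (λ a b c → a :+ b :* :- c := a :- c :* b) refl _ _ _ ⟩
    T^ n (u 1) d - x d * cyc n d   ∎
    where
    step : T (λ b → δ b d) ≋ (λ b → u 1 b + δ b d * - x d)
    step {b} b<N = begin
      x b * ∑ N (λ c → A b c * δ c d)
        ≈⟨ *-congˡ (∑-cong N (λ c → trans (*-comm _ _) (*-congʳ (δ-sym c d)))) ⟩
      x b * ∑ N (λ c → δ d c * A b c)   ≈⟨ *-congˡ (∑-δ N (A b) d<N) ⟩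
      x b * A b d                       ≈⟨ expand ⟩
      x b + δ b d * - x d               ≈⟨ +-congʳ (u-1 b) ⟨
      u 1 b + δ b d * - x d             ∎
      where
      expand : x b * A b d ≈ x b + δ b d * - x d
      expand with b ℕ.≟ d
      ... | yes ≡.refl = trans (*-congˡ (-‿inverseʳ _)) (trans (zeroʳ _)
                           (sym (trans (+-congˡ (*-identityˡ _)) (-‿inverseʳ _))))
      ... | no _ = trans (solve 3 (λ o y z → y :* (o :- con 0ℤ) := o :* y :+ con 0ℤ :* :- z)
                           refl _ _ _) (+-congʳ (*-identityˡ _))

  -- The subtraction in `cyc-suc` is absorbed by the `u` 1 term of `T^-u₁`, whose coefficient is the
  -- sum of j e (j+1) κ m j: the difference x d (e (j+1) - u (j+1) d) is u (j+2) d. This adds j to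
  -- the coefficient 1 which u (j+2) κ m j already has.
  cyc≈ : ∀ m {d} → d < N → cyc (suc m) d ≈ ∑ (suc m) (λ j → nat j * (u (suc j) d * κ m j))
  cyc≈ zero {d} d<N = begin
    cyc 1 d                     ≈⟨ cyc-suc 0 d<N ⟩
    u 1 d - x d * δ d d         ≈⟨ +-cong (u-1 d) (-‿cong (trans (*-congˡ (δ-refl d)) (*-identityʳ _))) ⟩
    x d - x d                   ≈⟨ solve 2 (λ a b → a :- a := con 0ℤ :* b :+ con 0ℤ) refl _ _ ⟩
    0# * (u 1 d * 1#) + 0#      ∎
  cyc≈ (suc m) {d} d<N = begin
    cyc (suc (suc m)) d
      ≈⟨ cyc-suc (suc m) d<N ⟩
    T^ (suc m) (u 1) d - x d * cyc (suc m) d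
      ≈⟨ +-cong (T^-u₁ (suc m) d<N) (-‿cong (*-congˡ (cyc≈ m d<N))) ⟩
    (u 1 d * κ (suc m) 0 + W) - x d * ∑ (suc m) (λ j → nat j * (u (suc j) d * κ m j))
      ≈⟨ +-congˡ (-‿cong (trans (sym (∑-*ˡ (suc m) _ f)) (trans (∑-cong (suc m) term)
           (trans (∑-minus (suc m) (λ j → x d * g j) h) (+-congʳ (∑-*ˡ (suc m) _ g)))))) ⟩
    (u 1 d * κ (suc m) 0 + W) - (x d * κ (suc m) 0 - V)
      ≈⟨ +-congʳ (+-congʳ (*-congʳ (u-1 d))) ⟩
    (x d * κ (suc m) 0 + W) - (x d * κ (suc m) 0 - V)
      ≈⟨ solve 4 (λ a w v z → (a :+ w) :- (a :- v) := con 0ℤ :* z :+ (w :+ v)) refl _ _ _ _ ⟩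
    0# * (u 1 d * κ (suc m) 0) + (W + V)
      ≈⟨ +-congˡ (trans (sym (∑-+ (suc m) w h)) (∑-cong (suc m) (λ j → sym (nat-suc-* (w j) j)))) ⟩
    ∑ (suc (suc m)) (λ j → nat j * (u (suc j) d * κ (suc m) j))   ∎
    where
    f g h w : ℕ → Carrier
    f j = nat j * (u (suc j) d * κ m j)
    g j = (nat j * e (suc j)) * κ m j
    w j = u (suc (suc j)) d * κ m j
    h j = nat j * w j
    W V : Carrier
    W = ∑ (suc m) w
    V = ∑ (suc m) h
    term : ∀ j → x d * f j ≈ x d * g j - h j
    term j = solve 5 (λ y n E w k →
      y :* (n :* (w :* k)) := y :* ((n :* E) :* k) :- n :* ((y :* (E :- w)) :* k))
      refl _ _ _ _ _

  -- What κ m j is multiplied by in T^-u; H is its analogue for cycle-u.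
  G : ℕ → ℕ → ℕ → Carrier
  G k j d = ∑ (suc j) (λ i → nat (k ℕ.+ j ∸ i) * (u (suc i) d * e (suc (k ℕ.+ j ∸ i))))

  G-suc : ∀ k j d → G k (suc j) d ≈ G (suc k) j d + u (suc (suc j)) d * (nat k * e (suc k))
  G-suc k j d = begin
    G k (suc j) d
      ≈⟨ ∑-last (suc j) (λ i → nat (k ℕ.+ suc j ∸ i) * (u (suc i) d * e (suc (k ℕ.+ suc j ∸ i)))) ⟩
    ∑ (suc j) (λ i → nat (k ℕ.+ suc j ∸ i) * (u (suc i) d * e (suc (k ℕ.+ suc j ∸ i)))) +
      nat (k ℕ.+ suc j ∸ suc j) * (u (suc (suc j)) d * e (suc (k ℕ.+ suc j ∸ suc j)))
      ≡⟨ ≡.cong₂ (λ s t →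
           ∑ (suc j) (λ i → nat (s ∸ i) * (u (suc i) d * e (suc (s ∸ i)))) +
           nat t * (u (suc (suc j)) d * e (suc t)))
           (ℕ.+-suc k j) (ℕ.m+n∸n≡m k (suc j)) ⟩
    G (suc k) j d + nat k * (u (suc (suc j)) d * e (suc k))
      ≈⟨ +-congˡ (solve 3 (λ a b c → a :* (b :* c) := b :* (a :* c)) refl _ _ _) ⟩
    G (suc k) j d + u (suc (suc j)) d * (nat k * e (suc k))   ∎

  -- The first step is `T-u`. Its main term is treated by induction with k + 1, and its `u` 1 term
  -- grows into a path by `T^-u₁`; for each j, `G-suc` merges the two contributions.
  T^-u : ∀ m k → T^ (suc m) (u (suc k)) ≋
    (λ d → u (suc (suc m) ℕ.+ k) d + ∑ (suc m) (λ j → κ m j * G k j d))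
  T^-u zero k {d} d<N = begin
    T (u (suc k)) d
      ≈⟨ T-u k d<N ⟩
    u (suc (suc k)) d + u 1 d * (nat k * e (suc k))
      ≡⟨ ≡.cong (λ l → u (suc (suc k)) d + u 1 d * (nat l * e (suc l))) (ℕ.+-identityʳ k) ⟨
    u (suc (suc k)) d + u 1 d * (nat (k ℕ.+ 0) * e (suc (k ℕ.+ 0)))
      ≈⟨ +-congˡ (trans (solve 3 (λ a b c → a :* (b :* c) := b :* (a :* c) :+ con 0ℤ) refl _ _ _)
           (trans (sym (*-identityˡ _)) (sym (+-identityʳ _)))) ⟩
    u (suc (suc k)) d + (1# * G k 0 d + 0#)   ∎
  T^-u (suc m) k {d} d<N = begin
    T^ (suc m) (T (u (suc k))) d
      ≈⟨ T^-cong (suc m) (T-u k) d<N ⟩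
    T^ (suc m) (λ b → u (suc (suc k)) b + u 1 b * q) d
      ≈⟨ T^-+* (suc m) (u (suc (suc k))) (u 1) q d<N ⟩
    T^ (suc m) (u (suc (suc k))) d + T^ (suc m) (u 1) d * q
      ≈⟨ +-cong (T^-u m (suc k) d<N) (*-congʳ (T^-u₁ (suc m) d<N)) ⟩
    (u (suc (suc m) ℕ.+ suc k) d + ∑ (suc m) (λ j → κ m j * G (suc k) j d)) +
      (u 1 d * κ (suc m) 0 + ∑ (suc m) (λ j → u (suc (suc j)) d * κ m j)) * q
      ≈⟨ solve 5 (λ a b c w q → (a :+ b) :+ (c :+ w) :* q := a :+ (c :* q :+ (b :+ w :* q)))
           refl _ _ _ _ _ ⟩
    u (suc (suc m) ℕ.+ suc k) d + ((u 1 d * κ (suc m) 0) * q +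
      (∑ (suc m) (λ j → κ m j * G (suc k) j d) + ∑ (suc m) (λ j → u (suc (suc j)) d * κ m j) * q))
      ≈⟨ +-cong (reflexive (≡.cong (λ l → u l d) (ℕ.+-suc (suc (suc m)) k))) (+-cong head tail) ⟩
    u (suc (suc (suc m)) ℕ.+ k) d + ∑ (suc (suc m)) (λ j → κ (suc m) j * G k j d)   ∎
    where
    q : Carrier
    q = nat k * e (suc k)
    w : ℕ → Carrier
    w j = u (suc (suc j)) d * κ m j
    head : (u 1 d * κ (suc m) 0) * q ≈ κ (suc m) 0 * G k 0 d
    head = trans
      (solve 4 (λ a b c f → (a :* b) :* (c :* f) := b :* (c :* (a :* f) :+ con 0ℤ)) refl _ _ _ _)
      (reflexive (≡.cong (λ l → κ (suc m) 0 * (nat l * (u 1 d * e (suc l)) + 0#))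
        (≡.sym (ℕ.+-identityʳ k))))
    tail : ∑ (suc m) (λ j → κ m j * G (suc k) j d) + ∑ (suc m) (λ j → u (suc (suc j)) d * κ m j) * q ≈
           ∑ (suc m) (λ j → κ m j * G k (suc j) d)
    tail = trans (+-congˡ (sym (∑-*ʳ (suc m) q w)))
      (trans (sym (∑-+ (suc m) (λ j → κ m j * G (suc k) j d) (λ j → w j * q)))
      (∑-cong (suc m) (λ j → trans
        (solve 4 (λ k g w q → k :* g :+ (w :* k) :* q := k :* (g :+ w :* q))
          refl (κ m j) (G (suc k) j d) (u (suc (suc j)) d) q)
        (*-congˡ (sym (G-suc k j d))))))

  -- `T^` n applied to the indicator of c and evaluated at d is the (d, c) entry of the n-th power
  -- of the transfer matrix. The closing edge forbids c = d, so the diagonal entry `cyc` n d is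
  -- removed.
  cycle-kernel : ∀ n F {d} → d < N →
    ∑ N (λ c → (A d c * T^ n (λ b → δ b c) d) * F c) ≈ T^ n F d - cyc n d * F d
  cycle-kernel n F {d} d<N = begin
    ∑ N (λ c → (A d c * T^ n (λ b → δ b c) d) * F c)
      ≈⟨ ∑-cong N (λ c → *-assoc _ _ _) ⟩
    ∑ N (λ c → A d c * (T^ n (λ b → δ b c) d * F c))
      ≈⟨ ∑-A N _ d<N ⟩
    ∑ N (λ c → T^ n (λ b → δ b c) d * F c) - cyc n d * F d
      ≈⟨ +-congʳ (T^-∑ n N (λ c b → δ b c) F d<N) ⟨
    T^ n (λ b → ∑ N (λ c → δ b c * F c)) d - cyc n d * F d
      ≈⟨ +-congʳ (T^-cong n (∑-δ N F) d<N) ⟩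
    T^ n F d - cyc n d * F d   ∎

  H : ℕ → ℕ → ℕ → Carrier
  H k j d = G k j d - nat j * (u (suc k) d * u (suc j) d)

  cycle-u : ∀ m k {d} → d < N →
    ∑ N (λ c → (A d c * T^ (suc m) (λ b → δ b c) d) * u (suc k) c) ≈
    u (suc (suc m) ℕ.+ k) d + ∑ (suc m) (λ j → κ m j * H k j d)
  cycle-u m k {d} d<N = begin
    ∑ N (λ c → (A d c * T^ (suc m) (λ b → δ b c) d) * u (suc k) c)
      ≈⟨ cycle-kernel (suc m) (u (suc k)) d<N ⟩
    T^ (suc m) (u (suc k)) d - cyc (suc m) d * u (suc k) d
      ≈⟨ +-cong (T^-u m k d<N) (-‿cong (*-congʳ (cyc≈ m d<N))) ⟩
    (u (suc (suc m) ℕ.+ k) d + ∑ (suc m) g) - ∑ (suc m) h * u (suc k) d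
      ≈⟨ trans (+-congˡ (-‿cong (sym (∑-*ʳ (suc m) _ h)))) (+-assoc _ _ _) ⟩
    u (suc (suc m) ℕ.+ k) d + (∑ (suc m) g - ∑ (suc m) (λ j → h j * u (suc k) d))
      ≈⟨ +-congˡ (trans (sym (∑-minus (suc m) g (λ j → h j * u (suc k) d)))
           (∑-cong (suc m) (λ j →
             solve 5 (λ κ g n a b → κ :* g :- (n :* (a :* κ)) :* b := κ :* (g :- n :* (b :* a)))
               refl (κ m j) (G k j d) (nat j) (u (suc j) d) (u (suc k) d)))) ⟩
    u (suc (suc m) ℕ.+ k) d + ∑ (suc m) (λ j → κ m j * H k j d)   ∎
    where
    g h : ℕ → Carrier
    g j = κ m j * G k j d
    h j = nat j * (u (suc j) d * κ m j)

  -- Here t is the smaller of k + 1 and j + 1, where the expansion of the product stops. Its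
  -- positive part meets the first t summands of `G` and lowers their coefficients from k+j-i to
  -- k-i; the other r summands are untouched, and the negative part of the expansion comes back with
  -- the sign plus.
  H-positive : ∀ k j t r d → t ℕ.+ r ≡ suc j → t ≤ suc k → t ≡ suc k ⊎ t ≡ suc j →
    H k j d ≈
    (∑ t (λ i → nat (k ∸ i) * (u (suc i) d * e (suc (k ℕ.+ j ∸ i)))) +
     ∑ r (λ i → nat (k ℕ.+ j ∸ (t ℕ.+ i)) * (u (suc (t ℕ.+ i)) d * e (suc (k ℕ.+ j ∸ (t ℕ.+ i)))))) +
    nat j * ∑ t (λ i → u (suc k ℕ.+ suc j ∸ i) d * e i)
  H-positive k j t r d t+r≡1+j t≤1+k t≡ = begin
    G k j d - nat j * UU
      ≈⟨ +-cong G-split (-‿cong (*-congˡ product)) ⟩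
    (∑ t (λ i → nat (k ℕ.+ j ∸ i) * w i) + Z) - nat j * (∑ t w - V)
      ≈⟨ solve 5 (λ g z j w v → (g :+ z) :- j :* (w :- v) := ((g :- j :* w) :+ z) :+ j :* v)
           refl _ _ _ _ _ ⟩
    ((∑ t (λ i → nat (k ℕ.+ j ∸ i) * w i) - nat j * ∑ t w) + Z) + nat j * V
      ≈⟨ +-congʳ (+-congʳ (trans (+-congˡ (-‿cong (sym (∑-*ˡ t _ w))))
           (trans (sym (∑-minus t _ _)) (∑-cong< t term)))) ⟩
    (∑ t (λ i → nat (k ∸ i) * w i) + Z) + nat j * V   ∎
    where
    w : ℕ → Carrier
    w i = u (suc i) d * e (suc (k ℕ.+ j ∸ i))
    UU V Z : Carrier
    UU = u (suc k) d * u (suc j) d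
    V = ∑ t (λ i → u (suc k ℕ.+ suc j ∸ i) d * e i)
    Z = ∑ r (λ i → nat (k ℕ.+ j ∸ (t ℕ.+ i)) * w (t ℕ.+ i))
    t≤1+j : t ≤ suc j
    t≤1+j = ≡.subst (t ≤_) t+r≡1+j (ℕ.m≤m+n t r)
    G-split : G k j d ≈ ∑ t (λ i → nat (k ℕ.+ j ∸ i) * w i) + Z
    G-split = trans (reflexive (≡.cong (λ l → ∑ l (λ i → nat (k ℕ.+ j ∸ i) * w i)) (≡.sym t+r≡1+j)))
                (∑-split t r _)
    term : ∀ i → i < t → nat (k ℕ.+ j ∸ i) * w i - nat j * w i ≈ nat (k ∸ i) * w i
    term i i<t = trans (solve 3 (λ a b w → a :* w :- b :* w := (a :- b) :* w) refl _ _ _)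
      (*-congʳ (trans (+-congʳ (trans (reflexive (≡.cong nat k+j∸i)) (nat-+ (k ∸ i) j)))
        (solve 2 (λ a b → (a :+ b) :- b := a) refl _ _)))
      where
      k+j∸i : k ℕ.+ j ∸ i ≡ k ∸ i ℕ.+ j
      k+j∸i = ℕ.+-∸-comm j (ℕ.s≤s⁻¹ (ℕ.≤-trans i<t t≤1+k))
    pairs : t ≡ suc k ⊎ t ≡ suc j →
      UU + ∑ t (λ i → e i * u (suc k ℕ.+ suc j ∸ i) d) ≈
      ∑ (suc t) (λ i → u i d * e (suc k ℕ.+ suc j ∸ i))
    pairs (inj₁ ≡.refl) = pt-product e (x d) _ (suc k) (suc j) ≡.refl
    pairs (inj₂ ≡.refl) = trans (+-congʳ (*-comm _ _))
      (pt-product e (x d) _ (suc j) (suc k) (ℕ.+-comm (suc j) (suc k)))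
    exponent : ∀ i → i < t → k ℕ.+ suc j ∸ i ≡ suc (k ℕ.+ j ∸ i)
    exponent i i<t = ≡.trans (≡.cong (_∸ i) (ℕ.+-suc k j))
      (ℕ.+-∸-assoc 1 (ℕ.≤-trans (ℕ.s≤s⁻¹ (ℕ.≤-trans i<t t≤1+j)) (ℕ.m≤n+m j k)))
    product : UU ≈ ∑ t w - V
    product = begin
      UU
        ≈⟨ solve 2 (λ a b → a := (a :+ b) :- b) refl _ _ ⟩
      (UU + ∑ t (λ i → e i * u (suc k ℕ.+ suc j ∸ i) d)) -
        ∑ t (λ i → e i * u (suc k ℕ.+ suc j ∸ i) d)
        ≈⟨ +-cong (pairs t≡) (-‿cong (∑-cong t (λ i → *-comm _ _))) ⟩
      (0# * e (suc k ℕ.+ suc j) + ∑ t (λ i → u (suc i) d * e (k ℕ.+ suc j ∸ i))) - V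
        -- The summand at 0 contains `u` 0 d, which is 0#. Dropping it aligns the index with that of
        -- `G`.
        ≈⟨ +-congʳ (trans (+-congʳ (zeroˡ _)) (+-identityˡ _)) ⟩
      ∑ t (λ i → u (suc i) d * e (k ℕ.+ suc j ∸ i)) - V
        ≈⟨ +-congʳ (∑-cong< t (λ i i<t →
             reflexive (≡.cong (λ l → u (suc i) d * e l) (exponent i i<t)))) ⟩
      ∑ t w - V   ∎

infix 4 _≢?_
_≢?_ : ∀ (b c : ℕ) → Dec (b ≢ c)
b ≢? c = ¬? (b ℕ.≟ c)

-- Weighted sums over words

module Words (R : CommutativeRing 0ℓ 0ℓ) (N : ℕ) (x : ℕ → CommutativeRing.Carrier R) where
  open CommutativeRing R
  open Transfer R N x public
  open SetoidReasoning setoid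

  -- The sum of h over all words of length k in the letters 0, …, N - 1.
  W : ℕ → (List ℕ → Carrier) → Carrier
  W zero    h = h []
  W (suc k) h = ∑ N (λ c → W k (λ w → h (c ∷ w)))

  mono : List ℕ → Carrier
  mono = foldr (λ i m → x i * m) 1#

  W-cong : ∀ k {g h} → (∀ w → length w ≡ k → g w ≈ h w) → W k g ≈ W k h
  W-cong zero    eq = eq [] ≡.refl
  W-cong (suc k) eq = ∑-cong N (λ c → W-cong k (λ w len → eq (c ∷ w) (cong suc len)))

  W-*ˡ : ∀ k a g → W k (λ w → a * g w) ≈ a * W k g
  W-*ˡ zero    a g = refl
  W-*ˡ (suc k) a g = trans (∑-cong N (λ c → W-*ˡ k a (g ∘ (c ∷_)))) (∑-*ˡ N a _)

  W-*ʳ : ∀ k a g → W k (λ w → g w * a) ≈ W k g * a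
  W-*ʳ k a g = trans (W-cong k (λ w _ → *-comm _ _)) (trans (W-*ˡ k a g) (*-comm _ _))

  W-∑ : ∀ k (g : List ℕ → ℕ → Carrier) →
        W k (λ w → ∑ N (g w)) ≈ ∑ N (λ c → W k (λ w → g w c))
  W-∑ zero    g = refl
  W-∑ (suc k) g = trans (∑-cong N (λ b → W-∑ k (g ∘ (b ∷_)))) (∑-swap N N _)

  W-++ : ∀ a b g → W (a ℕ.+ b) g ≈ W a (λ u → W b (λ v → g (u ++ v)))
  W-++ zero    b g = refl
  W-++ (suc a) b g = ∑-cong N (λ c → W-++ a b (g ∘ (c ∷_)))

  mono-++ : ∀ u v → mono (u ++ v) ≈ mono u * mono v
  mono-++ []      v = sym (*-identityˡ _)
  mono-++ (b ∷ u) v = trans (*-congˡ (mono-++ u v)) (sym (*-assoc _ _ _))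

  -- The words contributing to an elementary symmetric polynomial

  From : ℕ → List ℕ → Set
  From j []      = ⊤
  From j (b ∷ w) = j ≤ b × From (suc b) w

  from? : ∀ j w → Dec (From j w)
  from? j []      = yes tt
  from? j (b ∷ w) = (j ℕ.≤? b) ×-dec from? (suc b) w

  W-from : ∀ j k → W k (λ w → ind (from? j w) * mono w) ≈ ε j k
  W-from j zero    = *-identityˡ _
  W-from j (suc k) = ∑-cong N (λ b → trans
    (W-cong k (λ w _ → trans
      (*-congʳ (ind-× (from? j (b ∷ w)) (j ℕ.≤? b) (from? (suc b) w) id _,_))
      (solve 4 (λ p q y m → (p :* q) :* (y :* m) := (p :* y) :* (q :* m)) refl _ _ _ _)))
    (trans (W-*ˡ k _ _) (trans (*-congˡ (W-from (suc b) k)) (*-assoc _ _ _))))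

  -- Words without repeated letters

  prod : (ℕ → Carrier) → List ℕ → Carrier
  prod f = foldr (λ z m → f z * m) 1#

  prod-* : ∀ f g l → prod (λ z → f z * g z) l ≈ prod f l * prod g l
  prod-* f g []      = sym (*-identityˡ _)
  prod-* f g (z ∷ l) = trans (*-congˡ (prod-* f g l))
    (solve 4 (λ a b c d → (a :* b) :* (c :* d) := (a :* c) :* (b :* d)) refl _ _ _ _)

  prod-cong : ∀ {f g} l → (∀ z → f z ≈ g z) → prod f l ≈ prod g l
  prod-cong []      eq = refl
  prod-cong (z ∷ l) eq = *-cong (eq z) (prod-cong l eq)

  distinct : List ℕ → Carrier
  distinct []      = 1#
  distinct (b ∷ l) = prod (A b) l * distinct l

  -- The last letter is the colour of the gluing vertex, which has to be kept fixed while the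
  -- letters before it are summed.
  distinct-∷ʳ : ∀ u c → distinct (u ++ c ∷ []) ≈ distinct u * prod (A c) u
  distinct-∷ʳ []      c = refl
  distinct-∷ʳ (b ∷ u) c = begin
    prod (A b) (u ++ c ∷ []) * distinct (u ++ c ∷ [])
      ≈⟨ *-cong (prod-∷ʳ u) (distinct-∷ʳ u c) ⟩
    (prod (A b) u * A b c) * (distinct u * prod (A c) u)
      ≈⟨ *-congʳ (*-congˡ (A-sym b c)) ⟩
    (prod (A b) u * A c b) * (distinct u * prod (A c) u)
      ≈⟨ solve 4 (λ p a d q → (p :* a) :* (d :* q) := (p :* d) :* (a :* q)) refl _ _ _ _ ⟩
    (prod (A b) u * distinct u) * (A c b * prod (A c) u)   ∎
    where
    prod-∷ʳ : ∀ l → prod (A b) (l ++ c ∷ []) ≈ prod (A b) l * A b c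
    prod-∷ʳ []      = *-comm _ _
    prod-∷ʳ (z ∷ l) = trans (*-congˡ (prod-∷ʳ l)) (sym (*-assoc _ _ _))

  -- The condition that later letters differ from the first letter b is moved into the weight a,
  -- which becomes `A` b z * a z.
  W-distinct : ∀ k a → W k (λ u → (prod a u * distinct u) * mono u) ≈ injections k a
  W-distinct zero    a = trans (*-congʳ (*-identityˡ _)) (*-identityˡ _)
  W-distinct (suc k) a = ∑-cong N (λ b → trans
    (W-cong k (λ u _ → begin
      ((a b * prod a u) * (prod (A b) u * distinct u)) * (x b * mono u)
        ≈⟨ solve 6 (λ a p q d y m → ((a :* p) :* (q :* d)) :* (y :* m) :=
             (a :* y) :* (((q :* p) :* d) :* m)) refl _ _ _ _ _ _ ⟩
      (a b * x b) * (((prod (A b) u * prod a u) * distinct u) * mono u)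
        ≈⟨ *-congˡ (*-congʳ (*-congʳ (prod-* (A b) a u))) ⟨
      (a b * x b) * ((prod (λ z → A b z * a z) u * distinct u) * mono u)   ∎))
    (trans (W-*ˡ k _ _) (trans (*-congˡ (W-distinct k (λ z → A b z * a z))) (*-assoc _ _ _))))

  ind-distinct : ∀ l → ind (allPairs? _≢?_ l) ≈ distinct l
  ind-distinct []      = ind-yes (allPairs? _≢?_ []) []
  ind-distinct (b ∷ l) = trans
    (ind-× (allPairs? _≢?_ (b ∷ l)) (ListAll.all? (b ≢?_) l) (allPairs? _≢?_ l)
      (λ { (p ∷ q) → p , q }) _∷_)
    (*-cong (ind-all l) (ind-distinct l))
    where
    ind-all : ∀ l → ind (ListAll.all? (b ≢?_) l) ≈ prod (A b) l
    ind-all []      = ind-yes (ListAll.all? (b ≢?_) []) []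
    ind-all (c ∷ l) = trans
      (ind-× (ListAll.all? (b ≢?_) (c ∷ l)) (b ≢? c) (ListAll.all? (b ≢?_) l) (λ { (p ∷ q) → p , q }) _∷_)
      (*-cong (ind-≢ (b ≢? c) b c id id) (ind-all l))

  -- Words with distinct neighbouring letters

  path : ℕ → List ℕ → Carrier
  path d []      = 1#
  path d (b ∷ l) = A d b * path b l

  ind-path : ∀ d l → ind (linked? _≢?_ (d ∷ l)) ≈ path d l
  ind-path d []      = ind-yes (linked? _≢?_ (d ∷ [])) [-]
  ind-path d (b ∷ l) = trans
    (ind-× (linked? _≢?_ (d ∷ b ∷ l)) (d ≢? b) (linked? _≢?_ (b ∷ l)) (λ { (p ∷ q) → p , q }) _∷_)
    (*-cong (ind-≢ (d ≢? b) d b id id) (ind-path b l))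

  -- One application of `T` for each of the k + 1 edges from d to c. The variable of c is left out
  -- because the graph glued at that vertex will supply it.
  W-path : ∀ k d {c} → c < N →
    W k (λ u → path d (u ++ c ∷ []) * mono (d ∷ u)) ≈ T^ (suc k) (λ b → δ b c) d
  W-path zero d {c} c<N = begin
    (A d c * 1#) * (x d * 1#)
      ≈⟨ *-cong (*-identityʳ _) (*-identityʳ _) ⟩
    A d c * x d
      ≈⟨ *-comm _ _ ⟩
    x d * A d c
      ≈⟨ *-congˡ (∑-δ N (A d) c<N) ⟨
    x d * ∑ N (λ b → δ c b * A d b)
      ≈⟨ *-congˡ (∑-cong N (λ b → trans (*-comm _ _) (*-congˡ (δ-sym c b)))) ⟩
    x d * ∑ N (λ b → A d b * δ b c)   ∎
  W-path (suc k) d {c} c<N = begin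
    ∑ N (λ b → W k (λ u → (A d b * path b (u ++ c ∷ [])) * (x d * mono (b ∷ u))))
      ≈⟨ ∑-cong N (λ b → trans
           (W-cong k (λ u _ → solve 4 (λ a p y m → (a :* p) :* (y :* m) := (y :* a) :* (p :* m))
             refl _ _ _ (mono (b ∷ u))))
           (trans (W-*ˡ k _ _) (trans (*-congˡ (W-path k b c<N)) (*-assoc _ _ _)))) ⟩
    ∑ N (λ b → x d * (A d b * T^ (suc k) (λ z → δ z c) b))
      ≈⟨ ∑-*ˡ N _ _ ⟩
    T (T^ (suc k) (λ z → δ z c)) d
      ≡⟨ cong (λ F → F d) (T^-T (suc k) (λ z → δ z c)) ⟨
    T^ (suc (suc k)) (λ z → δ z c) d   ∎

-- The ring of power series in one variable

module Series (R : CommutativeRing 0ℓ 0ℓ) where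
  open CommutativeRing R
  open Sums R
  open SetoidReasoning setoid

  infixl 7 _⊛_
  _⊛_ : (ℕ → Carrier) → (ℕ → Carrier) → ℕ → Carrier
  (f ⊛ g) n = ∑ (suc n) (λ i → f i * g (n ∸ i))

  infix 4 _≐_
  _≐_ : (ℕ → Carrier) → (ℕ → Carrier) → Set
  f ≐ g = ∀ n → f n ≈ g n

  const : Carrier → ℕ → Carrier
  const a zero    = a
  const a (suc n) = 0#

  private
    tail : (ℕ → Carrier) → ℕ → Carrier
    tail f n = f (suc n)

    ⊛-cong : ∀ {f f′ g g′} → f ≐ f′ → g ≐ g′ → f ⊛ g ≐ f′ ⊛ g′
    ⊛-cong p q n = ∑-cong (suc n) (λ i → *-cong (p i) (q (n ∸ i)))

    -- Splits the convolution at its last summand, where its definition splits at the first;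
    -- commutativity follows by comparing the two.
    ⊛-sucʳ : ∀ f g n → (f ⊛ g) (suc n) ≈ (f ⊛ tail g) n + f (suc n) * g 0
    ⊛-sucʳ f g zero    = solve 4 (λ a b c d → a :* b :+ (c :* d :+ con 0ℤ) :=
      (a :* b :+ con 0ℤ) :+ c :* d) refl _ _ _ _
    ⊛-sucʳ f g (suc n) = trans (+-congˡ (⊛-sucʳ (tail f) g n)) (sym (+-assoc _ _ _))

    ⊛-comm : ∀ f g → f ⊛ g ≐ g ⊛ f
    ⊛-comm f g zero    = +-congʳ (*-comm _ _)
    ⊛-comm f g (suc n) = begin
      f 0 * g (suc n) + (tail f ⊛ g) n   ≈⟨ +-cong (*-comm _ _) (⊛-comm (tail f) g n) ⟩
      g (suc n) * f 0 + (g ⊛ tail f) n   ≈⟨ +-comm _ _ ⟩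
      (g ⊛ tail f) n + g (suc n) * f 0   ≈⟨ ⊛-sucʳ g f n ⟨
      (g ⊛ f) (suc n)                    ∎

    ⊛-distribʳ : ∀ h f g → (λ n → f n + g n) ⊛ h ≐ (λ n → (f ⊛ h) n + (g ⊛ h) n)
    ⊛-distribʳ h f g n = trans (∑-cong (suc n) (λ i → distribʳ (h (n ∸ i)) (f i) (g i)))
                           (∑-+ (suc n) (λ i → f i * h (n ∸ i)) (λ i → g i * h (n ∸ i)))

    ⊛-scale : ∀ a f g → (λ n → a * f n) ⊛ g ≐ (λ n → a * (f ⊛ g) n)
    ⊛-scale a f g n = trans (∑-cong (suc n) (λ i → *-assoc a (f i) (g (n ∸ i))))
                          (∑-*ˡ (suc n) a (λ i → f i * g (n ∸ i)))

    ⊛-assoc : ∀ f g h → (f ⊛ g) ⊛ h ≐ f ⊛ (g ⊛ h)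
    ⊛-assoc f g h zero    = solve 3 (λ a b c → (a :* b :+ con 0ℤ) :* c :+ con 0ℤ :=
      a :* (b :* c :+ con 0ℤ) :+ con 0ℤ) refl _ _ _
    ⊛-assoc f g h (suc n) = begin
      (f 0 * g 0 + 0#) * h (suc n) + ((λ i → f 0 * g (suc i) + (tail f ⊛ g) i) ⊛ h) n
        ≈⟨ +-cong (*-congʳ (+-identityʳ _)) (trans (⊛-distribʳ h (λ i → f 0 * tail g i) (tail f ⊛ g) n)
             (+-cong (⊛-scale (f 0) (tail g) h n) (⊛-assoc (tail f) g h n))) ⟩
      (f 0 * g 0) * h (suc n) + (f 0 * (tail g ⊛ h) n + (tail f ⊛ (g ⊛ h)) n)
        ≈⟨ solve 5 (λ a b c d e → (a :* b) :* c :+ (a :* d :+ e) := a :* (b :* c :+ d) :+ e)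
             refl _ _ _ _ _ ⟩
      f 0 * (g 0 * h (suc n) + (tail g ⊛ h) n) + (tail f ⊛ (g ⊛ h)) n   ∎

  ⊛-const : ∀ a f n → (const a ⊛ f) n ≈ a * f n
  ⊛-const a f zero    = +-identityʳ _
  ⊛-const a f (suc n) =
    trans (+-congˡ (trans (∑-cong (suc n) (λ i → zeroˡ (f (n ∸ i)))) (∑-0 (suc n)))) (+-identityʳ _)

  series : CommutativeRing 0ℓ 0ℓ
  series = record
    { Carrier = ℕ → Carrier
    ; _≈_ = _≐_
    ; _+_ = λ f g n → f n + g n
    ; _*_ = _⊛_
    ; -_  = λ f n → - f n
    ; 0#  = λ _ → 0#
    ; 1#  = const 1#
    ; isCommutativeRing = record
      { isRing = record
        { +-isAbelianGroup = Pointwise.isAbelianGroup ℕ +-isAbelianGroup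
        ; *-cong = ⊛-cong
        ; *-assoc = ⊛-assoc
        ; *-identity = ⊛-identityˡ , λ f n → trans (⊛-comm f (const 1#) n) (⊛-identityˡ f n)
        ; distrib = (λ f g h n → trans (⊛-comm f (λ m → g m + h m) n) (trans (⊛-distribʳ f g h n)
                      (+-cong (⊛-comm g f n) (⊛-comm h f n))))
                  , ⊛-distribʳ
        }
      ; *-comm = ⊛-comm
      }
    }
    where
    ⊛-identityˡ : ∀ f → const 1# ⊛ f ≐ f
    ⊛-identityˡ f n = trans (⊛-const 1# f n) (*-identityˡ _)

-- ℤ[[x₀, …, x_{N-1}]] as an iterated ring of power series in one variable.
Poly : ℕ → CommutativeRing 0ℓ 0ℓ
Poly zero    = ℤ.+-*-commutativeRing
Poly (suc N) = Series.series (Poly N)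

-- Sums over lists of integers

sumOver-cong : ∀ {A : Set} (xs : List A) {f g : A → ℤ} → (∀ a → f a ≡ g a) →
               sumOver xs f ≡ sumOver xs g
sumOver-cong []       eq = ≡.refl
sumOver-cong (a ∷ xs) eq = cong₂ ℤ._+_ (eq a) (sumOver-cong xs eq)

sumOver-map : ∀ {A B : Set} (h : A → B) xs (f : B → ℤ) →
              sumOver (List.map h xs) f ≡ sumOver xs (f ∘ h)
sumOver-map h []       f = ≡.refl
sumOver-map h (a ∷ xs) f = cong (ℤ._+_ (f (h a))) (sumOver-map h xs f)

sumOver-++ : ∀ {A : Set} (xs ys : List A) (f : A → ℤ) →
             sumOver (xs ++ ys) f ≡ sumOver xs f ℤ.+ sumOver ys f
sumOver-++ []       ys f = ≡.sym (ℤ.+-identityˡ _)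
sumOver-++ (a ∷ xs) ys f =
  ≡.trans (cong (ℤ._+_ (f a)) (sumOver-++ xs ys f)) (≡.sym (ℤ.+-assoc (f a) _ _))

sumOver-cartesianProductWith : ∀ {A B D : Set} (h : A → B → D) xs ys (f : D → ℤ) →
  sumOver (cartesianProductWith h xs ys) f ≡ sumOver xs (λ a → sumOver ys (λ b → f (h a b)))
sumOver-cartesianProductWith h []       ys f = ≡.refl
sumOver-cartesianProductWith h (a ∷ xs) ys f = ≡.trans
  (sumOver-++ (List.map (h a) ys) _ f)
  (cong₂ ℤ._+_ (sumOver-map (h a) ys f) (sumOver-cartesianProductWith h xs ys f))

χ : ∀ {P : Set} → Dec P → ℤ
χ d = if does d then 1ℤ else 0ℤ

χ-no : ∀ {P : Set} (d : Dec P) → ¬ P → χ d ≡ 0ℤ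
χ-no (yes p) ¬p = contradiction p ¬p
χ-no (no _)  ¬p = ≡.refl

χ-yes : ∀ {P : Set} (d : Dec P) → P → χ d ≡ 1ℤ
χ-yes (yes _) p = ≡.refl
χ-yes (no ¬p) p = contradiction p ¬p

χ-⇔ : ∀ {P Q : Set} (d : Dec P) (d′ : Dec Q) → (P → Q) → (Q → P) → χ d ≡ χ d′
χ-⇔ (yes p) d′ f g = ≡.sym (χ-yes d′ (f p))
χ-⇔ (no ¬p) d′ f g = ≡.sym (χ-no d′ (¬p ∘ g))

length-filter : ∀ {A : Set} {P : A → Set} (P? : Unary.Decidable P) xs →
                + length (filter P? xs) ≡ sumOver xs (λ a → χ (P? a))
length-filter P? []       = ≡.refl
length-filter P? (a ∷ xs) with P? a
... | yes _ = ≡.trans (ℤ.pos-+ 1 _) (cong (ℤ._+_ 1ℤ) (length-filter P? xs))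
... | no  _ = ≡.trans (length-filter P? xs) (≡.sym (ℤ.+-identityˡ _))

infix 4 _≟ᵛ_
_≟ᵛ_ : ∀ {N} (α β : Vec ℕ N) → Dec (α ≡ β)
_≟ᵛ_ = Vec.≡-dec ℕ._≟_

-- Coefficients

module P N = CommutativeRing (Poly N)

coeff : ∀ N → P.Carrier N → Vec ℕ N → ℤ
coeff zero    f []      = f
coeff (suc N) f (a ∷ α) = coeff N (f a) α

coeff-cong : ∀ N {f g} → P._≈_ N f g → ∀ α → coeff N f α ≡ coeff N g α
coeff-cong zero    f≈g []      = f≈g
coeff-cong (suc N) f≈g (a ∷ α) = coeff-cong N (f≈g a) α

coeff-+ : ∀ N f g α → coeff N (P._+_ N f g) α ≡ coeff N f α ℤ.+ coeff N g α
coeff-+ zero    f g []      = ≡.refl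
coeff-+ (suc N) f g (a ∷ α) = coeff-+ N (f a) (g a) α

coeff-0 : ∀ N α → coeff N (P.0# N) α ≡ 0ℤ
coeff-0 zero    []      = ≡.refl
coeff-0 (suc N) (a ∷ α) = coeff-0 N α

coeff-1 : ∀ N α → coeff N (P.1# N) α ≡ χ (α ≟ᵛ replicate N 0)
coeff-1 zero    []          = ≡.refl
coeff-1 (suc N) (zero ∷ α)  = ≡.trans (coeff-1 N α)
  (χ-⇔ (α ≟ᵛ replicate N 0) (0 ∷ α ≟ᵛ replicate (suc N) 0) (cong (0 ∷_)) Vec.∷-injectiveʳ)
coeff-1 (suc N) (suc a ∷ α) = ≡.trans (coeff-0 N α)
  (≡.sym (χ-no (suc a ∷ α ≟ᵛ replicate (suc N) 0) λ ()))

coeff-∑-applyUpTo : ∀ N n f (h : ℕ → ℕ) α →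
  coeff N (Sums.∑ (Poly N) n (f ∘ h)) α ≡ sumOver (applyUpTo h n) (λ i → coeff N (f i) α)
coeff-∑-applyUpTo N zero    f h α = coeff-0 N α
coeff-∑-applyUpTo N (suc n) f h α = ≡.trans (coeff-+ N _ _ α)
  (cong (ℤ._+_ (coeff N (f (h 0)) α)) (coeff-∑-applyUpTo N n f (h ∘ suc) α))

coeff-∑ : ∀ N n f α → coeff N (Sums.∑ (Poly N) n f) α ≡ sumOver (upTo n) (λ i → coeff N (f i) α)
coeff-∑ N n f = coeff-∑-applyUpTo N n f id

coeff-* : ∀ N f g α → coeff N (P._*_ N f g) α ≡
  sumOver (divisors α) (λ β → coeff N f β ℤ.* coeff N g (zipWith _∸_ α β))
coeff-* zero    f g []      = ≡.sym (ℤ.+-identityʳ _)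
coeff-* (suc N) f g (a ∷ α) = ≡.trans (coeff-∑ N (suc a) _ α) (≡.trans
  (sumOver-cong (upTo (suc a)) (λ i → coeff-* N (f i) (g (a ∸ i)) α))
  (≡.sym (sumOver-cartesianProductWith _∷_ (upTo (suc a)) (divisors α)
    (λ β → coeff (suc N) f β ℤ.* coeff (suc N) g (zipWith _∸_ (a ∷ α) β)))))

-- Variables and monomials

var : ∀ N → ℕ → P.Carrier N
var zero    i       = P.0# zero
var (suc N) zero    = λ { zero → P.0# N ; (suc n) → Series.const (Poly N) (P.1# N) n }
var (suc N) (suc i) = Series.const (Poly N) (var N i)

-- The coefficient in xᵢ f of the monomial with exponents α is read off
-- the coefficients k of f.
lower : ∀ {N} → ℕ → Vec ℕ N → (Vec ℕ N → ℤ) → ℤ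
lower i       []          k = 0ℤ
lower zero    (zero ∷ α)  k = 0ℤ
lower zero    (suc a ∷ α) k = k (a ∷ α)
lower (suc i) (a ∷ α)     k = lower i α (λ β → k (a ∷ β))

lower-cong : ∀ {N} i (α : Vec ℕ N) {k k′} → (∀ β → k β ≡ k′ β) → lower i α k ≡ lower i α k′
lower-cong i       []          eq = ≡.refl
lower-cong zero    (zero ∷ α)  eq = ≡.refl
lower-cong zero    (suc a ∷ α) eq = eq _
lower-cong (suc i) (a ∷ α)     eq = lower-cong i α (λ β → eq (a ∷ β))

lower-0 : ∀ {N} i (α : Vec ℕ N) → lower i α (λ _ → 0ℤ) ≡ 0ℤ
lower-0 i       []          = ≡.refl
lower-0 zero    (zero ∷ α)  = ≡.refl
lower-0 zero    (suc a ∷ α) = ≡.refl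
lower-0 (suc i) (a ∷ α)     = lower-0 i α

coeff-var* : ∀ N i f α → coeff N (P._*_ N (var N i) f) α ≡ lower i α (coeff N f)
coeff-var* zero    i       f []          = ≡.refl
coeff-var* (suc N) zero    f (zero ∷ α)  = ≡.trans
  (coeff-cong N (P.trans N (P.+-congʳ N (P.zeroˡ N _)) (P.+-identityʳ N _)) α) (coeff-0 N α)
coeff-var* (suc N) zero    f (suc a ∷ α) = coeff-cong N
  (P.trans N (P.+-cong N (P.zeroˡ N (f (suc a))) (P.*-identityˡ (suc N) f a)) (P.+-identityˡ N _)) α
coeff-var* (suc N) (suc i) f (a ∷ α)     = ≡.trans
  (coeff-cong N (Series.⊛-const (Poly N) (var N i) f a) α) (coeff-var* N i (f a) α)

incr : ∀ {N} → ℕ → Vec ℕ N → Vec ℕ N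
incr i       []      = []
incr zero    (a ∷ v) = suc a ∷ v
incr (suc i) (a ∷ v) = a ∷ incr i v

χ-incr : ∀ {N} i (v α : Vec ℕ N) → i < N → χ (incr i v ≟ᵛ α) ≡ lower i α (λ β → χ (v ≟ᵛ β))
χ-incr zero    (b ∷ v) (zero ∷ α)  _ = χ-no (suc b ∷ v ≟ᵛ zero ∷ α) λ ()
χ-incr zero    (b ∷ v) (suc a ∷ α) _ =
  χ-⇔ (suc b ∷ v ≟ᵛ suc a ∷ α) (b ∷ v ≟ᵛ a ∷ α) (λ { ≡.refl → ≡.refl }) (λ { ≡.refl → ≡.refl })
χ-incr (suc i) (b ∷ v) (a ∷ α) (s≤s i<N) with b ℕ.≟ a
... | yes ≡.refl = ≡.trans
  (χ-⇔ (b ∷ incr i v ≟ᵛ b ∷ α) (incr i v ≟ᵛ α) Vec.∷-injectiveʳ (cong (b ∷_)))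
  (≡.trans (χ-incr i v α i<N)
    (lower-cong i α λ β → χ-⇔ (v ≟ᵛ β) (b ∷ v ≟ᵛ b ∷ β) (cong (b ∷_)) Vec.∷-injectiveʳ))
... | no b≢a = ≡.trans
  (χ-no (b ∷ incr i v ≟ᵛ a ∷ α) (b≢a ∘ Vec.∷-injectiveˡ))
  (≡.sym (≡.trans
    (lower-cong i α λ β → χ-no (b ∷ v ≟ᵛ a ∷ β) (b≢a ∘ Vec.∷-injectiveˡ))
    (lower-0 i α)))

tabulate-incr : ∀ N i (φ ψ : ℕ → ℕ) → ψ i ≡ suc (φ i) → (∀ j → j ≢ i → ψ j ≡ φ j) →
                tabulate {n = N} (ψ ∘ toℕ) ≡ incr i (tabulate (φ ∘ toℕ))
tabulate-incr zero    i       φ ψ eq ne = ≡.refl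
tabulate-incr (suc N) zero    φ ψ eq ne =
  cong₂ _∷_ eq (Vec.tabulate-cong (λ j → ne (suc (toℕ j)) λ ()))
tabulate-incr (suc N) (suc i) φ ψ eq ne = cong₂ _∷_ (ne 0 λ ())
  (tabulate-incr N i (φ ∘ suc) (ψ ∘ suc) eq (λ j j≢i → ne (suc j) (j≢i ∘ ℕ.suc-injective)))

exponents-∷ : ∀ N i {k} (w : Vec ℕ k) → exponents N (i ∷ w) ≡ incr i (exponents N w)
exponents-∷ N i w = tabulate-incr N i _ _ eq ne
  where
  eq : count (i ℕ.≟_) (i ∷ w) ≡ suc (count (i ℕ.≟_) w)
  eq = cong (λ b → (if b then suc else id) (count (i ℕ.≟_) w)) (dec-true (i ℕ.≟ i) ≡.refl)
  ne : ∀ j → j ≢ i → count (j ℕ.≟_) (i ∷ w) ≡ count (j ℕ.≟_) w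
  ne j j≢i = cong (λ b → (if b then suc else id) (count (j ℕ.≟_) w)) (dec-false (j ℕ.≟ i) j≢i)

module PolyWords (N : ℕ) = Words (Poly N) N (var N)

-- A letter i ≥ N would be ignored by `exponents`, whereas `var` N i is zero; the bound on the
-- letters makes the two sides agree.
coeff-mono : ∀ N {k} (w : Vec ℕ k) α → ListAll (_< N) (toList w) →
             coeff N (PolyWords.mono N (toList w)) α ≡ χ (exponents N w ≟ᵛ α)
coeff-mono N []      α []         = ≡.trans (coeff-1 N α)
  (χ-⇔ (α ≟ᵛ replicate N 0) (exponents N [] ≟ᵛ α)
    (λ eq → ≡.trans (tabulate-0 N) (≡.sym eq)) (λ eq → ≡.trans (≡.sym eq) (tabulate-0 N)))
  where
  tabulate-0 : ∀ n → tabulate {n = n} (λ _ → 0) ≡ replicate n 0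
  tabulate-0 zero    = ≡.refl
  tabulate-0 (suc n) = cong (0 ∷_) (tabulate-0 n)
coeff-mono N (i ∷ w) α (i<N ∷ w<N) = begin
  coeff N (P._*_ N (var N i) (PolyWords.mono N (toList w))) α  ≡⟨ coeff-var* N i _ α ⟩
  lower i α (coeff N (PolyWords.mono N (toList w)))
    ≡⟨ lower-cong i α (λ β → coeff-mono N w β w<N) ⟩
  lower i α (λ β → χ (exponents N w ≟ᵛ β))        ≡⟨ χ-incr i (exponents N w) α i<N ⟨
  χ (incr i (exponents N w) ≟ᵛ α)
    ≡⟨ cong (λ v → χ (v ≟ᵛ α)) (exponents-∷ N i w) ⟨
  χ (exponents N (i ∷ w) ≟ᵛ α)                    ∎
  where open ≡.≡-Reasoning

sumOver-applyUpTo-cong : ∀ (h : ℕ → ℕ) n {f g : ℕ → ℤ} → (∀ i → i < n → f (h i) ≡ g (h i)) →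
                         sumOver (applyUpTo h n) f ≡ sumOver (applyUpTo h n) g
sumOver-applyUpTo-cong h zero    eq = ≡.refl
sumOver-applyUpTo-cong h (suc n) {f} {g} eq = cong₂ ℤ._+_ (eq 0 (s≤s z≤n))
  (sumOver-applyUpTo-cong (h ∘ suc) n {f} {g} (λ i i<n → eq (suc i) (s≤s i<n)))

coeff-W : ∀ N k h (g : Vec ℕ k → ℤ) α →
  (∀ w → ListAll (_< N) (toList w) → coeff N (h (toList w)) α ≡ g w) →
  coeff N (PolyWords.W N k h) α ≡ sumOver (words (upTo N) k) g
coeff-W N zero    h g α eq = ≡.trans (eq [] []) (≡.sym (ℤ.+-identityʳ _))
coeff-W N (suc k) h g α eq = ≡.trans (coeff-∑ N N _ α) (≡.trans
  (sumOver-applyUpTo-cong id N (λ c c<N →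
    coeff-W N k (h ∘ (c ∷_)) (g ∘ (c ∷_)) α (λ w w<N → eq (c ∷ w) (c<N ∷ w<N))))
  (≡.sym (sumOver-cartesianProductWith _∷_ (upTo N) (words (upTo N) k) g)))

-- The bridge from counted words to the rings `Poly` N: the number of words with exponents α is a
-- coefficient of their generating function. It also passes from predicates on vectors to predicates
-- on lists.
sumOfMonomials-W : ∀ {k} {P : Vec ℕ k → Set} (P? : Unary.Decidable P)
  {Q : List ℕ → Set} (Q? : Unary.Decidable Q) →
  (∀ w → P w → Q (toList w)) → (∀ w → Q (toList w) → P w) → ∀ N α →
  sumOfMonomials P? N α ≡
  coeff N (PolyWords.W N k (λ w → P._*_ N (Sums.ind (Poly N) (Q? w)) (PolyWords.mono N w))) α
sumOfMonomials-W {k} P? Q? P⇒Q Q⇒P N α = ≡.trans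
  (length-filter (λ w → P? w ×-dec (exponents N w ≟ᵛ α)) (words (upTo N) k))
  (≡.sym (coeff-W N k _ _ α term))
  where
  term : ∀ w → ListAll (_< N) (toList w) →
    coeff N (P._*_ N (Sums.ind (Poly N) (Q? (toList w))) (PolyWords.mono N (toList w))) α ≡
    χ (P? w ×-dec (exponents N w ≟ᵛ α))
  term w w<N with Q? (toList w)
  ... | yes q = ≡.trans (coeff-cong N (P.*-identityˡ N _) α) (≡.trans (coeff-mono N w α w<N)
    (χ-⇔ (exponents N w ≟ᵛ α) (P? w ×-dec (exponents N w ≟ᵛ α)) (Q⇒P w q ,_) proj₂))
  ... | no ¬q = ≡.trans (coeff-cong N (P.zeroˡ N _) α) (≡.trans (coeff-0 N α)
    (≡.sym (χ-no (P? w ×-dec (exponents N w ≟ᵛ α)) (λ (p , _) → ¬q (P⇒Q w p)))))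

coeff-e : ∀ k N α → Defs.e k N α ≡ coeff N (PolyWords.e N k) α
coeff-e k N α = ≡.trans
  (sumOfMonomials-W {k} (VecLinked.linked? ℕ._<?_) (PolyWords.from? N 0) linked⇒from from⇒linked N α)
  (coeff-cong N (PolyWords.W-from N 0 k) α)
  where
  linked⇒from : ∀ {k} (w : Vec ℕ k) → VecLinked.Linked _<_ w → PolyWords.From N 0 (toList w)
  linked⇒from []      _ = tt
  linked⇒from (b ∷ w) l = z≤n , tail b w l
    where
    tail : ∀ {k} b (w : Vec ℕ k) → VecLinked.Linked _<_ (b ∷ w) → PolyWords.From N (suc b) (toList w)
    tail b []      _                      = tt
    tail b (c ∷ w) (b<c VecLinked.∷ l) = b<c , tail c w l
  from⇒linked : ∀ {k} (w : Vec ℕ k) → PolyWords.From N 0 (toList w) → VecLinked.Linked _<_ w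
  from⇒linked []      _       = VecLinked.[]
  from⇒linked (b ∷ w) (_ , f) = tail b w f
    where
    tail : ∀ {k} b (w : Vec ℕ k) → PolyWords.From N (suc b) (toList w) → VecLinked.Linked _<_ (b ∷ w)
    tail b []      _         = VecLinked.[-]
    tail b (c ∷ w) (b<c , f) = b<c VecLinked.∷ tail c w f

eMono : ∀ N → List ℕ → P.Carrier N
eMono N = foldr (λ k f → P._*_ N (PolyWords.e N k) f) (P.1# N)

coeff-e[] : ∀ μ N α → e[ μ ] N α ≡ coeff N (eMono N μ) α
coeff-e[] []      N α = ≡.sym (coeff-1 N α)
coeff-e[] (k ∷ μ) N α = ≡.trans
  (sumOver-cong (divisors α) (λ β → cong₂ ℤ._*_ (coeff-e k N β) (coeff-e[] μ N _)))
  (≡.sym (coeff-* N _ _ α))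

-- Colourings as lists

-- With lists in place of vectors, a colouring of `G ⊕ H` can be cut at the shared vertex without
-- transport along equations between orders; 0 is a mere default beyond the end.
nth : List ℕ → ℕ → ℕ
nth []      i       = 0
nth (b ∷ l) zero    = b
nth (b ∷ l) (suc i) = nth l i

nth-lookup : ∀ {n} (w : Vec ℕ n) i → lookup w i ≡ nth (toList w) (toℕ i)
nth-lookup (b ∷ w) Fin.zero    = ≡.refl
nth-lookup (b ∷ w) (Fin.suc i) = nth-lookup w i

nth-++ʳ : ∀ u v j → nth (u ++ v) (j ℕ.+ length u) ≡ nth v j
nth-++ʳ []      v j = cong (nth v) (ℕ.+-identityʳ j)
nth-++ʳ (b ∷ u) v j = ≡.trans (cong (nth (b ∷ u ++ v)) (ℕ.+-suc j (length u))) (nth-++ʳ u v j)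

nth-∷ʳ : ∀ u c v i → i ≤ length u → nth (u ++ c ∷ v) i ≡ nth (u ++ c ∷ []) i
nth-∷ʳ []      c v zero    _         = ≡.refl
nth-∷ʳ (b ∷ u) c v zero    _         = ≡.refl
nth-∷ʳ (b ∷ u) c v (suc i) (s≤s i≤u) = nth-∷ʳ u c v i i≤u

ProperList : Graph → List ℕ → Set
ProperList G l = ∀ u v → Graph.Adj G u v → nth l (toℕ u) ≢ nth l (toℕ v)

properList? : ∀ G l → Dec (ProperList G l)
properList? G l = Fin.all? λ u → Fin.all? λ v →
  Graph.adj? G u v →-dec (nth l (toℕ u) ≢? nth l (toℕ v))

proper⇒properList : ∀ G w → Proper G w → ProperList G (toList w)
proper⇒properList G w p u v uv eq =
  p u v uv (≡.trans (nth-lookup w u) (≡.trans eq (≡.sym (nth-lookup w v))))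

properList⇒proper : ∀ G w → ProperList G (toList w) → Proper G w
properList⇒proper G w p u v uv eq =
  p u v uv (≡.trans (≡.sym (nth-lookup w u)) (≡.trans eq (nth-lookup w v)))

module _ (G H : Graph) {a b} (G≡ : order G ≡ suc a) (H≡ : order H ≡ suc b)
         (l : List ℕ) (c : ℕ) (v : List ℕ) (l≡ : length l ≡ a) where
  private
    n s : ℕ
    n = order (G ⊕ H)
    s = order G ∸ 1

    s≡ : s ≡ length l
    s≡ = ≡.trans (cong (_∸ 1) G≡) (≡.sym l≡)

    n≡ : n ≡ a ℕ.+ order H
    n≡ = cong (λ o → o ℕ.+ order H ∸ 1) G≡

    left : (i : Fin (order G)) → Fin n
    left i = fromℕ< {toℕ i} (ℕ.≤-trans (Fin.toℕ<n i) (≡.subst₂ _≤_ (≡.sym G≡)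
      (≡.sym (≡.trans n≡ (≡.trans (cong (a ℕ.+_) H≡) (ℕ.+-suc a b)))) (s≤s (ℕ.m≤m+n a b))))

    toℕ-left : ∀ i → toℕ (left i) ≡ toℕ i ℕ.+ 0
    toℕ-left i = ≡.trans (Fin.toℕ-fromℕ< _) (≡.sym (ℕ.+-identityʳ _))

    right : (i : Fin (order H)) → Fin n
    right i = fromℕ< {toℕ i ℕ.+ s} (≡.subst₂ _<_ (cong (toℕ i ℕ.+_) (≡.sym (≡.trans s≡ l≡)))
      (≡.sym (≡.trans n≡ (ℕ.+-comm a _))) (ℕ.+-monoˡ-< a (Fin.toℕ<n i)))

    toℕ-right : ∀ i → toℕ (right i) ≡ toℕ i ℕ.+ s
    toℕ-right i = Fin.toℕ-fromℕ< _

    nth-left : ∀ (i : Fin (order G)) {j} → j ≡ toℕ i ℕ.+ 0 →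
               nth (l ++ c ∷ v) j ≡ nth (l ++ c ∷ []) (toℕ i)
    nth-left i ≡.refl = ≡.trans (cong (nth (l ++ c ∷ v)) (ℕ.+-identityʳ (toℕ i)))
      (nth-∷ʳ l c v (toℕ i)
        (ℕ.s≤s⁻¹ (≡.subst (toℕ i <_) (≡.trans G≡ (cong suc (≡.sym l≡))) (Fin.toℕ<n i))))

    nth-right : ∀ (i : Fin (order H)) {j} → j ≡ toℕ i ℕ.+ s →
                nth (l ++ c ∷ v) j ≡ nth (c ∷ v) (toℕ i)
    nth-right i ≡.refl = ≡.trans (cong (λ t → nth (l ++ c ∷ v) (toℕ i ℕ.+ t)) s≡)
      (nth-++ʳ l (c ∷ v) (toℕ i))

  -- The letter c colours the identified vertex: it ends the colouring of G and begins that of H,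
  -- and each edge of `G ⊕ H` comes from one of the two graphs.
  ⊕-proper⇒ : ProperList (G ⊕ H) (l ++ c ∷ v) → ProperList G (l ++ c ∷ []) × ProperList H (c ∷ v)
  ⊕-proper⇒ p =
    (λ i j ij eq → p (left i) (left j) (inj₁ (i , j , ij , toℕ-left i , toℕ-left j))
      (≡.trans (nth-left i (toℕ-left i)) (≡.trans eq (≡.sym (nth-left j (toℕ-left j)))))) ,
    (λ i j ij eq → p (right i) (right j) (inj₂ (i , j , ij , toℕ-right i , toℕ-right j))
      (≡.trans (nth-right i (toℕ-right i)) (≡.trans eq (≡.sym (nth-right j (toℕ-right j))))))

  ⊕-proper⇐ : ProperList G (l ++ c ∷ []) → ProperList H (c ∷ v) → ProperList (G ⊕ H) (l ++ c ∷ v)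
  ⊕-proper⇐ pG pH u w (inj₁ (i , j , ij , u≡ , w≡)) eq =
    pG i j ij (≡.trans (≡.sym (nth-left i u≡)) (≡.trans eq (nth-left j w≡)))
  ⊕-proper⇐ pG pH u w (inj₂ (i , j , ij , u≡ , w≡)) eq =
    pH i j ij (≡.trans (≡.sym (nth-right i u≡)) (≡.trans eq (nth-right j w≡)))

nth-All : ∀ {b l} → ListAll (b ≢_) l → ∀ j → j < length l → b ≢ nth l j
nth-All (p ∷ ps) zero    _        = p
nth-All (p ∷ ps) (suc j) (s≤s j<) = nth-All ps j j<

nth-distinct : ∀ {l} → AllPairs _≢_ l → ∀ i j → i < length l → j < length l → i ≢ j →
               nth l i ≢ nth l j
nth-distinct (p ∷ ps) zero    zero    _ _ i≢j = contradiction ≡.refl i≢j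
nth-distinct (p ∷ ps) zero    (suc j) _ (s≤s j<) _ = nth-All p j j<
nth-distinct (p ∷ ps) (suc i) zero    (s≤s i<) _ _ = nth-All p i i< ∘ ≡.sym
nth-distinct (p ∷ ps) (suc i) (suc j) (s≤s i<) (s≤s j<) i≢j =
  nth-distinct ps i j i< j< (i≢j ∘ cong suc)

distinct-nth : ∀ l → (∀ i j → i < length l → j < length l → i ≢ j → nth l i ≢ nth l j) →
               AllPairs _≢_ l
distinct-nth []      p = []
distinct-nth (b ∷ l) p =
  all l (λ j j< → p 0 (suc j) (s≤s z≤n) (s≤s j<) λ ()) ∷
  distinct-nth l (λ i j i< j< i≢j → p (suc i) (suc j) (s≤s i<) (s≤s j<) (i≢j ∘ ℕ.suc-injective))
  where
  all : ∀ l → (∀ j → j < length l → b ≢ nth l j) → ListAll (b ≢_) l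
  all []      q = []
  all (c ∷ l) q = q 0 (s≤s z≤n) ∷ all l (λ j j< → q (suc j) (s≤s j<))

proper-K⇒ : ∀ n l → length l ≡ n → ProperList (K n) l → AllPairs _≢_ l
proper-K⇒ n l ≡.refl p = distinct-nth l λ i j i< j< i≢j →
  ≡.subst₂ (λ i′ j′ → nth l i′ ≢ nth l j′) (Fin.toℕ-fromℕ< i<) (Fin.toℕ-fromℕ< j<)
    (p (fromℕ< i<) (fromℕ< j<) λ eq → i≢j (Fin.fromℕ<-injective _ _ i< j< eq))

proper-K⇐ : ∀ n l → length l ≡ n → AllPairs _≢_ l → ProperList (K n) l
proper-K⇐ n l ≡.refl p i j i≢j =
  nth-distinct p (toℕ i) (toℕ j) (Fin.toℕ<n i) (Fin.toℕ<n j) (i≢j ∘ Fin.toℕ-injective)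

linked-nth : ∀ l → (∀ i → suc i < length l → nth l i ≢ nth l (suc i)) → Linked _≢_ l
linked-nth []          p = []
linked-nth (b ∷ [])    p = [-]
linked-nth (b ∷ c ∷ l) p =
  p 0 (s≤s (s≤s z≤n)) ∷ linked-nth (c ∷ l) (λ i i< → p (suc i) (s≤s i<))

nth-linked : ∀ {l} → Linked _≢_ l → ∀ i → suc i < length l → nth l i ≢ nth l (suc i)
nth-linked [-]     i       (s≤s ())
nth-linked (p ∷ q) zero    _        = p
nth-linked (p ∷ q) (suc i) (s≤s i<) = nth-linked q i i<

module _ (a : ℕ) (2≤a : 2 ≤ suc (suc a)) (d : ℕ) (u : List ℕ) (c : ℕ) (u≡ : length u ≡ a) where
  private
    l : List ℕ
    l = d ∷ u ++ c ∷ []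

    l≡ : length l ≡ suc (suc a)
    l≡ = cong suc (≡.trans (List.length-++ u) (≡.trans (ℕ.+-comm _ 1) (cong suc u≡)))

    last : nth l (suc a) ≡ c
    last = ≡.trans (cong (nth (u ++ c ∷ [])) (≡.sym u≡)) (nth-++ʳ u (c ∷ []) 0)

    Edges : Set
    Edges = d ≢ c × Linked _≢_ l

  -- The closing edge joins the last vertex to the first and gives d ≢ c; all other edges join
  -- neighbours in the list. For a = 0 both describe the single edge.
  proper-C⇒ : ProperList (C (suc (suc a)) 2≤a) l → Edges
  proper-C⇒ p = (λ d≡c → p (Fin.fromℕ (suc a)) Fin.zero (inj₁ (inj₂ (cong suc (Fin.toℕ-fromℕ (suc a)) , ≡.refl)))
      (≡.trans (≡.trans (cong (nth l) (Fin.toℕ-fromℕ (suc a))) last) (≡.sym d≡c))) ,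
    linked-nth l λ i i< →
      let 1+i< = ≡.subst (suc i <_) l≡ i<
          i<′  = ℕ.<-trans (ℕ.n<1+n i) 1+i<
      in ≡.subst₂ (λ i′ j′ → nth l i′ ≢ nth l j′) (Fin.toℕ-fromℕ< i<′) (Fin.toℕ-fromℕ< 1+i<)
           (p (fromℕ< i<′) (fromℕ< 1+i<)
             (inj₁ (inj₁ (≡.trans (Fin.toℕ-fromℕ< 1+i<) (cong suc (≡.sym (Fin.toℕ-fromℕ< i<′)))))))

  proper-C⇐ : Edges → ProperList (C (suc (suc a)) 2≤a) l
  proper-C⇐ (d≢c , link) = λ where
      v w (inj₁ vw) → next v w vw
      v w (inj₂ wv) → next w v wv ∘ ≡.sym
    where
    next : ∀ v w → Next (suc (suc a)) v w → nth l (toℕ v) ≢ nth l (toℕ w)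
    next v w (inj₁ w≡1+v) = ≡.subst (λ j → nth l (toℕ v) ≢ nth l j) (≡.sym w≡1+v)
      (nth-linked link (toℕ v) (≡.subst₂ _<_ w≡1+v (≡.sym l≡) (Fin.toℕ<n w)))
    next v w (inj₂ (1+v≡ , w≡0)) eq = d≢c (≡.trans (≡.sym (≡.trans eq (cong (nth l) w≡0)))
      (≡.trans (cong (nth l) (ℕ.suc-injective 1+v≡)) last))

-- Rooted chromatic series and gluing

module RootedSums (R : CommutativeRing 0ℓ 0ℓ) (N : ℕ) (x : ℕ → CommutativeRing.Carrier R) where
  open CommutativeRing R
  open Words R N x public
  open SetoidReasoning setoid

  weight : Graph → List ℕ → Carrier
  weight G l = ind (properList? G l) * mono l

  -- The part of the chromatic symmetric function due to the colourings
  -- which give the first vertex the colour d.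
  rooted : Graph → ℕ → Carrier
  rooted G d = W (order G ∸ 1) (λ w → weight G (d ∷ w))

  -- For a graph on a + 2 vertices with prescribed colours d and c of the
  -- first and the last vertex; the last vertex does not count.
  kernel : Graph → ℕ → ℕ → ℕ → Carrier
  kernel G a d c = W a (λ u → ind (properList? G (d ∷ u ++ c ∷ [])) * mono (d ∷ u))

  -- The shared vertex is the root of H. Once its colour c is fixed, the rest of G and the rest of H
  -- are coloured independently, and x c is counted on the side of H only.
  rooted-⊕ : ∀ G H {a b} → order G ≡ suc (suc a) → order H ≡ suc b → ∀ d →
             rooted (G ⊕ H) d ≈ ∑ N (λ c → kernel G a d c * rooted H c)
  rooted-⊕ G H {a} {b} G≡ H≡ d = begin
    W (order (G ⊕ H) ∸ 1) (λ w → weight (G ⊕ H) (d ∷ w))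
      ≡⟨ cong (λ k → W k (λ w → weight (G ⊕ H) (d ∷ w)))
           (cong₂ (λ g h → g ℕ.+ h ∸ 1 ∸ 1) G≡ H≡) ⟩
    W (a ℕ.+ suc b) (λ w → weight (G ⊕ H) (d ∷ w))
      ≈⟨ W-++ a (suc b) _ ⟩
    W a (λ u → ∑ N (λ c → W b (λ v → weight (G ⊕ H) (d ∷ u ++ c ∷ v))))
      ≈⟨ W-cong a (λ u u≡ → ∑-cong N (λ c → W-cong b (λ v _ → split u u≡ c v))) ⟩
    W a (λ u → ∑ N (λ c → W b (λ v → k u c * weight H (c ∷ v))))
      ≈⟨ W-cong a (λ u _ → ∑-cong N (λ c → W-*ˡ b _ _)) ⟩
    W a (λ u → ∑ N (λ c → k u c * W b (λ v → weight H (c ∷ v))))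
      ≈⟨ W-∑ a _ ⟩
    ∑ N (λ c → W a (λ u → k u c * W b (λ v → weight H (c ∷ v))))
      ≈⟨ ∑-cong N (λ c → W-*ʳ a _ _) ⟩
    ∑ N (λ c → kernel G a d c * W b (λ v → weight H (c ∷ v)))
      ≡⟨ cong (λ k → ∑ N (λ c → kernel G a d c * W k (λ v → weight H (c ∷ v)))) (cong (_∸ 1) H≡) ⟨
    ∑ N (λ c → kernel G a d c * rooted H c)   ∎
    where
    k : List ℕ → ℕ → Carrier
    k u c = ind (properList? G (d ∷ u ++ c ∷ [])) * mono (d ∷ u)
    split : ∀ u → length u ≡ a → ∀ c v →
            weight (G ⊕ H) (d ∷ u ++ c ∷ v) ≈ k u c * weight H (c ∷ v)
    split u u≡ c v = trans
      (*-cong (ind-× (properList? (G ⊕ H) (d ∷ u ++ c ∷ v)) (properList? G (d ∷ u ++ c ∷ []))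
                 (properList? H (c ∷ v))
                 (⊕-proper⇒ G H G≡ H≡ (d ∷ u) c v (cong suc u≡))
                 (⊕-proper⇐ G H G≡ H≡ (d ∷ u) c v (cong suc u≡)))
              (mono-++ (d ∷ u) (c ∷ v)))
      (solve 4 (λ p q m n → (p :* q) :* (m :* n) := (p :* m) :* (q :* n)) refl _ _ _ _)

  private
    proper-K₁ : ∀ l → ProperList (K 1) l
    proper-K₁ l Fin.zero Fin.zero 0≢0 = contradiction ≡.refl 0≢0

  -- A single vertex is first and last at once, so it has no `kernel`; gluing it adds neither a
  -- vertex nor an edge.
  rooted-K₁⊕ : ∀ H {b} → order H ≡ suc b → ∀ d → rooted (K 1 ⊕ H) d ≈ rooted H d
  rooted-K₁⊕ H H≡ d = W-cong (order H ∸ 1) (λ w _ → *-congʳ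
    (ind-⇔ (properList? (K 1 ⊕ H) (d ∷ w)) (properList? H (d ∷ w))
      (λ p → proj₂ (⊕-proper⇒ (K 1) H ≡.refl H≡ [] d w ≡.refl p))
      (⊕-proper⇐ (K 1) H ≡.refl H≡ [] d w ≡.refl (proper-K₁ (d ∷ [])))))

  rooted-K₁ : ∀ d → rooted (K 1) d ≈ x d
  rooted-K₁ d = trans (*-cong (ind-yes (properList? (K 1) (d ∷ [])) (proper-K₁ (d ∷ []))) (*-identityʳ _))
                  (*-identityˡ _)

  -- A lone piece behaves like that piece glued to a single vertex, whose rooted series is x c. The
  -- final piece of a chain thus falls under the same operator as the others.
  rooted-kernel : ∀ G {a} → order G ≡ suc (suc a) → ∀ d →
                  rooted G d ≈ ∑ N (λ c → kernel G a d c * x c)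
  rooted-kernel G {a} G≡ d = begin
    W (order G ∸ 1) (λ w → weight G (d ∷ w))
      ≡⟨ cong (λ k → W k (λ w → weight G (d ∷ w)))
           (≡.trans (cong (_∸ 1) G≡) (ℕ.+-comm 1 a)) ⟩
    W (a ℕ.+ 1) (λ w → weight G (d ∷ w))
      ≈⟨ W-++ a 1 _ ⟩
    W a (λ u → ∑ N (λ c → weight G (d ∷ u ++ c ∷ [])))
      ≈⟨ W-∑ a _ ⟩
    ∑ N (λ c → W a (λ u → weight G (d ∷ u ++ c ∷ [])))
      ≈⟨ ∑-cong N (λ c → trans (W-cong a (λ u _ → trans
           (*-congˡ (trans (mono-++ (d ∷ u) (c ∷ [])) (*-congˡ (*-identityʳ _))))
           (sym (*-assoc _ _ _)))) (W-*ʳ a _ _)) ⟩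
    ∑ N (λ c → kernel G a d c * x c)   ∎

  -- The a inner vertices receive distinct colours other than d and c, and each set of colours can
  -- be distributed in a! ways.
  kernel-K : ∀ a {d} (d<N : d < N) {c} → c < N →
             kernel (K (suc (suc a))) a d c ≈ nat (a !) * (A d c * Clique.v d<N (suc a) c)
  kernel-K a {d} d<N {c} c<N = begin
    W a (λ u → ind (properList? (K (suc (suc a))) (d ∷ u ++ c ∷ [])) * (x d * mono u))
      ≈⟨ W-cong a term ⟩
    W a (λ u → (A d c * x d) * ((prod av u * distinct u) * mono u))
      ≈⟨ W-*ˡ a _ _ ⟩
    (A d c * x d) * W a (λ u → (prod av u * distinct u) * mono u)
      ≈⟨ *-congˡ (W-distinct a av) ⟩
    (A d c * x d) * injections a av
      ≈⟨ adjacent ⟩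
    nat (a !) * (A d c * Clique.v d<N (suc a) c)   ∎
    where
    av : ℕ → Carrier
    av z = A c z * (A d z * 1#)
    term : ∀ u → length u ≡ a →
      ind (properList? (K (suc (suc a))) (d ∷ u ++ c ∷ [])) * (x d * mono u) ≈
      (A d c * x d) * ((prod av u * distinct u) * mono u)
    term u u≡ = begin
      ind (properList? (K (suc (suc a))) l) * (x d * mono u)
        ≈⟨ *-congʳ (trans (ind-⇔ (properList? (K (suc (suc a))) l) (allPairs? _≢?_ l)
             (proper-K⇒ _ l l≡) (proper-K⇐ _ l l≡)) (ind-distinct l)) ⟩
      distinct l * (x d * mono u)
        ≈⟨ *-congʳ (distinct-∷ʳ (d ∷ u) c) ⟩
      ((prod (A d) u * distinct u) * (A c d * prod (A c) u)) * (x d * mono u)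
        ≈⟨ *-congʳ (*-congˡ (*-congʳ (A-sym c d))) ⟩
      ((prod (A d) u * distinct u) * (A d c * prod (A c) u)) * (x d * mono u)
        ≈⟨ solve 6 (λ p q a r y m → ((p :* q) :* (a :* r)) :* (y :* m) :=
             (a :* y) :* (((r :* p) :* q) :* m)) refl _ _ _ _ _ _ ⟩
      (A d c * x d) * (((prod (A c) u * prod (A d) u) * distinct u) * mono u)
        ≈⟨ *-congˡ (*-congʳ (*-congʳ (prod-* (A c) (A d) u))) ⟨
      (A d c * x d) * ((prod (λ z → A c z * A d z) u * distinct u) * mono u)
        ≈⟨ *-congˡ (*-congʳ (*-congʳ (prod-cong u (λ z → *-congˡ (sym (*-identityʳ _)))))) ⟩
      (A d c * x d) * ((prod av u * distinct u) * mono u)   ∎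
      where
      l : List ℕ
      l = d ∷ u ++ c ∷ []
      l≡ : length l ≡ suc (suc a)
      l≡ = cong suc (≡.trans (List.length-++ u) (≡.trans (ℕ.+-comm _ 1) (cong suc u≡)))
    adjacent : (A d c * x d) * injections a av ≈ nat (a !) * (A d c * Clique.v d<N (suc a) c)
    -- If d = c the factor `A` d c annihilates both sides. Otherwise d and c can be deleted from the
    -- letters one after the other.
    adjacent with d ℕ.≟ c
    ... | yes _ = solve 5 (λ o y i n w → ((o :- o) :* y) :* i := n :* ((o :- o) :* w))
                    refl _ _ _ _ _
    ... | no d≢c = trans (*-congˡ (injections≈ a nw))
                     (solve 4 (λ p y n f → (p :* y) :* (n :* f) := n :* (p :* (y :* f)))
                       refl _ _ _ _)
      where
      nw : Newton av (del (del e (x d)) (x c))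
      nw = Newton-del (Newton-del e-Newton d<N refl) c<N
        (trans (*-identityʳ _) (trans (+-congˡ (-‿cong (ind-no (d ℕ.≟ c) d≢c)))
          (solve 1 (λ o → o :- con 0ℤ := o) refl _)))

  kernel-C : ∀ a 2≤a d {c} → c < N →
             kernel (C (suc (suc a)) 2≤a) a d c ≈ A d c * T^ (suc a) (λ b → δ b c) d
  kernel-C a 2≤a d {c} c<N = begin
    W a (λ u → ind (properList? (C (suc (suc a)) 2≤a) (d ∷ u ++ c ∷ [])) * mono (d ∷ u))
      ≈⟨ W-cong a (λ u u≡ → trans
           (*-congʳ (trans
             (ind-× (properList? (C (suc (suc a)) 2≤a) (d ∷ u ++ c ∷ []))
               (d ≢? c) (linked? _≢?_ (d ∷ u ++ c ∷ []))
               (proper-C⇒ a 2≤a d u c u≡) (λ p q → proper-C⇐ a 2≤a d u c u≡ (p , q)))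
             (*-cong (ind-≢ (d ≢? c) d c id id) (ind-path d (u ++ c ∷ [])))))
           (*-assoc _ _ _)) ⟩
    W a (λ u → A d c * (path d (u ++ c ∷ []) * mono (d ∷ u)))
      ≈⟨ W-*ˡ a _ _ ⟩
    A d c * W a (λ u → path d (u ++ c ∷ []) * mono (d ∷ u))
      ≈⟨ *-congˡ (W-path a d c<N) ⟩
    A d c * T^ (suc a) (λ b → δ b c) d   ∎

  attach-K : ∀ a k {d} (d<N : d < N) →
    ∑ N (λ c → kernel (K (suc (suc a))) a d c * u k c) ≈ nat (a !) * Clique.S d<N k (suc a)
  attach-K a k {d} d<N = trans
    (∑-cong< N (λ c c<N → trans (*-congʳ (kernel-K a d<N c<N))
      (solve 4 (λ n p v w → (n :* (p :* v)) :* w := n :* (p :* (v :* w))) refl _ _ _ _)))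
    (∑-*ˡ N _ _)

  attach-C : ∀ a 2≤a k {d} → d < N →
    ∑ N (λ c → kernel (C (suc (suc a)) 2≤a) a d c * u (suc k) c) ≈
    u (suc (suc a) ℕ.+ k) d + ∑ (suc a) (λ j → κ a j * H k j d)
  attach-C a 2≤a k {d} d<N = trans
    (∑-cong< N (λ c c<N → *-congʳ (kernel-C a 2≤a d c<N)))
    (cycle-u a k d<N)

-- Positive combinations and their stability under gluing

open CommutativeSemigroupProperties using (interchange; x∙yz≈y∙xz)

module PR (N : ℕ) = RootedSums (Poly N) N (var N)

open +-*-Solver using (_:+_; _:=_; con) renaming (solve to solveℕ)

-- Polynomials in the e_k with coefficients in ℕ, homogeneous of degree n,
-- and their linear combinations in which the coefficients are
-- multiplied by some u_k.

data EPos : ℕ → (∀ N → P.Carrier N) → Set where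
  0-pos : ∀ {n} → EPos n P.0#
  1-pos : EPos 0 P.1#
  e-pos : ∀ k → EPos k (λ N → PR.e N k)
  +-pos : ∀ {n f g} → EPos n f → EPos n g → EPos n (λ N → P._+_ N (f N) (g N))
  *-pos : ∀ {m n f g} → EPos m f → EPos n g → EPos (m ℕ.+ n) (λ N → P._*_ N (f N) (g N))
  ≈-pos : ∀ {n f g} → (∀ N → P._≈_ N (f N) (g N)) → EPos n f → EPos n g

data RootPos : ℕ → (∀ N → ℕ → P.Carrier N) → Set where
  0-pos : ∀ {n} → RootPos n (λ N d → P.0# N)
  u-pos : ∀ k {m f} → EPos m f → RootPos (k ℕ.+ m) (λ N d → P._*_ N (PR.u N k d) (f N))
  +-pos : ∀ {n F G} → RootPos n F → RootPos n G → RootPos n (λ N d → P._+_ N (F N d) (G N d))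
  ≈-pos : ∀ {n F G} → (∀ N d → d < N → P._≈_ N (F N d) (G N d)) → RootPos n F → RootPos n G

degree : ∀ {m n f} → m ≡ n → EPos m f → EPos n f
degree ≡.refl p = p

rootDegree : ∀ {m n F} → m ≡ n → RootPos m F → RootPos n F
rootDegree ≡.refl p = p

nat-pos : ∀ {n f} k → EPos n f → EPos n (λ N → P._*_ N (PR.nat N k) (f N))
nat-pos zero    p = ≈-pos (λ N → P.sym N (P.zeroˡ N _)) 0-pos
nat-pos (suc k) p = ≈-pos
  (λ N → P.sym N (P.trans N (P.distribʳ N _ _ _) (P.+-congʳ N (P.*-identityˡ N _))))
  (+-pos p (nat-pos k p))

∑-pos : ∀ {n} k (f : ∀ N → ℕ → P.Carrier N) → (∀ i → i < k → EPos n (λ N → f N i)) →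
        EPos n (λ N → PR.∑ N k (f N))
∑-pos zero    f p = 0-pos
∑-pos (suc k) f p = +-pos (p 0 (s≤s z≤n)) (∑-pos k _ (λ i i<k → p (suc i) (s≤s i<k)))

rootNat-pos : ∀ {n F} k → RootPos n F → RootPos n (λ N d → P._*_ N (PR.nat N k) (F N d))
rootNat-pos zero    p = ≈-pos (λ N d _ → P.sym N (P.zeroˡ N _)) 0-pos
rootNat-pos (suc k) p = ≈-pos
  (λ N d _ → P.sym N (P.trans N (P.distribʳ N _ _ _) (P.+-congʳ N (P.*-identityˡ N _))))
  (+-pos p (rootNat-pos k p))

root∑-pos : ∀ {n} k (F : ∀ N → ℕ → ℕ → P.Carrier N) →
            (∀ i → i < k → RootPos n (λ N d → F N i d)) →
            RootPos n (λ N d → PR.∑ N k (λ i → F N i d))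
root∑-pos zero    F p = 0-pos
root∑-pos (suc k) F p =
  +-pos (p 0 (s≤s z≤n)) (root∑-pos k (λ N i → F N (suc i)) (λ i i<k → p (suc i) (s≤s i<k)))

root*-pos : ∀ {m n f F} → EPos m f → RootPos n F → RootPos (m ℕ.+ n) (λ N d → P._*_ N (f N) (F N d))
root*-pos f 0-pos       = ≈-pos (λ N d _ → P.sym N (P.zeroʳ N _)) 0-pos
root*-pos {m} f (u-pos k {l} g) = rootDegree
  (solveℕ 3 (λ k m l → k :+ (m :+ l) :=
     m :+ (k :+ l)) ≡.refl k m l)
  (≈-pos (λ N d _ → x∙yz≈y∙xz (P.*-commutativeSemigroup N) _ _ _)
    (u-pos k (*-pos f g)))
root*-pos f (+-pos p q) = ≈-pos (λ N d _ → P.sym N (P.distribˡ N _ _ _))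
  (+-pos (root*-pos f p) (root*-pos f q))
root*-pos f (≈-pos eq p) = ≈-pos (λ N d d<N → P.*-congˡ N (eq N d d<N)) (root*-pos f p)

ue-pos : ∀ {n} j l → j ℕ.+ l ≡ n → RootPos n (λ N d → P._*_ N (PR.u N j d) (PR.e N l))
ue-pos j l eq = rootDegree eq (u-pos j (e-pos l))

total-pos : ∀ {n F} → RootPos n F → EPos n (λ N → PR.∑ N N (F N))
total-pos 0-pos = ≈-pos (λ N → P.sym N (PR.∑-0 N N)) 0-pos
total-pos (u-pos k f) = ≈-pos
  (λ N → P.sym N (P.trans N (PR.∑-*ʳ N N _ _) (P.*-congʳ N (PR.∑-u N k))))
  (*-pos (nat-pos k (e-pos k)) f)
total-pos (+-pos p q) = ≈-pos (λ N → P.sym N (PR.∑-+ N N _ _)) (+-pos (total-pos p) (total-pos q))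
total-pos (≈-pos eq p) = ≈-pos (λ N → PR.∑-cong< N N (eq N)) (total-pos p)

-- The coefficient f of a generator does not involve the colour c, so it leaves the sum over c and
-- only the action on `u` k has to be known. Here s is the number of vertices added.
attach-pos : ∀ {s} (κ : ∀ N → ℕ → ℕ → P.Carrier N) →
  (∀ k → RootPos (s ℕ.+ k) (λ N d → PR.∑ N N (λ c → P._*_ N (κ N d c) (PR.u N k c)))) →
  ∀ {n F} → RootPos n F → RootPos (s ℕ.+ n) (λ N d → PR.∑ N N (λ c → P._*_ N (κ N d c) (F N c)))
attach-pos κ base 0-pos = ≈-pos
  (λ N d _ → P.sym N (P.trans N (PR.∑-cong N N (λ c → P.zeroʳ N _)) (PR.∑-0 N N))) 0-pos
attach-pos {s} κ base (u-pos k {m} {f} p) = rootDegree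
  (solveℕ 3 (λ m s k → m :+ (s :+ k) :=
     s :+ (k :+ m)) ≡.refl m s k)
  (≈-pos (λ N d _ → P.trans N (P.*-comm N _ _) (P.trans N (P.sym N (PR.∑-*ʳ N N (f N) _))
      (PR.∑-cong N N (λ c → P.*-assoc N _ _ _))))
    (root*-pos p (base k)))
attach-pos κ base (+-pos p q) = ≈-pos
  (λ N d _ → P.trans N (P.sym N (PR.∑-+ N N _ _)) (PR.∑-cong N N (λ c → P.sym N (P.distribˡ N _ _ _))))
  (+-pos (attach-pos κ base p) (attach-pos κ base q))
attach-pos κ base (≈-pos eq p) = ≈-pos
  (λ N d _ → PR.∑-cong< N N (λ c c<N → P.*-congˡ N (eq N c c<N))) (attach-pos κ base p)

-- The path on m + 1 vertices has degree m + 1, of which `u` (j + 1) accounts for j + 1; this fixes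
-- the degree m - j.
κ-pos : ∀ m j {n} → n ℕ.+ j ≡ m → EPos n (λ N → PR.κ N m j)
κ-pos zero    zero    {zero} _  = 1-pos
κ-pos (suc m) (suc j) {n} eq = κ-pos m j (ℕ.suc-injective (≡.trans (≡.sym (ℕ.+-suc n j)) eq))
κ-pos (suc m) zero    {n} eq = ∑-pos (suc m) _ (λ j j<1+m →
  degree (≡.trans (cong suc (ℕ.m+[n∸m]≡n (ℕ.s≤s⁻¹ j<1+m))) (≡.trans (≡.sym eq) (ℕ.+-identityʳ n)))
    (*-pos (nat-pos j (e-pos (suc j))) (κ-pos m j (ℕ.m∸n+n≡m (ℕ.s≤s⁻¹ j<1+m)))))

private
  u*e-degree : ∀ k j i → i ≤ j → suc i ℕ.+ suc (k ℕ.+ j ∸ i) ≡ suc k ℕ.+ suc j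
  u*e-degree k j i i≤j = cong suc (≡.trans (ℕ.+-suc i _) (≡.trans
    (cong suc (ℕ.m+[n∸m]≡n (ℕ.≤-trans i≤j (ℕ.m≤n+m j k)))) (≡.sym (ℕ.+-suc k j))))

  H-pos′ : ∀ k j t r → t ℕ.+ r ≡ suc j → t ≤ suc k → t ≡ suc k ⊎ t ≡ suc j →
           RootPos (suc k ℕ.+ suc j) (λ N d → PR.H N k j d)
  H-pos′ k j t r t+r t≤ t≡ = ≈-pos (λ N d _ → P.sym N (PR.H-positive N k j t r d t+r t≤ t≡))
    (+-pos
      (+-pos
        (root∑-pos t _ (λ i i<t → rootNat-pos (k ∸ i) (ue-pos (suc i) _
          (u*e-degree k j i (ℕ.s≤s⁻¹ (ℕ.≤-trans i<t t≤1+j))))))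
        (root∑-pos r _ (λ i i<r → rootNat-pos (k ℕ.+ j ∸ (t ℕ.+ i)) (ue-pos (suc (t ℕ.+ i)) _
          (u*e-degree k j (t ℕ.+ i)
            (ℕ.s≤s⁻¹ (≡.subst (t ℕ.+ i <_) t+r (ℕ.+-monoʳ-< t i<r))))))))
      (rootNat-pos j (root∑-pos t _ (λ i i<t → ue-pos (suc k ℕ.+ suc j ∸ i) i
        (ℕ.m∸n+n≡m (ℕ.≤-trans (ℕ.<⇒≤ i<t) (ℕ.≤-trans t≤1+j (ℕ.m≤n+m (suc j) (suc k)))))))))
    where
    t≤1+j : t ≤ suc j
    t≤1+j = ≡.subst (t ≤_) t+r (ℕ.m≤m+n t r)

-- The comparison of j and k selects the smaller index, at which the product is expanded.
H-pos : ∀ k j → RootPos (suc k ℕ.+ suc j) (λ N d → PR.H N k j d)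
H-pos k j with ℕ.≤-total j k
... | inj₁ j≤k = H-pos′ k j (suc j) 0 (ℕ.+-identityʳ _) (s≤s j≤k) (inj₂ ≡.refl)
... | inj₂ k≤j = H-pos′ k j (suc k) (j ∸ k) (cong suc (ℕ.m+[n∸m]≡n k≤j)) ℕ.≤-refl (inj₁ ≡.refl)

-- Of the a + 2 vertices of the clique one is shared, hence the degree. Which of the two expansions
-- of `S` k (a + 1) is visibly positive depends on the comparison of a + 1 with k.
attach-K-pos : ∀ a k → RootPos (suc a ℕ.+ k)
  (λ N d → PR.∑ N N (λ c → P._*_ N (PR.kernel N (K (suc (suc a))) a d c) (PR.u N k c)))
attach-K-pos a k = rootDegree (ℕ.+-comm k (suc a)) (pos (ℕ.≤-total (suc a) k))
  where
  terms : ∀ m → m ≤ k ℕ.+ suc a → RootPos (k ℕ.+ suc a) (λ N d → PR.∑ N m (λ j → P._+_ N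
    (P._*_ N (PR.nat N (k ∸ j)) (P._*_ N (PR.u N j d) (PR.e N (k ℕ.+ suc a ∸ j))))
    (P._*_ N (PR.nat N (suc a ∸ j)) (P._*_ N (PR.u N (k ℕ.+ suc a ∸ j) d) (PR.e N j)))))
  terms m m≤ = root∑-pos m _ (λ j j<m →
    let j≤ = ℕ.≤-trans (ℕ.<⇒≤ j<m) m≤
    in +-pos (rootNat-pos (k ∸ j) (ue-pos j _ (ℕ.m+[n∸m]≡n j≤)))
             (rootNat-pos (suc a ∸ j) (ue-pos _ j (ℕ.m∸n+n≡m j≤))))
  pos : suc a ≤ k ⊎ k ≤ suc a → RootPos (k ℕ.+ suc a)
    (λ N d → PR.∑ N N (λ c → P._*_ N (PR.kernel N (K (suc (suc a))) a d c) (PR.u N k c)))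
  pos (inj₁ a<k) = ≈-pos
    (λ N d d<N → P.sym N (P.trans N (PR.attach-K N a k d<N)
      (P.*-congˡ N (PR.Clique.S-positive₁ N d<N k (suc a) a<k))))
    (rootNat-pos (a !) (+-pos (terms (suc a) (ℕ.m≤n+m (suc a) k))
      (rootNat-pos (k ∸ suc a) (ue-pos (suc a) k (ℕ.+-comm (suc a) k)))))
  pos (inj₂ k≤a) = ≈-pos
    (λ N d d<N → P.sym N (P.trans N (PR.attach-K N a k d<N)
      (P.*-congˡ N (PR.Clique.S-positive₂ N d<N k (suc a) k≤a))))
    (rootNat-pos (a !) (terms k (ℕ.m≤m+n k (suc a))))

attach-C-pos : ∀ a 2≤a k → RootPos (suc a ℕ.+ k)
  (λ N d → PR.∑ N N (λ c → P._*_ N (PR.kernel N (C (suc (suc a)) 2≤a) a d c) (PR.u N k c)))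
-- `u` 0 is zero, and `attach-C` starts at `u` 1.
attach-C-pos a 2≤a zero    = ≈-pos
  (λ N d _ → P.sym N (P.trans N (PR.∑-cong N N (λ c → P.zeroʳ N _)) (PR.∑-0 N N))) 0-pos
attach-C-pos a 2≤a (suc k) = ≈-pos (λ N d d<N → P.sym N (PR.attach-C N a 2≤a k d<N))
  (+-pos
    (rootDegree (≡.trans (ℕ.+-identityʳ _) (≡.sym (ℕ.+-suc (suc a) k)))
      (≈-pos (λ N d _ → P.*-identityʳ N _) (u-pos (suc (suc a) ℕ.+ k) 1-pos)))
    (root∑-pos (suc a) _ (λ j j<1+a → rootDegree (deg j (ℕ.s≤s⁻¹ j<1+a))
      (root*-pos (κ-pos a j (ℕ.m∸n+n≡m (ℕ.s≤s⁻¹ j<1+a))) (H-pos k j)))))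
  where
  deg : ∀ j → j ≤ a → (a ∸ j) ℕ.+ (suc k ℕ.+ suc j) ≡ suc a ℕ.+ suc k
  deg j j≤a = ≡.trans
    (solveℕ 3 (λ a k j → a :+ (k :+ (con 1 :+ j))
       := (con 1 :+ (a :+ j)) :+ k)
       ≡.refl (a ∸ j) (suc k) j)
    (cong (λ b → suc b ℕ.+ suc k) (ℕ.m∸n+n≡m j≤a))

-- Induction along the chain

Rooted : Graph → Set
Rooted G = ∃ λ b → order G ≡ suc b × RootPos (suc b) (λ N → PR.rooted N G)

vertex-pos : RootPos 1 var
vertex-pos = ≈-pos (λ N d _ → P.trans N (P.*-identityʳ N _) (PR.u-1 N d)) (u-pos 1 1-pos)

module _ (G : Graph) {a} (G≡ : order G ≡ suc (suc a))
  (base : ∀ k → RootPos (suc a ℕ.+ k)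
            (λ N d → PR.∑ N N (λ c → P._*_ N (PR.kernel N G a d c) (PR.u N k c)))) where

  rooted-single : Rooted G
  rooted-single = suc a , G≡ , rootDegree (ℕ.+-comm (suc a) 1)
    (≈-pos (λ N d _ → P.sym N (PR.rooted-kernel N G G≡ d))
      (attach-pos (λ N → PR.kernel N G a) base vertex-pos))

  rooted-attach : ∀ H → Rooted H → Rooted (G ⊕ H)
  rooted-attach H (b , H≡ , p) = suc a ℕ.+ b ,
    ≡.trans (cong₂ (λ g h → g ℕ.+ h ∸ 1) G≡ H≡) (ℕ.+-suc (suc a) b) ,
    rootDegree (ℕ.+-suc (suc a) b)
      (≈-pos (λ N d _ → P.sym N (PR.rooted-⊕ N G H G≡ H≡ d))
        (attach-pos (λ N → PR.kernel N G a) base p))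

piece-rooted : ∀ {G} → CliqueOrCycle G → Rooted G
piece-rooted (clique 1 _) =
  0 , ≡.refl , ≈-pos (λ N d _ → P.sym N (PR.rooted-K₁ N d)) vertex-pos
piece-rooted (clique (suc (suc a)) _) = rooted-single (K (suc (suc a))) ≡.refl (attach-K-pos a)
piece-rooted (cycle 1 (s≤s ()))
piece-rooted (cycle (suc (suc a)) 2≤a) =
  rooted-single (C (suc (suc a)) 2≤a) ≡.refl (attach-C-pos a 2≤a)

⊕-rooted : ∀ {G} → CliqueOrCycle G → ∀ H → Rooted H → Rooted (G ⊕ H)
⊕-rooted (clique 1 _) H (b , H≡ , p) =
  b , H≡ , ≈-pos (λ N d _ → P.sym N (PR.rooted-K₁⊕ N H H≡ d)) p
⊕-rooted (clique (suc (suc a)) _) = rooted-attach (K (suc (suc a))) ≡.refl (attach-K-pos a)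
⊕-rooted (cycle 1 (s≤s ()))
⊕-rooted (cycle (suc (suc a)) 2≤a) =
  rooted-attach (C (suc (suc a)) 2≤a) ≡.refl (attach-C-pos a 2≤a)

-- The chain is built from its right end: each new piece is glued by its last vertex to the current
-- root, and its first vertex becomes the new root.
chain-rooted : ∀ {G Gs} → CliqueOrCycle G → ListAll CliqueOrCycle Gs → Rooted (chain (G ∷ Gs))
chain-rooted p []       = piece-rooted p
chain-rooted {Gs = H ∷ Hs} p (q ∷ qs) = ⊕-rooted p (chain (H ∷ Hs)) (chain-rooted q qs)

chromatic : Graph → ∀ N → P.Carrier N
chromatic G N = PR.W N (order G) (PR.weight N G)

-- Every colouring gives the root exactly one colour, so the rooted series add up to the whole.
chain-pos : ∀ {Gs} → All CliqueOrCycle Gs → EPos (order (chain Gs)) (chromatic (chain Gs))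
chain-pos {Gs} (p ∷ ps) with chain-rooted p ps
... | b , H≡ , p = degree (≡.sym H≡) (≈-pos (λ N → P.reflexive N (rooted-total N)) (total-pos p))
  where
  rooted-total : ∀ N → PR.∑ N N (PR.rooted N (chain Gs)) ≡ chromatic (chain Gs) N
  rooted-total N = ≡.trans
    (cong (λ o → PR.∑ N N (λ d → PR.W N (o ∸ 1) (λ w → PR.weight N (chain Gs) (d ∷ w)))) H≡)
    (cong (λ o → PR.W N o (PR.weight N (chain Gs))) (≡.sym H≡))

X-coeff : ∀ G N α → X G N α ≡ coeff N (chromatic G N) α
X-coeff G = sumOfMonomials-W (proper? G) (properList? G) (proper⇒properList G) (properList⇒proper G)

-- From positive combinations to nonnegative coefficients

eSum : ∀ N → List (List ℕ) → P.Carrier N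
eSum N = foldr (λ μ s → P._+_ N (eMono N μ) s) (P.0# N)

eMono-++ : ∀ N μ ν → P._≈_ N (eMono N (μ ++ ν)) (P._*_ N (eMono N μ) (eMono N ν))
eMono-++ N []      ν = P.sym N (P.*-identityˡ N _)
eMono-++ N (k ∷ μ) ν = P.trans N (P.*-congˡ N (eMono-++ N μ ν)) (P.sym N (P.*-assoc N _ _ _))

eSum-++ : ∀ N L M → P._≈_ N (eSum N (L ++ M)) (P._+_ N (eSum N L) (eSum N M))
eSum-++ N []      M = P.sym N (P.+-identityˡ N _)
eSum-++ N (μ ∷ L) M = P.trans N (P.+-congˡ N (eSum-++ N L M)) (P.sym N (P.+-assoc N _ _ _))

eSum-* : ∀ N L M → P._≈_ N (eSum N (cartesianProductWith _++_ L M)) (P._*_ N (eSum N L) (eSum N M))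
eSum-* N []      M = P.sym N (P.zeroˡ N _)
eSum-* N (μ ∷ L) M = P.trans N (eSum-++ N (List.map (μ ++_) M) _)
  (P.trans N (P.+-cong N (scale M) (eSum-* N L M)) (P.sym N (P.distribʳ N _ _ _)))
  where
  scale : ∀ M → P._≈_ N (eSum N (List.map (μ ++_) M)) (P._*_ N (eMono N μ) (eSum N M))
  scale []      = P.sym N (P.zeroʳ N _)
  scale (ν ∷ M) = P.trans N (P.+-cong N (eMono-++ N μ ν) (scale M)) (P.sym N (P.distribˡ N _ _ _))

-- Multiplying out the derivation gives a list of monomials with repetitions. The list is chosen
-- before N, so it serves all numbers of variables at once.
eExpansion : ∀ {n f} → EPos n f →
  ∃ λ L → ListAll (λ μ → sum μ ≡ n) L × (∀ N → P._≈_ N (f N) (eSum N L))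
eExpansion 0-pos = [] , [] , λ N → P.refl N
eExpansion 1-pos = ([] ∷ []) , (≡.refl ∷ []) , λ N → P.sym N (P.+-identityʳ N _)
eExpansion (e-pos k) = ((k ∷ []) ∷ []) , (ℕ.+-identityʳ k ∷ []) ,
  λ N → P.sym N (P.trans N (P.+-identityʳ N _) (P.*-identityʳ N _))
eExpansion (+-pos p q) with eExpansion p | eExpansion q
... | L , L-deg , f≈ | M , M-deg , g≈ = L ++ M , ListAll.++⁺ L-deg M-deg ,
  λ N → P.trans N (P.+-cong N (f≈ N) (g≈ N)) (P.sym N (eSum-++ N L M))
eExpansion (*-pos {m} {n} p q) with eExpansion p | eExpansion q
... | L , L-deg , f≈ | M , M-deg , g≈ = cartesianProductWith _++_ L M , product-deg L-deg ,
  λ N → P.trans N (P.*-cong N (f≈ N) (g≈ N)) (P.sym N (eSum-* N L M))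
  where
  product-deg : ∀ {L} → ListAll (λ μ → sum μ ≡ m) L →
                ListAll (λ μ → sum μ ≡ m ℕ.+ n) (cartesianProductWith _++_ L M)
  product-deg [] = []
  product-deg {μ ∷ _} (refl-μ ∷ L-deg) = ListAll.++⁺
    (ListAll.map⁺ (ListAll.map (λ {ν} eq → ≡.trans (ℕ.sum-++ μ ν) (cong₂ ℕ._+_ refl-μ eq)) M-deg))
    (product-deg L-deg)
eExpansion (≈-pos eq p) with eExpansion p
... | L , L-deg , f≈ = L , L-deg , λ N → P.trans N (P.sym N (eq N)) (f≈ N)

-- The partition of a monomial in the e_k

toPartition : List ℕ → List ℕ
toPartition μ = sort (filter (1 ℕ.≤?_) μ)

toPartition-partition : ∀ μ → IsPartition (sum μ) (toPartition μ)
toPartition-partition μ =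
  All-resp-↭ (↭-sym (sort-↭ _)) (ListAll.all-filter (1 ℕ.≤?_) μ) ,
  sort-↗ _ ,
  ≡.trans (ℕ.sum-↭ (sort-↭ (filter (1 ℕ.≤?_) μ))) (sum-filter μ)
  where
  sum-filter : ∀ μ → sum (filter (1 ℕ.≤?_) μ) ≡ sum μ
  sum-filter []          = ≡.refl
  sum-filter (zero ∷ μ)  = sum-filter μ
  sum-filter (suc k ∷ μ) = cong (suc k ℕ.+_) (sum-filter μ)

eMono-↭ : ∀ N {μ ν} → μ ↭ ν → P._≈_ N (eMono N μ) (eMono N ν)
eMono-↭ N ↭-refl          = P.refl N
eMono-↭ N (↭-prep k p)    = P.*-congˡ N (eMono-↭ N p)
eMono-↭ N (↭-swap k l p)  = P.trans N (P.sym N (P.*-assoc N _ _ _)) (P.trans N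
  (P.*-cong N (P.*-comm N _ _) (eMono-↭ N p)) (P.*-assoc N _ _ _))
eMono-↭ N (↭-trans p q)   = P.trans N (eMono-↭ N p) (eMono-↭ N q)

eMono-toPartition : ∀ N μ → P._≈_ N (eMono N (toPartition μ)) (eMono N μ)
eMono-toPartition N μ = P.trans N (eMono-↭ N (sort-↭ (filter (1 ℕ.≤?_) μ))) (eMono-filter μ)
  where
  eMono-filter : ∀ μ → P._≈_ N (eMono N (filter (1 ℕ.≤?_) μ)) (eMono N μ)
  eMono-filter []          = P.refl N
  -- A part 0 stands for the factor `e` 0, which is 1.
  eMono-filter (zero ∷ μ)  = P.trans N (eMono-filter μ) (P.sym N (P.*-identityˡ N _))
  eMono-filter (suc k ∷ μ) = P.*-congˡ N (eMono-filter μ)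

-- Summation over partitions

sumOver-filter : ∀ {A : Set} {Q : A → Set} (Q? : Unary.Decidable Q) xs (f : A → ℤ) →
                 sumOver (filter Q? xs) f ≡ sumOver xs (λ a → χ (Q? a) ℤ.* f a)
sumOver-filter Q? []       f = ≡.refl
sumOver-filter Q? (a ∷ xs) f with Q? a
... | yes _ = cong₂ ℤ._+_ (≡.sym (ℤ.*-identityˡ (f a))) (sumOver-filter Q? xs f)
... | no  _ = ≡.trans (sumOver-filter Q? xs f) (≡.sym (ℤ.+-identityˡ _))

sumOver-concatMap : ∀ {A B : Set} (h : A → List B) xs (f : B → ℤ) →
                    sumOver (concatMap h xs) f ≡ sumOver xs (λ a → sumOver (h a) f)
sumOver-concatMap h []       f = ≡.refl
sumOver-concatMap h (a ∷ xs) f = ≡.trans (sumOver-++ (h a) _ f)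
  (cong (ℤ._+_ (sumOver (h a) f)) (sumOver-concatMap h xs f))

sumOver-*ˡ : ∀ {A : Set} (xs : List A) a (f : A → ℤ) →
             sumOver xs (λ b → a ℤ.* f b) ≡ a ℤ.* sumOver xs f
sumOver-*ˡ []       a f = ≡.sym (ℤ.*-zeroʳ a)
sumOver-*ˡ (b ∷ xs) a f = ≡.trans (cong (ℤ._+_ (a ℤ.* f b)) (sumOver-*ˡ xs a f))
  (≡.sym (ℤ.*-distribˡ-+ a (f b) _))

sumOver-*ʳ : ∀ {A : Set} (xs : List A) a (f : A → ℤ) →
             sumOver xs (λ b → f b ℤ.* a) ≡ sumOver xs f ℤ.* a
sumOver-*ʳ xs a f = ≡.trans (sumOver-cong xs (λ b → ℤ.*-comm (f b) a))
  (≡.trans (sumOver-*ˡ xs a f) (ℤ.*-comm a _))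

sumOver-0 : ∀ {A : Set} (xs : List A) → sumOver xs (λ _ → 0ℤ) ≡ 0ℤ
sumOver-0 []       = ≡.refl
sumOver-0 (a ∷ xs) = ≡.trans (ℤ.+-identityˡ _) (sumOver-0 xs)

sumOver-+ : ∀ {A : Set} (xs : List A) (f g : A → ℤ) →
            sumOver xs (λ a → f a ℤ.+ g a) ≡ sumOver xs f ℤ.+ sumOver xs g
sumOver-+ []       f g = ≡.refl
sumOver-+ (a ∷ xs) f g = ≡.trans (cong (ℤ._+_ (f a ℤ.+ g a)) (sumOver-+ xs f g))
  (interchange ℤ.+-commutativeSemigroup (f a) (g a) _ _)

sumOver-swap : ∀ {A B : Set} (xs : List A) (ys : List B) (f : A → B → ℤ) →
  sumOver xs (λ a → sumOver ys (f a)) ≡ sumOver ys (λ b → sumOver xs (λ a → f a b))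
sumOver-swap []       ys f = ≡.sym (sumOver-0 ys)
sumOver-swap (a ∷ xs) ys f = ≡.trans (cong (ℤ._+_ (sumOver ys (f a))) (sumOver-swap xs ys f))
  (≡.sym (sumOver-+ ys (f a) _))

sumOver-applyUpTo-∑ : ∀ n (h : ℕ → ℕ) (f : ℕ → ℤ) →
  sumOver (applyUpTo h n) f ≡ Sums.∑ ℤ.+-*-commutativeRing n (f ∘ h)
sumOver-applyUpTo-∑ zero    h f = ≡.refl
sumOver-applyUpTo-∑ (suc n) h f = cong (ℤ._+_ (f (h 0))) (sumOver-applyUpTo-∑ n (h ∘ suc) f)

sumOver-upTo-χ : ∀ n {r} (f : ℕ → ℤ) → r < n → sumOver (upTo n) (λ c → χ (r ℕ.≟ c) ℤ.* f c) ≡ f r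
sumOver-upTo-χ n {r} f r<n = ≡.trans (sumOver-applyUpTo-∑ n id _) (≡.trans
  (ℤΣ.∑-cong n (λ c → cong (ℤ._* f c) (χ≡ind (r ℕ.≟ c)))) (ℤΣ.∑-δ n f r<n))
  where
  module ℤΣ = Sums ℤ.+-*-commutativeRing
  χ≡ind : ∀ {Q : Set} (d : Dec Q) → χ d ≡ ℤΣ.ind d
  χ≡ind (yes _) = ≡.refl
  χ≡ind (no _)  = ≡.refl

infix 4 _≟ˡ_
_≟ˡ_ : ∀ (μ ν : List ℕ) → Dec (μ ≡ ν)
_≟ˡ_ = List.≡-dec ℕ._≟_

χ-× : ∀ {P Q S : Set} (d : Dec S) (p : Dec P) (q : Dec Q) →
      (S → P × Q) → (P → Q → S) → χ d ≡ χ p ℤ.* χ q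
χ-× d (yes p) q f g = ≡.trans (χ-⇔ d q (proj₂ ∘ f) (g p)) (≡.sym (ℤ.*-identityˡ (χ q)))
χ-× d (no ¬p) q f g = χ-no d (¬p ∘ proj₁ ∘ f)

χ-∷ : ∀ r c ρ μ → χ (r ∷ ρ ≟ˡ c ∷ μ) ≡ χ (r ℕ.≟ c) ℤ.* χ (ρ ≟ˡ μ)
χ-∷ r c ρ μ = χ-× (r ∷ ρ ≟ˡ c ∷ μ) (r ℕ.≟ c) (ρ ≟ˡ μ) List.∷-injective (cong₂ _∷_)

-- Over the alphabet of letters below M, the list ρ is spelled by exactly one word of its own length
-- and by none of any other length.
sumOver-words-χ : ∀ M k ρ → ListAll (_< M) ρ → (f : List ℕ → ℤ) →
  sumOver (words (upTo M) k) (λ w → χ (ρ ≟ˡ toList w) ℤ.* f (toList w)) ≡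
  χ (length ρ ℕ.≟ k) ℤ.* f ρ
sumOver-words-χ M zero    []      _        f = ℤ.+-identityʳ _
sumOver-words-χ M zero    (r ∷ ρ) _        f = ≡.refl
sumOver-words-χ M (suc k) []      _        f = ≡.trans
  (sumOver-cartesianProductWith _∷_ (upTo M) (words (upTo M) k)
    (λ w → χ ([] ≟ˡ toList w) ℤ.* f (toList w)))
  (≡.trans (sumOver-cong (upTo M) (λ c → sumOver-0 (words (upTo M) k))) (sumOver-0 (upTo M)))
sumOver-words-χ M (suc k) (r ∷ ρ) (r< ∷ ρ<) f = begin
  sumOver (words (upTo M) (suc k)) (λ w → χ (r ∷ ρ ≟ˡ toList w) ℤ.* f (toList w))
    ≡⟨ sumOver-cartesianProductWith _∷_ (upTo M) (words (upTo M) k)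
         (λ w → χ (r ∷ ρ ≟ˡ toList w) ℤ.* f (toList w)) ⟩
  sumOver (upTo M) (λ c → sumOver (words (upTo M) k)
    (λ w → χ (r ∷ ρ ≟ˡ c ∷ toList w) ℤ.* f (c ∷ toList w)))
    ≡⟨ sumOver-cong (upTo M) (λ c → ≡.trans
         (sumOver-cong (words (upTo M) k) (λ w → ≡.trans
           (cong (ℤ._* f (c ∷ toList w)) (χ-∷ r c ρ (toList w)))
           (ℤ.*-assoc (χ (r ℕ.≟ c)) _ _)))
         (≡.trans (sumOver-*ˡ (words (upTo M) k) (χ (r ℕ.≟ c)) _)
           (cong (χ (r ℕ.≟ c) ℤ.*_) (sumOver-words-χ M k ρ ρ< (f ∘ (c ∷_)))))) ⟩
  sumOver (upTo M) (λ c → χ (r ℕ.≟ c) ℤ.* (χ (length ρ ℕ.≟ k) ℤ.* f (c ∷ ρ)))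
    ≡⟨ sumOver-upTo-χ M _ r< ⟩
  χ (length ρ ℕ.≟ k) ℤ.* f (r ∷ ρ)
    ≡⟨ cong (ℤ._* f (r ∷ ρ)) (χ-⇔ (length ρ ℕ.≟ k) (suc (length ρ) ℕ.≟ suc k)
         (cong suc) ℕ.suc-injective) ⟩
  χ (suc (length ρ) ℕ.≟ suc k) ℤ.* f (r ∷ ρ)   ∎
  where open ≡.≡-Reasoning

length≤sum : ∀ {μ} → ListAll (1 ≤_) μ → length μ ≤ sum μ
length≤sum []       = z≤n
length≤sum (p ∷ ps) = ℕ.+-mono-≤ p (length≤sum ps)

parts≤sum : ∀ μ → ListAll (_≤ sum μ) μ
parts≤sum []      = []
parts≤sum (k ∷ μ) = ℕ.m≤m+n k (sum μ) ∷ ListAll.map (λ p → ℕ.≤-trans p (ℕ.m≤n+m (sum μ) k)) (parts≤sum μ)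

-- A partition of n has parts at most n, and at most n of them because each is at least 1. So ρ lies
-- within the range that is searched, and is found there once.
sumOver-partitions-χ : ∀ n ρ → IsPartition n ρ → (f : List ℕ → ℤ) →
  sumOver (partitions n) (λ μ → χ (ρ ≟ˡ μ) ℤ.* f μ) ≡ f ρ
sumOver-partitions-χ n ρ isP@(ρ≥1 , _ , sum≡) f = begin
  sumOver (partitions n) (λ μ → χ (ρ ≟ˡ μ) ℤ.* f μ)
    ≡⟨ sumOver-filter (isPartition? n) (concatMap ws (upTo M)) (λ μ → χ (ρ ≟ˡ μ) ℤ.* f μ) ⟩
  sumOver (concatMap ws (upTo M)) h
    ≡⟨ sumOver-concatMap ws (upTo M) h ⟩
  sumOver (upTo M) (λ k → sumOver (ws k) h)
    ≡⟨ sumOver-cong (upTo M) (λ k → ≡.trans (sumOver-map toList (words (upTo M) k) h)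
         (≡.trans (sumOver-cong (words (upTo M) k) (λ w → h≡ (toList w)))
           (sumOver-words-χ M k ρ ρ<M g))) ⟩
  sumOver (upTo M) (λ k → χ (length ρ ℕ.≟ k) ℤ.* g ρ)
    ≡⟨ sumOver-upTo-χ M (λ _ → g ρ) (s≤s (≡.subst (length ρ ≤_) sum≡ (length≤sum ρ≥1))) ⟩
  χ (isPartition? n ρ) ℤ.* f ρ
    ≡⟨ cong (ℤ._* f ρ) (χ-yes (isPartition? n ρ) isP) ⟩
  1ℤ ℤ.* f ρ
    ≡⟨ ℤ.*-identityˡ (f ρ) ⟩
  f ρ   ∎
  where
  open ≡.≡-Reasoning
  M : ℕ
  M = suc n
  ws : ℕ → List (List ℕ)
  ws k = List.map toList (words (upTo M) k)
  g : List ℕ → ℤ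
  g μ = χ (isPartition? n μ) ℤ.* f μ
  h : List ℕ → ℤ
  h μ = χ (isPartition? n μ) ℤ.* (χ (ρ ≟ˡ μ) ℤ.* f μ)
  h≡ : ∀ μ → h μ ≡ χ (ρ ≟ˡ μ) ℤ.* g μ
  h≡ μ = x∙yz≈y∙xz ℤ.*-commutativeSemigroup (χ (isPartition? n μ)) (χ (ρ ≟ˡ μ)) (f μ)
  ρ<M : ListAll (_< M) ρ
  ρ<M = ListAll.map (λ p → s≤s (≡.subst (_ ≤_) sum≡ p)) (parts≤sum ρ)

multiplicity : List (List ℕ) → List ℕ → ℤ
multiplicity L μ = sumOver L (λ ν → χ (toPartition ν ≟ˡ μ))

multiplicity≥0 : ∀ L μ → 0ℤ ℤ.≤ multiplicity L μ
multiplicity≥0 []      μ = ℤ.≤-refl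
multiplicity≥0 (ν ∷ L) μ = ℤ.+-mono-≤ (χ≥0 (toPartition ν ≟ˡ μ)) (multiplicity≥0 L μ)
  where
  χ≥0 : ∀ {Q : Set} (d : Dec Q) → 0ℤ ℤ.≤ χ d
  χ≥0 (yes _) = ℤ.+≤+ z≤n
  χ≥0 (no _)  = ℤ.≤-refl

-- After the two summations are exchanged, each monomial of L selects its own partition from the sum
-- over all partitions of n.
eCombination-multiplicity : ∀ n L → ListAll (λ μ → sum μ ≡ n) L → ∀ N α →
  eCombination n (multiplicity L) N α ≡ coeff N (eSum N L) α
eCombination-multiplicity n L deg N α = begin
  sumOver (partitions n) (λ μ → multiplicity L μ ℤ.* e[ μ ] N α)
    ≡⟨ sumOver-cong (partitions n) (λ μ → sumOver-*ʳ L (e[ μ ] N α) (λ ν → χ (toPartition ν ≟ˡ μ))) ⟨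
  sumOver (partitions n) (λ μ → sumOver L (λ ν → χ (toPartition ν ≟ˡ μ) ℤ.* e[ μ ] N α))
    ≡⟨ sumOver-swap (partitions n) L (λ μ ν → χ (toPartition ν ≟ˡ μ) ℤ.* e[ μ ] N α) ⟩
  sumOver L (λ ν → sumOver (partitions n) (λ μ → χ (toPartition ν ≟ˡ μ) ℤ.* e[ μ ] N α))
    ≡⟨ collect deg ⟩
  coeff N (eSum N L) α   ∎
  where
  open ≡.≡-Reasoning
  collect : ∀ {L} → ListAll (λ μ → sum μ ≡ n) L →
    sumOver L (λ ν → sumOver (partitions n) (λ μ → χ (toPartition ν ≟ˡ μ) ℤ.* e[ μ ] N α)) ≡
    coeff N (eSum N L) α
  collect [] = ≡.sym (coeff-0 N α)
  collect {ν ∷ L} (≡.refl ∷ deg) = ≡.trans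
    (cong₂ ℤ._+_
      (≡.trans (sumOver-partitions-χ n (toPartition ν) (toPartition-partition ν) (λ μ → e[ μ ] N α))
        (≡.trans (coeff-e[] (toPartition ν) N α) (coeff-cong N (eMono-toPartition N ν) α)))
      (collect deg))
    (≡.sym (coeff-+ N _ _ α))

mainTheorem3 : (Gs : List⁺ Graph) → All CliqueOrCycle Gs → EPositive (chain Gs)
mainTheorem3 Gs ps with eExpansion (chain-pos ps)
... | L , deg , X≈ = multiplicity L ,
  (λ N α → ≡.trans (X-coeff (chain Gs) N α) (≡.trans (coeff-cong N (X≈ N) α)
    (≡.sym (eCombination-multiplicity (order (chain Gs)) L deg N α)))) ,
  λ μ _ → multiplicity≥0 L μ
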